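{- Let $D$ be a strongly connected digraph with at least two vertices. Then the following statements are equivalent: (i) $\mathrm{dtw}(D)=1$, i.e. $D$ has directed treewidth exactly one; (ii) the cycle hypergraph $\mathcal{C}(D)$ is a hypertree; (iii) $D$ contains neither a bicycle nor $A_4$ as a butterfly minor (that is, no bicycle of any length $\ell\ge 3$ and not the digraph $A_4$).
   Context: All digraphs $D=(V(D),E(D))$ are finite, nonempty and simple: no loops and no parallel edges, but both edges $(u,v)$ and $(v,u)$ may be present (a digon). A directed walk may repeat vertices. A directed cycle has pairwise distinct vertices; a digon is a directed cycle of length $2$. $D$ is strongly connected if for all $u,v\in V(D)$ there is a directed path from $u$ to $v$. Directed treewidth. An arborescence $T$ is an orientation of an undirected tree with a unique vertex $r$ (the root) from which all vertices are reachable; for $t\in V(T)$, $T_t$ is the subgraph of $T$ induced by the vertices reachable from $t$. A directed tree decomposition of $D$ is a triple $(T,\beta,\gamma)$ where $T$ is an arborescence, $\beta:V(T)\to 2^{V(D)}$ is such that the sets $\beta(t)$ form a partition of $V(D)$ into nonempty sets, and $\gamma:E(T)\to 2^{V(D)}$ is such that for every $(d,t)\in E(T)$ the set $\gamma((d,t))$ meets every directed walk in $D$ that starts and ends in $\beta(T_t):=\bigcup_{t'\in V(T_t)}\beta(t')$ and contains a vertex not in $\beta(T_t)$. Put $\Gamma(t):=\beta(t)\cup\bigcup_{e\text{ incident with }t}\gamma(e)$. The width is $\max_{t\in V(T)}|\Gamma(t)|-1$, and $\mathrm{dtw}(D)$ is the minimum width of a directed tree decomposition of $D$. Cycle hypergraph.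 $\mathcal{C}(D)$ is the hypergraph with vertex set $V(D)$ having one hyperedge $V(C)$ for each directed cycle $C$ of $D$ (multiple hyperedges allowed). A hypergraph $H$ is a hypertree if there is a tree $T$ with $V(T)=V(H)$ such that every hyperedge of $H$ induces a subtree (connected subgraph) of $T$. Butterfly minors. An edge $(u,v)$ is butterfly contractible if it is the only outgoing edge of $u$ or the only incoming edge of $v$. Its butterfly contraction identifies $u$ and $v$ into one vertex and deletes resulting loops and parallel edges. $D'$ is a butterfly minor of $D$ if it can be obtained (up to isomorphism) from a subgraph of $D$ by a sequence of butterfly contractions. A bicycle of length $\ell\ge3$ is the digraph obtained from an undirected cycle of length $\ell$ by replacing each edge $uv$ by both $(u,v)$ and $(v,u)$. $A_4$ is the digraph with vertices $v_1,v_2,v_3,v_4$ and edges $(v_1,v_2),(v_2,v_3),(v_3,v_4),(v_4,v_1),(v_1,v_3),(v_3,v_1),(v_2,v_4),(v_4,v_2)$. -}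

module Defs where

open import Data.Bool.Base using (Bool; true; false; T; _∨_)
open import Data.Bool.Properties using (T?; T-∨; ∨-comm)
open import Data.Fin.Base using (Fin; toℕ)
open import Data.Fin.Patterns using (0F; 1F; 2F; 3F)
open import Data.Fin.Properties using (_≟_)
open import Data.Fin.Subset using (Subset; Nonempty; _∈_; _∪_; ⋃; ⁅_⁆; ∣_∣)
open import Data.List.Base using (List; []; _∷_; map; filter; length; allFin; cartesianProduct)
open import Data.List.Extrema.Nat using (max)
open import Data.List.Relation.Unary.Any using (Any)
open import Data.List.Relation.Unary.Unique.Propositional using (Unique)
open import Data.Nat.Base using (ℕ; suc; _∸_; _≤_; z≤n; s≤s; NonZero; >-nonZero)
import Data.Nat.Properties as ℕ
open import Data.Product.Base using (∃; ∃₂; _×_; _,_; uncurry)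
open import Data.Product using (∃!)
open import Data.Sum.Base using (_⊎_; inj₁; inj₂; swap; [_,_])
open import Function.Base using (id; _∘_)
open import Function.Bundles using (_⇔_; Equivalence)
open import Function.Definitions using (Injective; Surjective)
open import Level using (0ℓ)
open import Relation.Binary.Core using (Rel)
open import Relation.Binary.Construct.Closure.ReflexiveTransitive using (Star; ε; _◅_)
open import Relation.Binary.PropositionalEquality using (_≡_; _≢_; refl; sym; trans; subst)
open import Relation.Nullary.Decidable
  using (Dec; ⌊_⌋; toWitness; fromWitness; _×-dec_; _⊎-dec_)
open import Relation.Nullary.Negation using (¬_)

Walk : {A : Set} → Rel A 0ℓ → Rel A 0ℓ
Walk = Star

vertices : {A : Set} {R : Rel A 0ℓ} {u v : A} → Walk R u v → List A
vertices {u = u} ε       = u ∷ []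
vertices {u = u} (_ ◅ w) = u ∷ vertices w

Path : {A : Set} → Rel A 0ℓ → Rel A 0ℓ
Path R u v = ∃ λ (w : Walk R u v) → Unique (vertices w)

Connected : {A : Set} → Rel A 0ℓ → Set
Connected R = ∀ u v → Path R u v

-- A cycle is presented by a path together with an edge from its last
-- vertex back to its first.  For irreflexive R it has at least two
-- vertices.  The k rotations of a cycle of length k are k presentations
-- of it.

record Cycle {A : Set} (R : Rel A 0ℓ) : Set where
  field
    {first last} : A
    walk         : Walk R first last
    distinct     : Unique (vertices walk)
    closing      : R last first

  cycleVertices : List A
  cycleVertices = vertices walk

open Cycle public using (cycleVertices)

_↾_ : ∀ {n} → Rel (Fin n) 0ℓ → Subset n → Rel (Fin n) 0ℓ
(R ↾ S) u v = u ∈ S × v ∈ S × R u v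

InducesConnected : ∀ {n} → Rel (Fin n) 0ℓ → Subset n → Set
InducesConnected R S = ∀ {u v} → u ∈ S → v ∈ S → Path (R ↾ S) u v

record Graph (n : ℕ) : Set where
  field
    adj       : Fin n → Fin n → Bool
    symmetric : ∀ {u v} → T (adj u v) → T (adj v u)
    loopless  : ∀ {v} → ¬ T (adj v v)

record Digraph (n : ℕ) : Set where
  field
    .{{nonempty}} : NonZero n
    adj           : Fin n → Fin n → Bool
    loopless      : ∀ {v} → ¬ T (adj v v)

Adjacent : ∀ {n} → Graph n → Rel (Fin n) 0ℓ
Adjacent G u v = T (Graph.adj G u v)

Edge : ∀ {n} → Digraph n → Rel (Fin n) 0ℓ
Edge D u v = T (Digraph.adj D u v)

edges : ∀ {n} → Digraph n → List (Fin n × Fin n)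
edges {n} D =
  filter (λ (u , v) → T? (Digraph.adj D u v)) (cartesianProduct (allFin n) (allFin n))

StronglyConnected : ∀ {n} → Digraph n → Set
StronglyConnected D = Connected (Edge D)

-- The bound on the length is needed because an undirected edge {u , v}
-- yields a Cycle through u and v.

IsTree : ∀ {n} → Graph n → Set
IsTree G = Connected (Adjacent G)
         × (∀ (C : Cycle (Adjacent G)) → ¬ (3 ≤ length (cycleVertices C)))

underlying : ∀ {n} → Digraph n → Graph n
underlying D = record
  { adj       = λ u v → adj u v ∨ adj v u
  ; symmetric = λ {u} {v} → subst T (∨-comm (adj u v) (adj v u))
  ; loopless  = [ loopless , loopless ] ∘ Equivalence.to T-∨
  }
  where open Digraph D

bidirected : ∀ {n} → .{{NonZero n}} → Graph n → Digraph n
bidirected G = record { adj = Graph.adj G ; loopless = Graph.loopless G }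

record Arborescence (m : ℕ) : Set where
  field
    digraph  : Digraph m
    oriented : ∀ {s t} → Edge digraph s t → ¬ Edge digraph t s
    tree     : IsTree (underlying digraph)
    root     : ∃! _≡_ λ r → ∀ t → Walk (Edge digraph) r t

record DirectedTreeDecomposition {n : ℕ} (D : Digraph n) : Set where
  field
    {size}       : ℕ
    arborescence : Arborescence size

  open Arborescence arborescence public using (digraph)

  -- γ is a total function on pairs of nodes; only its values on edges
  -- of the arborescence are ever used.
  field
    β : Fin size → Subset n
    γ : Fin size → Fin size → Subset n

  _∈β↓_ : Fin n → Fin size → Set
  v ∈β↓ t = ∃ λ t′ → Walk (Edge digraph) t t′ × v ∈ β t′

  field
    β-nonempty : ∀ t → Nonempty (β t)
    β-disjoint : ∀ {s t v} → v ∈ β s → v ∈ β t → s ≡ t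
    β-covers   : ∀ v → ∃ λ t → v ∈ β t
    γ-guards   : ∀ {d t} → Edge digraph d t →
                 ∀ {u v} (w : Walk (Edge D) u v) → u ∈β↓ t → v ∈β↓ t →
                 Any (λ x → ¬ (x ∈β↓ t)) (vertices w) →
                 Any (_∈ γ d t) (vertices w)

  Γ : Fin size → Subset n
  Γ t = β t ∪ ⋃ (map (uncurry γ)
                     (filter (λ (d , s) → (t ≟ d) ⊎-dec (t ≟ s)) (edges digraph)))

  -- The maximum is at least 1, because there is a node and every β t is
  -- nonempty; hence the subtraction is not truncated.
  width : ℕ
  width = max 0 (map (λ t → ∣ Γ t ∣) (allFin size)) ∸ 1

open DirectedTreeDecomposition public using (width)

HasDirectedTreewidth : ∀ {n} → Digraph n → ℕ → Set
HasDirectedTreewidth D k =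
    (∃ λ (𝒯 : DirectedTreeDecomposition D) → width 𝒯 ≡ k)
  × (∀ (𝒯 : DirectedTreeDecomposition D) → k ≤ width 𝒯)

record Hypergraph (n : ℕ) : Set₁ where
  field
    Hyperedge : Set
    ⟦_⟧       : Hyperedge → Subset n

IsHypertree : ∀ {n} → Hypergraph n → Set
IsHypertree {n} H =
  ∃ λ (G : Graph n) → IsTree G × (∀ e → InducesConnected (Adjacent G) ⟦ e ⟧)
  where open Hypergraph H

-- Each directed cycle contributes one hyperedge per rotation, so the
-- multiplicities of the hyperedges differ from one per cycle; being a
-- hypertree does not depend on multiplicities.

cycleHypergraph : ∀ {n} → Digraph n → Hypergraph n
cycleHypergraph D = record
  { Hyperedge = Cycle (Edge D)
  ; ⟦_⟧       = λ C → ⋃ (map ⁅_⁆ (cycleVertices C))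
  }

-- H is isomorphic to a subgraph of D.

Subgraph : ∀ {m n} → Digraph m → Digraph n → Set
Subgraph {m} {n} H D =
  ∃ λ (f : Fin m → Fin n) →
    Injective _≡_ _≡_ f × (∀ {u v} → Edge H u v → Edge D (f u) (f v))

ButterflyContractible : ∀ {n} → Digraph n → Rel (Fin n) 0ℓ
ButterflyContractible D u v =
  Edge D u v × ((∀ {w} → Edge D u w → w ≡ v) ⊎ (∀ {w} → Edge D w v → w ≡ u))

-- Up to isomorphism, D′ arises from D by butterfly contracting (u , v):
-- the map π is the quotient map identifying u and v and nothing else.

record ContractsTo {n m : ℕ} (D : Digraph n) (D′ : Digraph m) : Set where
  field
    {u v}        : Fin n
    contractible : ButterflyContractible D u v
    π            : Fin n → Fin m
    surjective   : Surjective _≡_ _≡_ π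
    identifies   : ∀ {x y} → π x ≡ π y ⇔ (x ≡ y ⊎ (x ≡ u × y ≡ v) ⊎ (x ≡ v × y ≡ u))
    edge⇔        : ∀ {a b} → Edge D′ a b ⇔
                   (a ≢ b × ∃₂ λ x y → π x ≡ a × π y ≡ b × Edge D x y)

ContractionStep : Rel (∃ Digraph) 0ℓ
ContractionStep (_ , D) (_ , D′) = ContractsTo D D′

-- No further isomorphism is needed at the end, since both Subgraph and
-- ContractsTo are already up to isomorphism.

ButterflyMinor : ∀ {m n} → Digraph m → Digraph n → Set
ButterflyMinor D′ D =
  ∃₂ λ k (H : Digraph k) → Subgraph H D × Star ContractionStep (k , H) (_ , D′)

Next : ∀ {ℓ} → Rel (Fin ℓ) 0ℓ
Next {ℓ} i j = toℕ j ≡ suc (toℕ i) ⊎ (suc (toℕ i) ≡ ℓ × toℕ j ≡ 0)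

next? : ∀ {ℓ} (i j : Fin ℓ) → Dec (Next i j)
next? {ℓ} i j =
  (toℕ j ℕ.≟ suc (toℕ i)) ⊎-dec ((suc (toℕ i) ℕ.≟ ℓ) ×-dec (toℕ j ℕ.≟ 0))

Next-irrefl : ∀ {ℓ} → 3 ≤ ℓ → {i : Fin ℓ} → ¬ Next i i
Next-irrefl _ (inj₁ i≡1+i) = ℕ.1+n≢n (sym i≡1+i)
Next-irrefl (s≤s (s≤s _)) (inj₂ (1+i≡ℓ , i≡0))
  with () ← trans (sym i≡0) (ℕ.suc-injective 1+i≡ℓ)

cycleGraph : (ℓ : ℕ) → 3 ≤ ℓ → Graph ℓ
cycleGraph ℓ 3≤ℓ = record
  { adj       = λ i j → ⌊ adj? i j ⌋
  ; symmetric = λ {i} {j} a → fromWitness {a? = adj? j i} (swap (toWitness {a? = adj? i j} a))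
  ; loopless  = λ {i} a → [ Next-irrefl 3≤ℓ , Next-irrefl 3≤ℓ ] (toWitness {a? = adj? i i} a)
  }
  where
  adj? : (i j : Fin ℓ) → Dec (Next i j ⊎ Next j i)
  adj? i j = next? i j ⊎-dec next? j i

bicycle : (ℓ : ℕ) → 3 ≤ ℓ → Digraph ℓ
bicycle ℓ 3≤ℓ = bidirected {{>-nonZero (ℕ.<-≤-trans (s≤s z≤n) 3≤ℓ)}} (cycleGraph ℓ 3≤ℓ)

A₄ : Digraph 4
A₄ = record { adj = adj ; loopless = λ {v} → loopless v }
  where
  adj : Fin 4 → Fin 4 → Bool
  adj 0F 1F = true
  adj 1F 2F = true
  adj 2F 3F = true
  adj 3F 0F = true
  adj 0F 2F = true
  adj 2F 0F = true
  adj 1F 3F = true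
  adj 3F 1F = true
  adj _  _  = false

  loopless : ∀ v → ¬ T (adj v v)
  loopless 0F = id
  loopless 1F = id
  loopless 2F = id
  loopless 3F = id

{-# OPTIONS --safe #-}
module Submission where

-- Call a set of vertices strong if it induces a strongly connected
-- subdigraph.  All three conditions are equivalent to the existence of an
-- elimination order: an enumeration of the vertices in which every x but
-- the first has an earlier vertex p lying in each strong set that contains
-- x and some earlier vertex.  Joining every x to its p gives a hypertree,
-- and a hypertree grown from a root gives such an order.  A decomposition
-- of width one yields the order by peeling off its leaves; conversely the
-- strong components among the vertices from x onwards are nested, and this
-- nesting is the arborescence of a decomposition of width one.
--
-- Three strong sets that meet pairwise but have no common vertex (an
-- obstruction) exclude an elimination order.  Bicycles and A₄ contain
-- obstructions, and obstructions lift along butterfly contractions.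
--
-- For the remaining implication, a strong digraph with a cut vertex y
-- splits at y into two butterfly minors whose orders can be glued.  If
-- there is no cut vertex, then by Menger's theorem some two cycles C, C′
-- meet only in one vertex v, and C, C′ and the strong digraph D − v form
-- an obstruction.  By induction no obstruction may leave an edge unused,
-- and this forces a bicycle or A₄ as a subdigraph.

open import Defs
open import Data.Bool.Base using (T; true; false)
open import Data.Bool.Properties using (T?; T-∨)
open import Data.Empty using (⊥; ⊥-elim)
open import Data.Fin.Base using (Fin; zero; suc; toℕ; fromℕ; fromℕ<; punchIn; punchOut)
open import Data.Fin.Patterns using (0F; 1F; 2F; 3F)
open import Data.Fin.Properties
  using (_≟_; any?; all?; toℕ<n; toℕ-fromℕ<; toℕ-fromℕ; toℕ-injective;
         punchIn-punchOut; punchOut-punchIn; punchIn-injective; punchOut-injective; punchInᵢ≢i; punchOut-cong)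
open import Data.Fin.Subset using (Subset; ⋃; ⁅_⁆; ∣_∣; _∪_; _⊆_) renaming (_∈_ to _∈ˢ_)
open import Data.Fin.Subset.Properties
  using (x∈⁅x⁆; x∈⁅y⁆⇒x≡y; ∣⁅x⁆∣≡1; x∈p∪q⁺; x∈p∪q⁻; ∉⊥; p⊆q⇒∣p∣≤∣q∣; x∈p⇒∣p-x∣<∣p∣; x∈p∧x≢y⇒x∈p-y)
  renaming (_∈?_ to _∈ˢ?_)
open import Data.List.Base using (List; []; _∷_; _++_; length; map; allFin; cartesianProduct)
open import Data.List.Extrema.Nat using (max≤v⁺; xs≤max)
open import Data.List.Membership.Propositional using (_∈_; _∉_; find; lose)
open import Data.List.Membership.Propositional.Properties
  using (∈-allFin; ∈-map⁺; ∈-map⁻; ∈-filter⁺; ∈-filter⁻; ∈-cartesianProduct⁺; ∈-++⁺ˡ; ∈-++⁺ʳ; ∈-++⁻)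
import Data.List.Relation.Binary.Permutation.Setoid.Properties as Permutation
open import Data.List.Relation.Unary.All as All using (All; []; _∷_)
open import Data.List.Relation.Unary.All.Properties using (¬Any⇒All¬; All¬⇒¬Any)
open import Data.List.Relation.Unary.AllPairs using ([]; _∷_)
open import Data.List.Relation.Unary.Any as Any using (Any; here; there)
open import Data.List.Relation.Unary.Unique.Propositional using (Unique)
open import Data.Nat.Base using (ℕ; zero; suc; _+_; _≤_; _<_; z≤n; s≤s; NonZero)
open import Data.Nat.Induction using (<-wellFounded)
import Data.Nat.Properties as ℕ
open import Data.Product.Base using (Σ; ∃; ∃₂; _×_; _,_; proj₁; proj₂; uncurry)
open import Data.Sum.Base using (_⊎_; inj₁; inj₂; reduce; swap; map₂; [_,_]′)
open import Data.Unit.Base using (⊤; tt)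
open import Data.Vec.Base using ([]; _∷_)
open import Function.Base using (id; _∘_; flip)
open import Function.Bundles using (_⇔_; Equivalence; mk⇔)
open import Function.Definitions using (Injective; Surjective)
open import Induction.WellFounded using (Acc; acc)
open import Level using (0ℓ)
open import Relation.Binary.Construct.Closure.ReflexiveTransitive as Star using (Star; ε; _◅_; _◅◅_)
open import Relation.Binary.Core using (Rel; _⇒_)
open import Relation.Binary.Definitions using (Decidable; Transitive; Total; tri<; tri≈; tri>)
open import Relation.Binary.PropositionalEquality
  using (_≡_; _≢_; refl; sym; trans; cong; cong₂; subst; subst₂; setoid)
open import Relation.Nullary.Decidable
  using (Dec; yes; no; ⌊_⌋; toWitness; fromWitness; decidable-stable; ¬?; _×-dec_; _⊎-dec_; _→-dec_)
open import Relation.Nullary.Negation using (¬_; contradiction)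
open import Relation.Unary using (Pred) renaming (Decidable to Decidable₁)

-- Walks, strong sets and elimination orders

-- Strong sets rather than cycles carry the argument because they behave well under both operations
-- on digraphs: a strong set leaves a strong trace when one side of a cut vertex is contracted, and
-- it lifts back along a butterfly contraction.
--
-- The search for a bicycle or `A₄` always uses one lever. Without cut vertices, and with at least
-- three vertices, every vertex has two out-neighbours and the deletion of any edge leaves the
-- digraph strong. An obstruction that leaves some vertex along a single edge therefore survives a
-- deletion, and the induction supplies a forbidden minor. Each case looks for a vertex at which
-- three chosen strong sets need only one outgoing edge; the configurations that offer none are the
-- bicycles and `A₄`.
--
-- Gluing at a cut vertex needs an order of one side that begins with that vertex. For this reason
-- the induction proves that orders exist with every prescribed root.

infix 6 _⇂_
-- Unlike `_↾_`, this restricts to an arbitrary predicate, since the strong sets below arise from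
-- walks, unions and traces.
record _⇂_ {A : Set} (R : Rel A 0ℓ) (P : Pred A 0ℓ) (u v : A) : Set where
  constructor within
  field
    source : P u
    target : P v
    step   : R u v

open _⇂_ public

⇂-mono : {A : Set} {R S : Rel A 0ℓ} {P Q : Pred A 0ℓ} → R ⇒ S → (∀ {x} → P x → Q x) →
         R ⇂ P ⇒ S ⇂ Q
⇂-mono f g (within p q e) = within (g p) (g q) (f e)

⇂-forget : {A : Set} {R : Rel A 0ℓ} {P : Pred A 0ℓ} → R ⇂ P ⇒ R
⇂-forget = step

infix 4 _∈?_
_∈?_ : ∀ {n} (x : Fin n) (xs : List (Fin n)) → Dec (x ∈ xs)
x ∈? xs = Any.any? (x ≟_) xs

module _ {A : Set} where

  first∈ : {R : Rel A 0ℓ} {x y : A} (w : Walk R x y) → x ∈ vertices w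
  first∈ ε       = here refl
  first∈ (_ ◅ _) = here refl

  last∈ : {R : Rel A 0ℓ} {x y : A} (w : Walk R x y) → y ∈ vertices w
  last∈ ε       = here refl
  last∈ (_ ◅ w) = there (last∈ w)

  digon-vertices : {x y z : A} → z ∈ x ∷ y ∷ [] ⊎ z ∈ y ∷ x ∷ [] → z ≡ x ⊎ z ≡ y
  digon-vertices (inj₁ (here p))         = inj₁ p
  digon-vertices (inj₁ (there (here p))) = inj₂ p
  digon-vertices (inj₂ (here p))         = inj₂ p
  digon-vertices (inj₂ (there (here p))) = inj₁ p

  middle∈ : {R : Rel A 0ℓ} {x y z : A} (p : Walk R x y) (q : Walk R y z) → y ∈ vertices (p ◅◅ q)
  middle∈ ε       q = first∈ q
  middle∈ (_ ◅ p) q = there (middle∈ p q)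

  vertices-map : {R S : Rel A 0ℓ} (f : R ⇒ S) {x y : A} (w : Walk R x y) →
                 vertices (Star.map f w) ≡ vertices w
  vertices-map f ε       = refl
  vertices-map f (_ ◅ w) = cong (_ ∷_) (vertices-map f w)

  stays : {R : Rel A 0ℓ} {P : Pred A 0ℓ} {x y z : A} (w : Walk (R ⇂ P) x y) →
          P x → z ∈ vertices w → P z
  stays ε       p (here refl) = p
  stays (_ ◅ _) p (here refl) = p
  stays (within _ q _ ◅ w) p (there i) = stays w q i

  prefixWalk : {R : Rel A 0ℓ} {P : Pred A 0ℓ} {x y z : A} (w : Walk R x y) →
               (∀ {v} → v ∈ vertices w → P v) → z ∈ vertices w → Walk (R ⇂ P) x z
  prefixWalk ε       _ (here refl) = ε
  prefixWalk (_ ◅ _) _ (here refl) = ε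
  prefixWalk (e ◅ w) h (there i) =
    within (h (here refl)) (h (there (first∈ w))) e ◅ prefixWalk w (h ∘ there) i

  suffixWalk : {R : Rel A 0ℓ} {P : Pred A 0ℓ} {x y z : A} (w : Walk R x y) →
               (∀ {v} → v ∈ vertices w → P v) → z ∈ vertices w → Walk (R ⇂ P) z y
  suffixWalk ε       _ (here refl) = ε
  suffixWalk (e ◅ w) h (here refl) =
    within (h (here refl)) (h (there (first∈ w))) e ◅ suffixWalk w (h ∘ there) (first∈ w)
  suffixWalk (e ◅ w) h (there i) = suffixWalk w (h ∘ there) i

  confine : {R : Rel A 0ℓ} {P : Pred A 0ℓ} {x y : A} (w : Walk R x y) →
            (∀ {v} → v ∈ vertices w → P v) → Walk (R ⇂ P) x y
  confine w h = prefixWalk w h (last∈ w)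

  walk-end : {R : Rel A 0ℓ} {P : Pred A 0ℓ} {x y : A} → Walk (R ⇂ P) x y → P x → P y
  walk-end w p = stays w p (last∈ w)

module _ {n : ℕ} where

  private V = Fin n

  subpath : {R : Rel V 0ℓ} {x y z : V} (w : Walk R x y) → Unique (vertices w) →
            z ∈ vertices w → Path R z y
  subpath ε       u (here refl) = ε , u
  subpath (e ◅ w) u (here refl) = e ◅ w , u
  subpath (e ◅ w) (_ ∷ u) (there i) = subpath w u i

  simple : {R : Rel V 0ℓ} {x y : V} → Walk R x y → Path R x y
  simple ε = ε , [] ∷ []
  simple {x = x} (e ◅ w) with simple w
  ... | p , u with x ∈? vertices p
  ...   | yes i = subpath p u i
  ...   | no ¬i = e ◅ p , ¬Any⇒All¬ _ ¬i ∷ u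

  mapPath : {R S : Rel V 0ℓ} {x y : V} → R ⇒ S → Path R x y → Path S x y
  mapPath f (w , u) = Star.map f w , subst Unique (sym (vertices-map f w)) u

  -- Walks may repeat vertices, which makes unions and closed walks easy to handle. Empty and
  -- singleton predicates count as strong.
  Str : Rel V 0ℓ → Pred V 0ℓ → Set
  Str R P = ∀ {x y} → P x → P y → Walk (R ⇂ P) x y

  Str-mono : {R S : Rel V 0ℓ} {P : Pred V 0ℓ} → R ⇒ S → Str R P → Str S P
  Str-mono f s p q = Star.map (⇂-mono f id) (s p q)

  Str-hub : {R : Rel V 0ℓ} {P : Pred V 0ℓ} (h : V) →
            (∀ {x} → P x → Walk (R ⇂ P) x h × Walk (R ⇂ P) h x) → Str R P
  Str-hub h f p q = proj₁ (f p) ◅◅ proj₂ (f q)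

  Str-∪ : {R : Rel V 0ℓ} {P Q : Pred V 0ℓ} {z : V} → P z → Q z → Str R P → Str R Q →
          Str R (λ x → P x ⊎ Q x)
  Str-∪ {R} {P} {Q} {z} pz qz sP sQ = Str-hub z λ
    { (inj₁ p) → Star.map (⇂-mono id inj₁) (sP p pz) , Star.map (⇂-mono id inj₁) (sP pz p)
    ; (inj₂ q) → Star.map (⇂-mono id inj₂) (sQ q qz) , Star.map (⇂-mono id inj₂) (sQ qz q) }

  -- Every vertex of a closed walk is reached from `x` along its beginning and returns to `x` along
  -- the rest. This is the main source of strong sets.
  Str-closed : {R : Rel V 0ℓ} {x y : V} (p : Walk R x y) (q : Walk R y x) →
               Str R (λ z → z ∈ vertices p ⊎ z ∈ vertices q)
  Str-closed {x = x} p q = Str-hub x λ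
    { (inj₁ i) → suffixWalk p inj₁ i ◅◅ confine q inj₂ , prefixWalk p inj₁ i
    ; (inj₂ i) → suffixWalk q inj₂ i , confine p inj₁ ◅◅ prefixWalk q inj₂ i }

  Str-singleton : {R : Rel V 0ℓ} (x : V) → Str R (_≡ x)
  Str-singleton x refl refl = ε

  -- This is a failure of the Helly property: subtrees of a tree that meet pairwise have a common
  -- vertex.
  record Obs (R : Rel V 0ℓ) : Set₁ where
    field
      {A B C} : Pred V 0ℓ
      strA    : Str R A
      strB    : Str R B
      strC    : Str R C
      AB      : ∃ λ x → A x × B x
      BC      : ∃ λ x → B x × C x
      CA      : ∃ λ x → C x × A x
      none    : ∀ {x} → A x → B x → C x → ⊥

  Obs-mono : {R S : Rel V 0ℓ} → R ⇒ S → Obs R → Obs S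
  Obs-mono f o = record
    { strA = Str-mono f strA ; strB = Str-mono f strB ; strC = Str-mono f strC
    ; AB = AB ; BC = BC ; CA = CA ; none = none }
    where open Obs o

  -- The list grows at its head, so the tail holds the earlier vertices and the last entry is the
  -- root.
  data Elim (R : Rel V 0ℓ) : List V → Set₁ where
    root : ∀ r → Elim R (r ∷ [])
    leaf : ∀ {x l} p → p ∈ l → x ∉ l →
           (∀ {P} → Str R P → P x → ∀ {y} → y ∈ l → P y → P p) →
           Elim R l → Elim R (x ∷ l)

  private
    Meet : List V → Pred V 0ℓ → Pred V 0ℓ → Set
    Meet l P Q = ∃ λ x → x ∈ l × P x × Q x

  -- If `P` and `Q` meet in the newest vertex `x`, then `x` is outside `S`, so the other two
  -- meetings lie in `l`. They give `P` and `Q` a vertex in `l` each, and hence both contain the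
  -- parent `p`.
  meet-later : {R : Rel V 0ℓ} {x p : V} {l : List V} {P Q S : Pred V 0ℓ} → p ∈ l →
    (∀ {P} → Str R P → P x → ∀ {y} → y ∈ l → P y → P p) →
    Str R P → Str R Q → (∀ {x} → P x → Q x → S x → ⊥) →
    Meet (x ∷ l) P Q → Meet (x ∷ l) Q S → Meet (x ∷ l) S P → Meet l P Q
  meet-later p∈ dom sP sQ none (x , there i , Px , Qx) _ _ = x , i , Px , Qx
  meet-later p∈ dom sP sQ none (x , here refl , Px , Qx) (y , here refl , Qy , Sy) _ = ⊥-elim (none Px Qx Sy)
  meet-later p∈ dom sP sQ none (x , here refl , Px , Qx) _ (y , here refl , Sy , Py) = ⊥-elim (none Px Qx Sy)
  meet-later p∈ dom sP sQ none (x , here refl , Px , Qx) (y , there i , Qy , _) (z , there j , _ , Pz) =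
    _ , p∈ , dom sP Px j Pz , dom sQ Qx i Qy

  -- Removing the newest vertices one by one pushes the three meeting points down to the root, where
  -- they coincide.
  Elim⇒¬Obs : {R : Rel V 0ℓ} {l : List V} → Elim R l → (o : Obs R) → let open Obs o in
              proj₁ AB ∈ l → proj₁ BC ∈ l → proj₁ CA ∈ l → ⊥
  Elim⇒¬Obs e o ab bc ca = go e (_ , ab , proj₂ AB) (_ , bc , proj₂ BC) (_ , ca , proj₂ CA)
    where
    open Obs o
    go : ∀ {l} → Elim _ l → Meet l A B → Meet l B C → Meet l C A → ⊥
    go (root r) (_ , here refl , a , b) (_ , here refl , _ , c) _ = none a b c
    go (leaf p p∈ _ dom e) mab mbc mca = go e
      (meet-later p∈ dom strA strB none mab mbc mca)
      (meet-later p∈ dom strB strC (λ b c a → none a b c) mbc mca mab)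
      (meet-later p∈ dom strC strA (λ c a b → none a b c) mca mab mbc)

  EliminationOrder : Digraph n → Set₁
  EliminationOrder D = ∃ λ l → Elim (Edge D) l × (∀ x → x ∈ l)

  -- The value par r is junk, since the root has no parent.

  record Rank (R : Rel V 0ℓ) : Set₁ where
    field
      r     : V
      par   : V → V
      ρ     : V → ℕ
      ρ-par : ∀ {x} → x ≢ r → ρ (par x) < ρ x
      ρ-inj : ∀ {x y} → ρ x ≡ ρ y → x ≡ y
      dom   : ∀ {P x y} → Str R P → P x → P y → ρ y < ρ x → P (par x)

  private
    upd : {B : Set} → V → B → (V → B) → V → B
    upd x b f z with z ≟ x
    ... | yes _ = b
    ... | no  _ = f z

    upd-≡ : {B : Set} (x : V) (b : B) (f : V → B) → upd x b f x ≡ b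
    upd-≡ x b f with x ≟ x
    ... | yes _ = refl
    ... | no ¬p = contradiction refl ¬p

    upd-≢ : {B : Set} (x : V) (b : B) (f : V → B) {z : V} → z ≢ x → upd x b f z ≡ f z
    upd-≢ x b f {z} z≢x with z ≟ x
    ... | yes p = contradiction p z≢x
    ... | no  _ = refl

    record RankOn (R : Rel V 0ℓ) (l : List V) : Set₁ where
      field
        r       : V
        r∈      : r ∈ l
        par     : V → V
        ρ       : V → ℕ
        ρ<      : ∀ {x} → x ∈ l → ρ x < length l
        par∈    : ∀ {x} → x ∈ l → par x ∈ l
        ρ-par   : ∀ {x} → x ∈ l → x ≢ r → ρ (par x) < ρ x
        ρ-inj   : ∀ {x y} → x ∈ l → y ∈ l → ρ x ≡ ρ y → x ≡ y
        dom     : ∀ {P x y} → x ∈ l → y ∈ l → Str R P → P x → P y → ρ y < ρ x → P (par x)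

    rankOn : {R : Rel V 0ℓ} {l : List V} → Elim R l → RankOn R l
    rankOn (root r) = record
      { r = r ; r∈ = here refl ; par = λ _ → r ; ρ = λ _ → 0
      ; ρ< = λ _ → s≤s z≤n ; par∈ = λ _ → here refl
      ; ρ-par = λ { (here refl) x≢ → contradiction refl x≢ }
      ; ρ-inj = λ { (here refl) (here refl) _ → refl }
      ; dom = λ _ _ _ _ _ () }
    rankOn {R} {x ∷ l} (leaf p p∈ x∉ d e) = record
      { r = r ; r∈ = there r∈ ; par = par′ ; ρ = ρ′
      ; ρ< = λ { (here refl) → subst (_< suc (length l)) (sym ρ-x) ℕ.≤-refl
               ; (there i) → subst (_< suc (length l)) (sym (ρ-l i)) (ℕ.m<n⇒m<1+n (ρ< i)) }
      ; par∈ = λ { (here refl) → there (subst (_∈ l) (sym par-x) p∈)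
                 ; (there i) → there (subst (_∈ l) (sym (par-l i)) (par∈ i)) }
      ; ρ-par = λ { (here refl) _ → subst₂ _<_ (sym (trans (cong ρ′ par-x) (ρ-l p∈))) (sym ρ-x) (ρ< p∈)
                  ; (there i) z≢r → subst₂ _<_ (sym (trans (cong ρ′ (par-l i)) (ρ-l (par∈ i)))) (sym (ρ-l i)) (ρ-par i z≢r) }
      ; ρ-inj = λ { (here refl) (here refl) _ → refl
                  ; (here refl) (there j) q → contradiction (trans (sym (ρ-l j)) (trans (sym q) ρ-x)) (ℕ.<⇒≢ (ρ< j))
                  ; (there i) (here refl) q → contradiction (trans (sym (ρ-l i)) (trans q ρ-x)) (ℕ.<⇒≢ (ρ< i))
                  ; (there i) (there j) q → ρ-inj i j (trans (sym (ρ-l i)) (trans q (ρ-l j))) }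
      ; dom = λ { (here refl) (here refl) s Px Py lt → contradiction lt (ℕ.<-irrefl refl)
                ; {P = P} (here refl) (there j) s Px Py lt → subst P (sym par-x) (d s Px j Py)
                ; (there i) (here refl) s Px Py lt →
                    contradiction (subst₂ _<_ ρ-x (ρ-l i) lt) (ℕ.<⇒≯ (ρ< i))
                ; {P = P} (there i) (there j) s Px Py lt →
                    subst P (sym (par-l i)) (dom i j s Px Py (subst₂ _<_ (ρ-l j) (ρ-l i) lt)) } }
      where
      open RankOn (rankOn e)
      par′ : V → V
      par′ = upd x p par
      -- A vertex is ranked by the number of vertices before it, so the new `x` outranks all of `l`.
      ρ′ : V → ℕ
      ρ′ = upd x (length l) ρ
      ρ-x : ρ′ x ≡ length l
      ρ-x = upd-≡ x (length l) ρ
      par-x : par′ x ≡ p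
      par-x = upd-≡ x p par
      ≢x : ∀ {z} → z ∈ l → z ≢ x
      ≢x i refl = x∉ i
      ρ-l : ∀ {z} → z ∈ l → ρ′ z ≡ ρ z
      ρ-l i = upd-≢ x (length l) ρ (≢x i)
      par-l : ∀ {z} → z ∈ l → par′ z ≡ par z
      par-l i = upd-≢ x p par (≢x i)

  rank : {R : Rel V 0ℓ} {l : List V} → Elim R l → (∀ x → x ∈ l) → Rank R
  rank e all = record
    { r = r ; par = par ; ρ = ρ ; ρ-par = ρ-par (all _) ; ρ-inj = ρ-inj (all _) (all _)
    ; dom = dom (all _) (all _) }
    where open RankOn (rankOn e)

  -- A simple walk from `d` to `d′` missing `t` would close through `t` to a cycle. As `d` and `d′`
  -- differ, it has the three vertices that `IsTree` asks for.
  no-bypass : {G : Graph n} → IsTree G → {t d d′ : V} → Adjacent G t d → Adjacent G d′ t →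
              d ≢ d′ → ¬ Walk (Adjacent G ⇂ (_≢ t)) d d′
  no-bypass {G} (_ , acyclic) {t} {d} {d′} td d′t d≢d′ w with simple w
  ... | p , u = acyclic C (long (proj₁ p′))
    where
    t≢d : d ≢ t
    t≢d refl = Graph.loopless G td
    p′ : Path (Adjacent G) d d′
    p′ = mapPath ⇂-forget (p , u)
    C : Cycle (Adjacent G)
    C = record
      { walk = td ◅ proj₁ p′
      ; distinct = ¬Any⇒All¬ _ (λ i → stays p t≢d (subst (t ∈_) (vertices-map ⇂-forget p) i) refl) ∷ proj₂ p′
      ; closing = d′t }
    long : (q : Walk (Adjacent G) d d′) → 3 ≤ suc (length (vertices q))
    long ε = contradiction refl d≢d′
    long (_ ◅ ε) = s≤s (s≤s (s≤s z≤n))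
    long (_ ◅ _ ◅ _) = s≤s (s≤s (s≤s z≤n))

  fin-nonZero : V → NonZero n
  fin-nonZero zero    = _
  fin-nonZero (suc _) = _

-- Trees from a parent function

module ParentTree {n : ℕ} (r : Fin n) (par : Fin n → Fin n) (ρ : Fin n → ℕ)
                  (ρ-par : ∀ {x} → x ≢ r → ρ (par x) < ρ x) where

  private V = Fin n

  Up : Rel V 0ℓ
  Up t d = t ≢ r × par t ≡ d

  up? : Decidable Up
  up? t d = ¬? (t ≟ r) ×-dec (par t ≟ d)

  Up-ρ : ∀ {t d} → Up t d → ρ d < ρ t
  Up-ρ (t≢r , refl) = ρ-par t≢r

  digraph : Digraph n
  digraph = record
    { nonempty = fin-nonZero r
    ; adj      = λ d t → ⌊ up? t d ⌋
    ; loopless = λ {v} e → ℕ.<-irrefl refl (Up-ρ (toWitness {a? = up? v v} e)) }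

  edge⁺ : ∀ {d t} → Up t d → Edge digraph d t
  edge⁺ {d} {t} = fromWitness {a? = up? t d}

  edge⁻ : ∀ {d t} → Edge digraph d t → Up t d
  edge⁻ {d} {t} = toWitness {a? = up? t d}

  G : Graph n
  G = underlying digraph

  adj⁻ : ∀ {u v} → Adjacent G u v → Up v u ⊎ Up u v
  adj⁻ a with Equivalence.to T-∨ a
  ... | inj₁ e = inj₁ (edge⁻ e)
  ... | inj₂ e = inj₂ (edge⁻ e)

  adj-down : ∀ {u v} → Up v u → Adjacent G u v
  adj-down e = Equivalence.from T-∨ (inj₁ (edge⁺ e))

  adj-up : ∀ {u v} → Up u v → Adjacent G u v
  adj-up e = Equivalence.from T-∨ (inj₂ (edge⁺ e))

  oriented : ∀ {s t} → Edge digraph s t → ¬ Edge digraph t s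
  oriented e f = ℕ.<-asym (Up-ρ (edge⁻ e)) (Up-ρ (edge⁻ f))

  fromRoot : ∀ t → Walk (Edge digraph) r t
  fromRoot t = go t (<-wellFounded (ρ t))
    where
    go : ∀ t → Acc _<_ (ρ t) → Walk (Edge digraph) r t
    go t (acc rs) with t ≟ r
    ... | yes refl = ε
    ... | no t≢r = go (par t) (rs (ρ-par t≢r)) ◅◅ (edge⁺ (t≢r , refl) ◅ ε)

  private
    connected : Connected (Adjacent G)
    connected u v = simple (Star.reverse (λ {x} {y} → Graph.symmetric G {x} {y}) (walk u) ◅◅ walk v)
      where
      walk : ∀ t → Walk (Adjacent G) r t
      walk t = Star.map (λ e → Equivalence.from T-∨ (inj₁ e)) (fromRoot t)

    -- A simple walk that has once gone down cannot go up again.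
    downward : ∀ {x z y} (w : Walk (Adjacent G) z y) → Up z x → Unique (x ∷ vertices w) →
               ρ x < ρ y × Up y (par y) × (par y ∈ vertices w ⊎ (z ≡ y × par y ≡ x))
    downward ε u _ = Up-ρ u , (proj₁ u , refl) , inj₂ (refl , proj₂ u)
    downward (e ◅ w) u (x∉ ∷ uq) with adj⁻ e
    ... | inj₂ (_ , p) = contradiction (there (subst (_∈ vertices w) (trans (sym p) (proj₂ u)) (first∈ w))) (All¬⇒¬Any x∉)
    ... | inj₁ d with downward w d uq
    ...   | lt , up , inj₁ i = ℕ.<-trans (Up-ρ u) lt , up , inj₁ (there i)
    ...   | lt , up , inj₂ (refl , q) = ℕ.<-trans (Up-ρ u) lt , up , inj₁ (here q)

    -- A simple walk first moves towards the root and then only away from it. Either the second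
    -- phase is empty and the rank has dropped, or the last step comes from the parent of the end
    -- vertex.
    unimodal : ∀ {x z y} → Adjacent G x z → (w : Walk (Adjacent G) z y) → Unique (x ∷ vertices w) →
               ρ y < ρ x ⊎ (Up y (par y) × (par y ∈ vertices w ⊎ (z ≡ y × par y ≡ x)))
    unimodal e w uq with adj⁻ e
    unimodal e w uq | inj₁ d = inj₂ (proj₂ (downward w d uq))
    unimodal e ε uq | inj₂ u = inj₁ (Up-ρ u)
    unimodal e (f ◅ w) (_ ∷ uq) | inj₂ u with unimodal f w uq
    ... | inj₁ lt = inj₁ (ℕ.<-trans lt (Up-ρ u))
    ... | inj₂ (up , inj₁ i) = inj₂ (up , inj₁ (there i))
    ... | inj₂ (up , inj₂ (_ , q)) = inj₂ (up , inj₁ (here q))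

    -- The closing edge compares the ranks of the two ends in one way; the shape of the walk
    -- compares them in the other way or forces a vertex to repeat.
    acyclic : ∀ {x y} (w : Walk (Adjacent G) x y) → Unique (vertices w) → Adjacent G y x →
              ¬ (3 ≤ length (vertices w))
    acyclic ε _ _ (s≤s ())
    acyclic (e ◅ ε) _ _ (s≤s (s≤s ()))
    acyclic {x} {y} (e ◅ w@(_ ◅ w′)) (x∉ ∷ uq@(z∉ ∷ _)) c _ with adj⁻ c
    ... | inj₁ xUp with adj⁻ e
    ...   | inj₂ xz = All¬⇒¬Any z∉ (subst (_∈ vertices w′) (trans (sym (proj₂ xUp)) (proj₂ xz)) (last∈ w′))
    ...   | inj₁ d = ℕ.<-asym (proj₁ (downward w d (x∉ ∷ uq))) (Up-ρ xUp)
    acyclic {x} {y} (e ◅ w@(_ ◅ w′)) (x∉ ∷ uq@(z∉ ∷ _)) c _ | inj₂ yUp with unimodal e w (x∉ ∷ uq)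
    ... | inj₁ lt = ℕ.<-asym lt (Up-ρ yUp)
    ... | inj₂ (_ , inj₁ i) = All¬⇒¬Any x∉ (subst (_∈ vertices w) (proj₂ yUp) i)
    ... | inj₂ (_ , inj₂ (refl , _)) = All¬⇒¬Any z∉ (last∈ w′)

  isTree : IsTree G
  isTree = connected , λ C → acyclic (Cycle.walk C) (Cycle.distinct C) (Cycle.closing C)

  arborescence : Arborescence n
  arborescence = record
    { digraph = digraph ; oriented = λ {s} {t} → oriented {s} {t} ; tree = isTree
    ; root = r , fromRoot , λ {s} f → sym (entry (f r)) }
    where
    entry : ∀ {s} → Walk (Edge digraph) s r → s ≡ r
    entry ε = refl
    entry (e ◅ w) with refl ← entry w = contradiction refl (proj₁ (edge⁻ e))

-- The hypertree of an elimination order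

module _ {n : ℕ} where

  ∈⋃⁺ : {x : Fin n} {xs : List (Fin n)} → x ∈ xs → x ∈ˢ ⋃ (map ⁅_⁆ xs)
  ∈⋃⁺ (here refl) = x∈p∪q⁺ (inj₁ (x∈⁅x⁆ _))
  ∈⋃⁺ (there i)   = x∈p∪q⁺ (inj₂ (∈⋃⁺ i))

  ∈⋃⁻ : {x : Fin n} (xs : List (Fin n)) → x ∈ˢ ⋃ (map ⁅_⁆ xs) → x ∈ xs
  ∈⋃⁻ []       i = contradiction i ∉⊥
  ∈⋃⁻ (y ∷ xs) i with x∈p∪q⁻ ⁅ y ⁆ _ i
  ... | inj₁ j = here (x∈⁅y⁆⇒x≡y y j)
  ... | inj₂ j = there (∈⋃⁻ xs j)

  -- The vertex set of a cycle is strong, so by `dom` it contains the parent of each member except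
  -- the lowest. Passing to parents joins any two members without leaving the set.
  Rank⇒IsHypertree : (D : Digraph n) → Rank (Edge D) → IsHypertree (cycleHypergraph D)
  Rank⇒IsHypertree D k = G , isTree , λ C u∈ v∈ →
    let l = cycleVertices C
        s = Str-closed (Cycle.walk C) (Cycle.closing C ◅ ε)
        w = connected C s (inj₁ (∈⋃⁻ l u∈)) (inj₁ (∈⋃⁻ l v∈))
        conv : ∀ {z} → z ∈ l ⊎ z ∈ vertices {R = Edge D} (Cycle.closing C ◅ ε) → z ∈ˢ ⋃ (map ⁅_⁆ l)
        conv = λ { (inj₁ i) → ∈⋃⁺ i
                 ; (inj₂ (here refl)) → ∈⋃⁺ (last∈ (Cycle.walk C))
                 ; (inj₂ (there (here refl))) → ∈⋃⁺ (first∈ (Cycle.walk C)) }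
    in simple (Star.map (λ (within p q e) → conv p , conv q , e) w)
    where
    open Rank k
    open ParentTree r par ρ ρ-par
    -- A vertex that outranks another one is not the root, because parents lower the rank all the
    -- way down to the root.
    r-min : ∀ {P z y} → Str (Edge D) P → P z → P y → ρ y < ρ z → z ≢ r
    r-min = λ { _ _ _ lt refl → below _ (<-wellFounded _) lt }
      where
      below : ∀ y → Acc _<_ (ρ y) → ρ y < ρ r → ⊥
      below y (acc rs) lt with y ≟ r
      ... | yes refl = ℕ.<-irrefl refl lt
      ... | no y≢r = below (par y) (rs (ρ-par y≢r)) (ℕ.<-trans (ρ-par y≢r) lt)
    -- The member of larger rank steps to its parent.
    connected : ∀ {P} (C : Cycle (Edge D)) → Str (Edge D) P → ∀ {u v} → P u → P v → Walk (Adjacent G ⇂ P) u v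
    connected {P} C s {u} {v} Pu Pv = go u v Pu Pv (<-wellFounded _)
      where
      go : ∀ u v → P u → P v → Acc _<_ (ρ u + ρ v) → Walk (Adjacent G ⇂ P) u v
      go u v Pu Pv (acc rs) with ℕ.<-cmp (ρ u) (ρ v)
      ... | tri< lt _ _ =
        let v≢r = r-min s Pv Pu lt ; Pp = dom s Pv Pu lt in
        go u (par v) Pu Pp (rs (ℕ.+-monoʳ-< (ρ u) (ρ-par v≢r))) ◅◅ (within Pp Pv (adj-down (v≢r , refl)) ◅ ε)
      ... | tri≈ _ eq _ = subst (Walk _ u) (ρ-inj eq) ε
      ... | tri> _ _ gt =
        let u≢r = r-min s Pu Pv gt ; Pp = dom s Pu Pv gt in
        within Pu Pp (adj-up (u≢r , refl)) ◅ go (par u) v Pp Pv (rs (ℕ.+-monoˡ-< (ρ v) (ρ-par u≢r)))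

-- Trees grown by search

module _ {A : Set} where

  count : {P : Pred A 0ℓ} → Decidable₁ P → List A → ℕ
  count P? []       = 0
  count P? (x ∷ xs) with P? x
  ... | yes _ = suc (count P? xs)
  ... | no  _ = count P? xs

  count-≤ : {P Q : Pred A 0ℓ} (P? : Decidable₁ P) (Q? : Decidable₁ Q) → (∀ {x} → P x → Q x) →
            ∀ xs → count P? xs ≤ count Q? xs
  count-≤ P? Q? f []       = z≤n
  count-≤ P? Q? f (x ∷ xs) with P? x | Q? x
  ... | yes p | yes q = s≤s (count-≤ P? Q? f xs)
  ... | yes p | no ¬q = contradiction (f p) ¬q
  ... | no ¬p | yes q = ℕ.m≤n⇒m≤1+n (count-≤ P? Q? f xs)
  ... | no ¬p | no ¬q = count-≤ P? Q? f xs

  count-< : {P Q : Pred A 0ℓ} (P? : Decidable₁ P) (Q? : Decidable₁ Q) → (∀ {x} → P x → Q x) →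
            ∀ {x xs} → x ∈ xs → Q x → ¬ P x → count P? xs < count Q? xs
  count-< P? Q? f {xs = x ∷ xs} (here refl) qx ¬px with P? x | Q? x
  ... | yes p | _     = contradiction p ¬px
  ... | no ¬p | yes q = s≤s (count-≤ P? Q? f xs)
  ... | no ¬p | no ¬q = contradiction qx ¬q
  count-< P? Q? f {xs = y ∷ xs} (there i) qx ¬px with P? y | Q? y
  ... | yes p | yes q = s≤s (count-< P? Q? f i qx ¬px)
  ... | yes p | no ¬q = contradiction (f p) ¬q
  ... | no ¬p | yes q = ℕ.m<n⇒m<1+n (count-< P? Q? f i qx ¬px)
  ... | no ¬p | no ¬q = count-< P? Q? f i qx ¬px

module _ {n : ℕ} where

  private V = Fin n

  data Grown (R : Rel V 0ℓ) (r : V) : List V → Set where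
    seed : Grown R r (r ∷ [])
    grow : ∀ {x l} d → d ∈ l → R d x → x ∉ l → Grown R r l → Grown R r (x ∷ l)

  Grown-root : {R : Rel V 0ℓ} {r : V} {l : List V} → Grown R r l → r ∈ l
  Grown-root seed = here refl
  Grown-root (grow _ _ _ _ g) = there (Grown-root g)

  Grown-walk : {R : Rel V 0ℓ} {r : V} {l : List V} → Grown R r l → ∀ {x} → x ∈ l →
               Walk (R ⇂ (_∈ l)) r x
  Grown-walk seed (here refl) = ε
  Grown-walk (grow d d∈ e _ g) (here refl) =
    Star.map (⇂-mono id there) (Grown-walk g d∈) ◅◅ (within (there d∈) (here refl) e ◅ ε)
  Grown-walk (grow d d∈ e _ g) (there i) = Star.map (⇂-mono id there) (Grown-walk g i)

  saturate : {R : Rel V 0ℓ} → Decidable R → (r : V) →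
             ∃ λ l → Grown R r l × (∀ {d x} → d ∈ l → R d x → x ∈ l)
  saturate {R} R? r = go (r ∷ []) seed (<-wellFounded _)
    where
    missing : List V → ℕ
    missing l = count (λ x → ¬? (x ∈? l)) (allFin n)
    go : ∀ l → Grown R r l → Acc _<_ (missing l) →
         ∃ λ l → Grown R r l × (∀ {d x} → d ∈ l → R d x → x ∈ l)
    go l g (acc rs) with any? (λ d → any? (λ x → (d ∈? l) ×-dec (¬? (x ∈? l) ×-dec R? d x)))
    ... | yes (d , x , d∈ , x∉ , e) =
      go (x ∷ l) (grow d d∈ e x∉ g)
         (rs (count-< (λ y → ¬? (y ∈? (x ∷ l))) (λ y → ¬? (y ∈? l)) (_∘ there)
                      (∈-allFin x) x∉ (λ ¬i → ¬i (here refl))))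
    ... | no ¬leaves = l , g , closed
      where
      closed : ∀ {d x} → d ∈ l → R d x → x ∈ l
      closed {d} {x} d∈ e with x ∈? l
      ... | yes i = i
      ... | no x∉ = contradiction (d , x , d∈ , x∉ , e) ¬leaves

  spanning : {R : Rel V 0ℓ} → Decidable R → (r : V) → (∀ t → Walk R r t) →
             ∃ λ l → Grown R r l × (∀ x → x ∈ l)
  spanning {R} R? r reach with l , g , closed ← saturate R? r = l , g , λ x → follow (reach x) (Grown-root g)
    where
    follow : ∀ {x y} → Walk R x y → x ∈ l → y ∈ l
    follow ε i = i
    follow (e ◅ w) i = follow w (closed i e)

  -- The field `nonempty` is irrelevant and can only refute the empty case, so the vertex is found
  -- by matching on the size.
  fin : Digraph n → V
  fin record { nonempty = z } = pick z
    where
    pick : ∀ {m} → .(NonZero m) → Fin m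
    pick {zero} ()
    pick {suc _} _ = zero

  -- Any order in which a search discovers the tree works; the parent of a vertex is the neighbour
  -- from which it was discovered.
  IsHypertree⇒Elim : (D : Digraph n) → IsHypertree (cycleHypergraph D) →
                     EliminationOrder D
  IsHypertree⇒Elim D (G , tree , hyp) with spanning (λ x y → T? (Graph.adj G x y)) (fin D) (λ t → proj₁ (proj₁ tree (fin D) t))
  ... | l , g , all = l , elim g , all
    where
    -- An edge inside a strong set closes up, within the set, to a cycle. The hyperedge of that
    -- cycle is connected in the tree, hence so is the strong set.
    induced : ∀ {P} → Str (Edge D) P → ∀ {x y} → Walk (Edge D ⇂ P) x y → Walk (Adjacent G ⇂ P) x y
    induced s ε = ε
    induced {P} s {x} (_◅_ {j = y} (within Px Py e) w) = Star.map inside (proj₁ (hyp C (∈⋃⁺ x∈) (∈⋃⁺ y∈))) ◅◅ induced s w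
      where
      back = simple (s Py Px)
      back′ : Path (Edge D) y x
      back′ = mapPath step back
      C : Cycle (Edge D)
      C = record { walk = proj₁ back′ ; distinct = proj₂ back′ ; closing = e }
      x∈ = last∈ (proj₁ back′)
      y∈ = first∈ (proj₁ back′)
      inP : ∀ {z} → z ∈ˢ ⋃ (map ⁅_⁆ (cycleVertices C)) → P z
      inP {z} i = stays (proj₁ back) Py
        (subst (z ∈_) (vertices-map step (proj₁ back)) (∈⋃⁻ (cycleVertices C) i))
      inside : ∀ {u v} → (Adjacent G ↾ ⋃ (map ⁅_⁆ (cycleVertices C))) u v → (Adjacent G ⇂ P) u v
      inside (p , q , a) = within (inP p) (inP q) a
    sym-adj : ∀ {P : Pred V 0ℓ} {x y} → (Adjacent G ⇂ P) x y → (Adjacent G ⇂ P) y x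
    sym-adj (within p q a) = within q p (Graph.symmetric G a)
    elim : ∀ {r l} → Grown (Adjacent G) r l → Elim (Edge D) l
    elim seed = root _
    elim (grow {x} {l} d d∈ dx x∉ g) = leaf d d∈ x∉ through (elim g)
      where
      ≢x : ∀ {z} → z ∈ l → z ≢ x
      ≢x i refl = x∉ i
      -- The tree path from `x` to `y` inside `P` must begin with `d`. Any other first vertex `q`
      -- would be joined to `d` without `x`: along the path to `y`, and from `y` back within `l`.
      through : ∀ {P} → Str (Edge D) P → P x → ∀ {y} → y ∈ l → P y → P d
      through {P} s Px {y} y∈ Py with simple (induced s (s Px Py))
      ... | ε , _ = contradiction y∈ x∉
      ... | _◅_ {j = q} (within _ Pq xq) w , x∉w ∷ _ with q ≟ d
      ...   | yes refl = Pq
      ...   | no q≢d = contradiction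
                (Star.map (⇂-mono step id) (confine w λ { i refl → All¬⇒¬Any x∉w i })
                 ◅◅ Star.map (⇂-mono id ≢x) (Star.reverse sym-adj (Grown-walk g y∈) ◅◅ Grown-walk g d∈))
                (no-bypass {G = G} tree xq dx q≢d)

-- Decompositions of width one yield elimination orders

module _ {n : ℕ} where

  two≤∣p∣ : ∀ {p : Subset n} {x y} → x ∈ˢ p → y ∈ˢ p → x ≢ y → 2 ≤ ∣ p ∣
  two≤∣p∣ x∈ y∈ x≢y = ℕ.≤-trans (s≤s (ℕ.≤-trans (s≤s z≤n) (x∈p⇒∣p-x∣<∣p∣ (x∈p∧x≢y⇒x∈p-y y∈ (x≢y ∘ sym)))))
                                (x∈p⇒∣p-x∣<∣p∣ x∈)

  three≤∣p∣ : ∀ {p : Subset n} {x y z} → x ∈ˢ p → y ∈ˢ p → z ∈ˢ p → x ≢ y → y ≢ z → x ≢ z → 3 ≤ ∣ p ∣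
  three≤∣p∣ x∈ y∈ z∈ x≢y y≢z x≢z =
    ℕ.≤-trans (s≤s (two≤∣p∣ (x∈p∧x≢y⇒x∈p-y y∈ (x≢y ∘ sym)) (x∈p∧x≢y⇒x∈p-y z∈ (x≢z ∘ sym)) y≢z)) (x∈p⇒∣p-x∣<∣p∣ x∈)

  ∈-⋃ : ∀ {x} {p : Subset n} {ps} → x ∈ˢ p → p ∈ ps → x ∈ˢ ⋃ ps
  ∈-⋃ x∈ (here refl) = x∈p∪q⁺ (inj₁ x∈)
  ∈-⋃ x∈ (there i)   = x∈p∪q⁺ (inj₂ (∈-⋃ x∈ i))

  ∈edges : (D : Digraph n) {u v : Fin n} → Edge D u v → (u , v) ∈ edges D
  ∈edges D e = ∈-filter⁺ _ (∈-cartesianProduct⁺ (∈-allFin _) (∈-allFin _)) e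

-- Ancestors in an arborescence

module Arb {m : ℕ} (𝒜 : Arborescence m) where

  open Arborescence 𝒜 using (digraph; oriented; tree)

  private
    N = Fin m
    G = underlying digraph

  E : Rel N 0ℓ
  E = Edge digraph

  top : N
  top = proj₁ (Arborescence.root 𝒜)

  fromTop : ∀ t → Walk E top t
  fromTop = proj₁ (proj₂ (Arborescence.root 𝒜))

  down : ∀ {s t} → E s t → Adjacent G s t
  down e = Equivalence.from T-∨ (inj₁ e)

  up : ∀ {s t} → E s t → Adjacent G t s
  up e = Equivalence.from T-∨ (inj₂ e)

  -- By orientation a walk from `t` to `d` leaves `t` by a neighbour other than `d`, so it would
  -- bypass `t` between two of its neighbours.
  no-return : ∀ {d t} → E d t → ¬ Walk E t d
  no-return {d} {t} e w with simple w
  ... | ε , _ = Digraph.loopless digraph e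
  ... | _◅_ {j = s} f w′ , t∉ ∷ _ =
    no-bypass {G = G} tree (down f) (down e) (λ { refl → oriented e f })
      (Star.map (⇂-mono down id) (confine w′ λ { i refl → All¬⇒¬Any t∉ i }))

  -- Two parents would be joined through `top` by walks avoiding `t`: a walk from `top` to a parent
  -- of `t` that passed through `t` would contradict `no-return`.
  unique-parent : ∀ {d d′ t} → E d t → E d′ t → d ≡ d′
  unique-parent {d} {d′} {t} e e′ with d ≟ d′
  ... | yes p = p
  ... | no d≢d′ = contradiction (Star.reverse (λ (within p q a) → within q p (up a)) (avoid e) ◅◅ Star.map (⇂-mono down id) (avoid e′))
                    (no-bypass {G = G} tree (up e) (down e′) d≢d′)
    where
    avoid : ∀ {c} → E c t → Walk (E ⇂ (_≢ t)) top c
    avoid {c} f = confine (fromTop c) λ { i refl → no-return f (Star.map step (suffixWalk {P = λ _ → ⊤} (fromTop c) _ i)) }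

  top-orphan : ∀ {d} → ¬ E d top
  top-orphan {d} e = no-return e (fromTop d)

  -- Used contrapositively: a node outside `l` has no descendant in `l`, so the newest node of a
  -- grown list is a leaf among the listed ones.
  ancestor-closed : ∀ {l} → Grown E top l → ∀ {a u} → Walk E a u → u ∈ l → a ∈ l
  ancestor-closed g ε i = i
  ancestor-closed g (e ◅ w) i = parent∈ g e (ancestor-closed g w i)
    where
    parent∈ : ∀ {l} → Grown E top l → ∀ {a u} → E a u → u ∈ l → a ∈ l
    parent∈ seed e (here refl) = contradiction e top-orphan
    parent∈ (grow d d∈ f _ g) e (here refl) = there (subst (_∈ _) (unique-parent f e) d∈)
    parent∈ (grow d d∈ f _ g) e (there i) = there (parent∈ g e i)

  last-edge : ∀ {a d t} → E d t → Walk E a t → a ≢ t → Walk E a d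
  last-edge f ε a≢t = contradiction refl a≢t
  last-edge f (e ◅ ε) _ = subst (Walk E _) (unique-parent e f) ε
  last-edge f (e ◅ w@(e′ ◅ w′)) _ = e ◅ last-edge f w λ { refl → no-return e′ w′ }

-- The leaves of the arborescence are removed one at a time.  A leaf with
-- bag {x} either has all its crossing sets through one further vertex g,
-- and then x is eliminated with parent g, or it is merged into its parent.

module Peel {m n : ℕ} (𝒜 : Arborescence m) (R : Rel (Fin n) 0ℓ) where

  open Arb 𝒜

  private
    N = Fin m
    V = Fin n

  AtMost2 : Pred V 0ℓ → Set
  AtMost2 Q = ∀ {x y z} → Q x → Q y → Q z → x ≡ y ⊎ y ≡ z ⊎ x ≡ z

  -- What is left of `Γ t`. Guards are indexed by the lower end of their edge, so the edges at `t`
  -- contribute `γ t` and the `γ c` of the remaining children `c`.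
  Bag : Pred V 0ℓ → (V → N) → (N → Pred V 0ℓ) → List N → N → Pred V 0ℓ
  Bag alive home γ ts t g = alive g × (home g ≡ t ⊎ γ t g ⊎ ∃ λ c → c ∈ ts × E t c × γ c g)

  -- The invariant of the peeling. `guard` weakens `γ-guards` from walks to strong sets, which
  -- survives the changes below; `atMost2` is width at most one, stated without cardinalities.
  record Guarded (ts : List N) (alive : Pred V 0ℓ) (home : V → N) : Set₁ where
    field
      γ       : N → Pred V 0ℓ
      γ?      : ∀ t → Decidable₁ (γ t)
      guard   : ∀ {d t} → t ∈ ts → E d t → ∀ {P} → Str R P → ∀ {x y} →
                alive x → P x → Walk E t (home x) → alive y → P y → ¬ Walk E t (home y) →
                ∃ λ g → alive g × P g × γ t g
      atMost2 : ∀ {t} → t ∈ ts → AtMost2 (Bag alive home γ ts t)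

  Dominates : Pred V 0ℓ → V → V → Set₁
  Dominates alive g x = ∀ {P} → Str R P → P x → ∀ {w} → alive w → w ≢ x → P w → P g

  drop : ∀ {t ts alive home} → Guarded (t ∷ ts) alive home → Guarded ts alive home
  drop {t} {ts} {alive} {home} c = record
    { γ = γ ; γ? = γ? ; guard = guard ∘ there
    ; atMost2 = λ t∈ x y z → atMost2 (there t∈) (bag x) (bag y) (bag z) }
    where
    open Guarded c
    bag : ∀ {u x} → Bag alive home γ ts u x → Bag alive home γ (t ∷ ts) u x
    bag (a , inj₁ h) = a , inj₁ h
    bag (a , inj₂ (inj₁ h)) = a , inj₂ (inj₁ h)
    bag (a , inj₂ (inj₂ (c , i , h))) = a , inj₂ (inj₂ (c , there i , h))

  -- By domination `g` can take over every guarding duty of `x`. Each new bag lies in the image of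
  -- the old one under replacing `x` by `g`, so no bag grows.
  remove : ∀ {ts alive home x g} → Guarded ts alive home → alive x → alive g → g ≢ x → Dominates alive g x →
           Guarded ts (λ v → alive v × v ≢ x) home
  remove {ts} {alive} {home} {x} {g} c ax ag g≢x dom = record
    { γ = γ′ ; γ? = λ t v → γ? t v ⊎-dec ((v ≟ g) ×-dec γ? t x)
    ; guard = guard′ ; atMost2 = atMost2′ }
    where
    open Guarded c
    alive′ = λ v → alive v × v ≢ x
    γ′ : N → Pred V 0ℓ
    γ′ t v = γ t v ⊎ (v ≡ g × γ t x)
    guard′ : ∀ {d t} → t ∈ ts → E d t → ∀ {P} → Str R P → ∀ {a b} →
             alive′ a → P a → Walk E t (home a) → alive′ b → P b → ¬ Walk E t (home b) →
             ∃ λ v → alive′ v × P v × γ′ t v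
    guard′ t∈ e s (a , a≢x) Pa wa (b , _) Pb ¬wb with guard t∈ e s a Pa wa b Pb ¬wb
    ... | v , av , Pv , γv with v ≟ x
    ...   | no v≢x   = v , (av , v≢x) , Pv , inj₁ γv
    ...   | yes refl = g , (ag , g≢x) , dom s Pv a a≢x Pa , inj₂ (refl , γv)
    Image : V → V → Set
    Image v v₀ = v₀ ≡ v ⊎ (v₀ ≡ x × v ≡ g)
    preimage : ∀ {t v} → Bag alive′ home γ′ ts t v → v ≢ x × ∃ λ v₀ → Bag alive home γ ts t v₀ × Image v v₀
    preimage ((a , n) , inj₁ h) = n , _ , (a , inj₁ h) , inj₁ refl
    preimage ((a , n) , inj₂ (inj₁ (inj₁ h))) = n , _ , (a , inj₂ (inj₁ h)) , inj₁ refl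
    preimage ((_ , n) , inj₂ (inj₁ (inj₂ (q , h)))) = n , x , (ax , inj₂ (inj₁ h)) , inj₂ (refl , q)
    preimage ((a , n) , inj₂ (inj₂ (c , i , e , inj₁ h))) = n , _ , (a , inj₂ (inj₂ (c , i , e , h))) , inj₁ refl
    preimage ((_ , n) , inj₂ (inj₂ (c , i , e , inj₂ (q , h)))) = n , x , (ax , inj₂ (inj₂ (c , i , e , h))) , inj₂ (refl , q)
    unique : ∀ {u v u₀ v₀} → u ≢ x → v ≢ x → Image u u₀ → Image v v₀ → u₀ ≡ v₀ → u ≡ v
    unique _   _   (inj₁ refl)       (inj₁ refl)       refl = refl
    unique u≢x _   (inj₁ refl)       (inj₂ (p , _))    refl = contradiction p u≢x
    unique _   v≢x (inj₂ (p , _))    (inj₁ refl)       refl = contradiction p v≢x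
    unique _   _   (inj₂ (_ , refl)) (inj₂ (_ , refl)) _    = refl
    atMost2′ : ∀ {t} → t ∈ ts → AtMost2 (Bag alive′ home γ′ ts t)
    atMost2′ t∈ p q r with preimage p | preimage q | preimage r
    ... | np , _ , bp , ip | nq , _ , bq , iq | nr , _ , br , ir with atMost2 t∈ bp bq br
    ...   | inj₁ e        = inj₁ (unique np nq ip iq e)
    ...   | inj₂ (inj₁ e) = inj₂ (inj₁ (unique nq nr iq ir e))
    ...   | inj₂ (inj₂ e) = inj₂ (inj₂ (unique np nr ip ir e))

  moved : V → N → (V → N) → V → N
  moved x d home z with z ≟ x
  ... | yes _ = d
  ... | no  _ = home z

  merge : ∀ {t d ts alive home x} (c : Guarded (t ∷ ts) alive home) → E d t → t ∉ ts → home x ≡ t →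
          (∀ {z} → alive z → home z ≡ t → z ≡ x) → Guarded.γ c t x →
          Guarded ts alive (moved x d home)
  merge {t} {d} {ts} {alive} {home} {x} c e t∉ hx only γx = record
    { γ = γ ; γ? = γ?
    ; guard = λ {d′} {u} u∈ f s {a} {b} aa Pa wa ab Pb ¬wb →
        guard (there u∈) f s aa Pa (forth a wa) ab Pb (¬wb ∘ back b u∈)
    ; atMost2 = λ u∈ p q r → atMost2 (there u∈) (bag p) (bag q) (bag r) }
    where
    open Guarded c
    forth : ∀ {u} a → Walk E u (moved x d home a) → Walk E u (home a)
    forth a w with a ≟ x
    ... | yes refl = w ◅◅ (subst (E d) (sym hx) e ◅ ε)
    ... | no _ = w
    back : ∀ {u} b → u ∈ ts → Walk E u (home b) → Walk E u (moved x d home b)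
    back b u∈ w with b ≟ x
    -- Here `u` differs from `t`, which is no longer listed, so a walk from `u` to `t` arrives
    -- through the parent `d`.
    ... | yes refl = last-edge e (subst (Walk E _) hx w) λ { refl → t∉ u∈ }
    ... | no _ = w
    bag : ∀ {u v} → Bag alive (moved x d home) γ ts u v → Bag alive home γ (t ∷ ts) u v
    bag {v = v} (a , inj₁ h) with v ≟ x
    ... | yes refl = a , inj₂ (inj₂ (t , here refl , subst (λ u → E u t) h e , γx))
    ... | no _ = a , inj₁ h
    bag (a , inj₂ (inj₁ h)) = a , inj₂ (inj₁ h)
    bag (a , inj₂ (inj₂ (c , i , f , h))) = a , inj₂ (inj₂ (c , there i , f , h))

  Order : Pred V 0ℓ → Set₁
  Order alive = ∃ λ l → Elim R l × (∀ {x} → alive x → x ∈ l) × (∀ {x} → x ∈ l → alive x)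

  extend : ∀ {alive x g} → Decidable₁ alive → alive x → alive g → g ≢ x → Dominates alive g x →
           Order (λ v → alive v × v ≢ x) → Order alive
  extend {alive} {x} {g} alive? ax ag g≢x dom (l , el , complete , sound) =
    x ∷ l ,
    leaf g (complete (ag , g≢x)) (λ i → proj₂ (sound i) refl)
         (λ s Px y∈ Py → dom s Px (proj₁ (sound y∈)) (proj₂ (sound y∈)) Py) el ,
    complete′ , λ { (here refl) → ax ; (there i) → proj₁ (sound i) }
    where
    complete′ : ∀ {z} → alive z → z ∈ x ∷ l
    complete′ {z} az with z ≟ x
    ... | yes p = here p
    ... | no p = there (complete (az , p))

  without? : ∀ {alive : Pred V 0ℓ} → Decidable₁ alive → ∀ x → Decidable₁ (λ v → alive v × v ≢ x)
  without? alive? x v = alive? v ×-dec ¬? (v ≟ x)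

  mutual

    peel : ∀ {ts alive home} → Grown E top ts → Decidable₁ alive → Guarded ts alive home →
           (∀ {x} → alive x → home x ∈ ts) → (∀ {t} → t ∈ ts → ∃ λ x → alive x × home x ≡ t) →
           Order alive
    peel {alive = alive} {home} seed alive? c home∈ inhabited with inhabited (here refl)
    ... | x , ax , hx with any? (λ y → alive? y ×-dec ¬? (y ≟ x))
    ...   | no none = x ∷ [] , root x , complete , λ { (here refl) → ax }
      where
      complete : ∀ {z} → alive z → z ∈ x ∷ []
      complete {z} az with z ≟ x
      ... | yes p = here p
      ... | no p = contradiction (z , az , p) none
    ...   | yes (y , ay , y≢x) =
      y ∷ x ∷ [] , leaf x (here refl) (λ { (here p) → y≢x p }) (λ { _ _ (here refl) Px → Px }) (root x) ,
      complete , λ { (here refl) → ay ; (there (here refl)) → ax }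
      where
      atTop : ∀ {z} → alive z → home z ≡ top
      atTop az with home∈ az
      ... | here p = p
      complete : ∀ {z} → alive z → z ∈ y ∷ x ∷ []
      complete az with Guarded.atMost2 c (here refl) (ay , inj₁ (atTop ay)) (ax , inj₁ hx) (az , inj₁ (atTop az))
      ... | inj₁ p = contradiction p y≢x
      ... | inj₂ (inj₁ p) = there (here (sym p))
      ... | inj₂ (inj₂ p) = here (sym p)
    peel {ts = .t ∷ ts} {alive} {home} (grow {t} d d∈ e t∉ g) alive? c home∈ inhabited
      with inhabited (here refl)
    ... | x , ax , hx with any? (λ y → alive? y ×-dec ((home y ≟ t) ×-dec ¬? (y ≟ x)))
    ...   | no none = peelLeaf g d∈ e t∉ c alive? home∈ (inhabited ∘ there) ax hx only
      where
      only : ∀ {z} → alive z → home z ≡ t → z ≡ x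
      only {z} az hz with z ≟ x
      ... | yes p = p
      ... | no p = contradiction (z , az , hz , p) none
    -- At most one of `x` and `y` guards the edge above `t`: with a vertex living at `d` they would
    -- otherwise be three in the bag of `d`. One that does not guard it is eliminated first.
    ...   | yes (y , ay , hy , y≢x) with Guarded.γ? c t x
    ...     | yes γx = peelDouble g d∈ e t∉ c alive? home∈ inhabited ax ay hx hy y≢x λ γy → three (inhabited (there d∈)) γy
      where
      open Guarded c
      three : (∃ λ z → alive z × home z ≡ d) → ¬ γ t y
      three (z , az , hz) γy with atMost2 (there d∈) (ax , inj₂ (inj₂ (t , here refl , e , γx))) (ay , inj₂ (inj₂ (t , here refl , e , γy))) (az , inj₁ hz)
      ... | inj₁ p = y≢x (sym p)
      ... | inj₂ (inj₁ refl) = t∉ (subst (_∈ ts) (trans (sym hz) hy) d∈)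
      ... | inj₂ (inj₂ refl) = t∉ (subst (_∈ ts) (trans (sym hz) hx) d∈)
    ...     | no ¬γx = peelDouble g d∈ e t∉ c alive? home∈ inhabited ay ax hy hx (y≢x ∘ sym) ¬γx

    -- The bag of `t` is exhausted by `x` and `y`, and `y` does not guard the edge above. A strong
    -- set crossing that edge must then use `x`, so `x` dominates `y`.
    peelDouble : ∀ {t d ts alive home x y} → Grown E top ts → d ∈ ts → E d t → t ∉ ts →
                 (c : Guarded (t ∷ ts) alive home) → Decidable₁ alive →
                 (∀ {x} → alive x → home x ∈ t ∷ ts) → (∀ {u} → u ∈ t ∷ ts → ∃ λ x → alive x × home x ≡ u) →
                 alive x → alive y → home x ≡ t → home y ≡ t → y ≢ x → ¬ Guarded.γ c t y → Order alive
    peelDouble {t} {d} {ts} {alive} {home} {x} {y} g d∈ e t∉ c alive? home∈ inhabited ax ay hx hy y≢x ¬γy =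
      extend alive? ay ax (y≢x ∘ sym) dom
        (peelLeaf g d∈ e t∉ (remove c ay ax (y≢x ∘ sym) dom) (without? alive? y) (home∈ ∘ proj₁)
          (λ u∈ → let z , az , hz = inhabited (there u∈) in
                  z , (az , λ { refl → t∉ (subst (_∈ ts) (trans (sym hz) hy) u∈) }) , hz)
          (ax , y≢x ∘ sym) hx only)
      where
      open Guarded c
      only : ∀ {z} → alive z × z ≢ y → home z ≡ t → z ≡ x
      only (az , z≢y) hz with atMost2 (here refl) (ax , inj₁ hx) (ay , inj₁ hy) (az , inj₁ hz)
      ... | inj₁ p = contradiction (sym p) y≢x
      ... | inj₂ (inj₁ p) = contradiction (sym p) z≢y
      ... | inj₂ (inj₂ p) = sym p
      dom : Dominates alive x y
      dom {P} s Py {w} aw w≢y Pw with home∈ aw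
      ... | here hw = subst P (only (aw , w≢y) hw) Pw
      ... | there i with guard (here refl) e s ay Py (subst (Walk E t) (sym hy) ε) aw Pw (λ v → t∉ (ancestor-closed g v i))
      ...   | v , av , Pv , γv with atMost2 (here refl) (ax , inj₁ hx) (ay , inj₁ hy) (av , inj₂ (inj₁ γv))
      ...     | inj₁ p = contradiction (sym p) y≢x
      ...     | inj₂ (inj₁ refl) = contradiction γv ¬γy
      ...     | inj₂ (inj₂ refl) = Pv

    peelLeaf : ∀ {t d ts alive home x} → Grown E top ts → d ∈ ts → E d t → t ∉ ts →
               Guarded (t ∷ ts) alive home → Decidable₁ alive →
               (∀ {x} → alive x → home x ∈ t ∷ ts) → (∀ {u} → u ∈ ts → ∃ λ x → alive x × home x ≡ u) →
               alive x → home x ≡ t → (∀ {z} → alive z → home z ≡ t → z ≡ x) → Order alive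
    peelLeaf {t} {d} {ts} {alive} {home} {x} g d∈ e t∉ c alive? home∈ inhabited ax hx only with Guarded.γ? c t x
    ... | yes γx = peel g alive? (merge c e t∉ hx only γx) home∈′ inhabited′
      where
      home∈′ : ∀ {z} → alive z → moved x d home z ∈ ts
      home∈′ {z} az with z ≟ x
      ... | yes _ = d∈
      ... | no z≢x with home∈ az
      ...   | here hz = contradiction (only az hz) z≢x
      ...   | there i = i
      moved-≢ : ∀ {z} → z ≢ x → moved x d home z ≡ home z
      moved-≢ {z} z≢x with z ≟ x
      ... | yes p = contradiction p z≢x
      ... | no _ = refl
      inhabited′ : ∀ {u} → u ∈ ts → ∃ λ z → alive z × moved x d home z ≡ u
      inhabited′ u∈ with inhabited u∈
      ... | z , az , refl = z , az , moved-≢ λ { refl → t∉ (subst (_∈ ts) hx u∈) }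
    ... | no ¬γx = dominated (any? λ v → alive? v ×-dec γ? t v)
      where
      open Guarded c
      rest : ∀ {z} → alive z → z ≢ x → home z ∈ ts
      rest az z≢x with home∈ az
      ... | here hz = contradiction (only az hz) z≢x
      ... | there i = i
      crossing : ∀ {P} → Str R P → P x → ∀ {w} → alive w → w ≢ x → P w → ∃ λ v → alive v × P v × γ t v
      crossing s Px aw w≢x Pw = guard (here refl) e s ax Px (subst (Walk E t) (sym hx) ε) aw Pw
        λ w → t∉ (ancestor-closed g w (rest aw w≢x))
      finish : ∀ {v} → alive v → v ≢ x → Dominates alive v x → Order alive
      finish av v≢x dom = extend alive? ax av v≢x dom
        (peel g (without? alive? x) (drop (remove c ax av v≢x dom))
              (λ (az , z≢x) → rest az z≢x)
              λ u∈ → let z , az , hz = inhabited u∈ in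
                     z , (az , λ { refl → t∉ (subst (_∈ ts) (trans (sym hz) hx) u∈) }) , hz)
      dominated : Dec (∃ λ v → alive v × γ t v) → Order alive
      dominated (yes (v , av , γv)) = finish av (λ { refl → ¬γx γv }) dom
        where
        dom : Dominates alive v x
        dom {P} s Px aw w≢x Pw with crossing s Px aw w≢x Pw
        ... | v′ , av′ , Pv′ , γv′ with atMost2 (here refl) (ax , inj₁ hx) (av , inj₂ (inj₁ γv)) (av′ , inj₂ (inj₁ γv′))
        ...   | inj₁ refl = contradiction γv ¬γx
        ...   | inj₂ (inj₁ refl) = Pv′
        ...   | inj₂ (inj₂ refl) = contradiction γv′ ¬γx
      -- Without a living guard no strong set joins `x` to another living vertex, so any vertex can
      -- serve as parent.
      dominated (no none) with inhabited d∈
      ... | z , az , hz = finish az (λ { refl → t∉ (subst (_∈ ts) (trans (sym hz) hx) d∈) })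
        λ s Px aw w≢x Pw → let v , av , _ , γv = crossing s Px aw w≢x Pw in contradiction (v , av , γv) none

module _ {n : ℕ} (D : Digraph n) where

  private V = Fin n

  module _ (𝒯 : DirectedTreeDecomposition D) where

    open DirectedTreeDecomposition 𝒯 hiding (width)
    open Arb arborescence

    β⊆Γ : ∀ {t g} → g ∈ˢ β t → g ∈ˢ Γ t
    β⊆Γ i = x∈p∪q⁺ (inj₁ i)

    γ⊆Γ : ∀ {d s t g} → E d s → t ≡ d ⊎ t ≡ s → g ∈ˢ γ d s → g ∈ˢ Γ t
    γ⊆Γ {d} {s} e t≡ i = x∈p∪q⁺ (inj₂ (∈-⋃ i (∈-map⁺ (uncurry γ) (∈-filter⁺ _ (∈edges digraph e) t≡))))

    home : V → Fin size
    home v = proj₁ (β-covers v)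

    ↓⇒Walk : ∀ {v t} → v ∈β↓ t → Walk E t (home v)
    ↓⇒Walk {v} (t′ , w , i) = subst (Walk E _) (β-disjoint i (proj₂ (β-covers v))) w

    Walk⇒↓ : ∀ {v t} → Walk E t (home v) → v ∈β↓ t
    Walk⇒↓ {v} w = home v , w , proj₂ (β-covers v)

    bags≤ : ∀ t → ∣ Γ t ∣ ≤ suc (width 𝒯)
    bags≤ t = ℕ.≤-trans (All.lookup (xs≤max 0 (map (λ t → ∣ Γ t ∣) (allFin size))) (∈-map⁺ (λ t → ∣ Γ t ∣) (∈-allFin t)))
                        (ℕ.m≤n+m∸n _ 1)

    -- Going from `x` to `y` and back inside `P` gives a walk to which `γ-guards` applies, and its
    -- guarding vertex lies in `P`.
    crossing-guarded : ∀ {d t} → E d t → ∀ {P} → Str (Edge D) P → ∀ {x y} → P x → Walk E t (home x) → P y → ¬ Walk E t (home y) →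
               ∃ λ g → P g × g ∈ˢ γ d t
    crossing-guarded e {P} s {x} {y} Px wx Py ¬wy =
      let g , g∈ , γg = find (γ-guards e w (Walk⇒↓ wx) (Walk⇒↓ wx) (lose y∈ (¬wy ∘ ↓⇒Walk)))
      in g , stays w′ Px (subst (g ∈_) (vertices-map step w′) g∈) , γg
      where
      w′ = s Px Py ◅◅ s Py Px
      w = Star.map step w′
      y∈ : y ∈ vertices w
      y∈ = subst (y ∈_) (sym (vertices-map step w′)) (middle∈ (s Px Py) (s Py Px))

    width≤1⇒Elim : width 𝒯 ≤ 1 → EliminationOrder D
    width≤1⇒Elim w≤1 =
      let ts , g , all = spanning (λ s t → T? (Digraph.adj digraph s t)) top fromTop
          l , el , complete , _ = Peel.peel arborescence (Edge D) {alive = λ _ → ⊤} {home = home} g (λ _ → yes tt) (guarded ts)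
                              (λ _ → all _) (λ {t} _ → let x , i = β-nonempty t in x , tt , β-disjoint (proj₂ (β-covers x)) i)
      in l , el , λ x → complete {x} tt
      where
      open Peel arborescence (Edge D) using (Guarded; Bag; AtMost2)
      -- Parents are unique, so indexing a guard by the lower end of its edge loses nothing.
      γ̂ : Fin size → Pred V 0ℓ
      γ̂ t g = ∃ λ d → E d t × g ∈ˢ γ d t
      inΓ : ∀ {ts t g} → Bag (λ _ → ⊤) home γ̂ ts t g → g ∈ˢ Γ t
      inΓ {g = g} (_ , inj₁ refl) = β⊆Γ (proj₂ (β-covers g))
      inΓ (_ , inj₂ (inj₁ (d , e , i))) = γ⊆Γ e (inj₂ refl) i
      inΓ (_ , inj₂ (inj₂ (c , _ , f , (d , e , i)))) with refl ← unique-parent e f = γ⊆Γ e (inj₁ refl) i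
      few : ∀ {t} → AtMost2 (_∈ˢ Γ t)
      few {t} {x} {y} {z} i j k with x ≟ y | y ≟ z | x ≟ z
      ... | yes p | _ | _ = inj₁ p
      ... | _ | yes p | _ = inj₂ (inj₁ p)
      ... | _ | _ | yes p = inj₂ (inj₂ p)
      ... | no p | no q | no r = contradiction (ℕ.≤-trans (three≤∣p∣ i j k p q r) (ℕ.≤-trans (bags≤ t) (s≤s w≤1))) λ { (s≤s (s≤s ())) }
      guarded : ∀ ts → Guarded ts (λ _ → ⊤) home
      guarded ts = record
        { γ = γ̂ ; γ? = λ t g → any? λ d → T? (Digraph.adj digraph d t) ×-dec (g ∈ˢ? γ d t)
        ; guard = λ _ e s _ Px wx _ Py ¬wy → let g , Pg , i = crossing-guarded e s Px wx Py ¬wy in g , tt , Pg , (_ , e , i)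
        ; atMost2 = λ _ p q r → few (inΓ p) (inΓ q) (inΓ r) }

    -- If two distinct vertices live at the root, its bag is large enough. Otherwise there is an
    -- edge of the arborescence; a vertex guarding it lies in the bags of both ends and differs from
    -- a resident of one of them.
    1≤width : 2 ≤ n → StronglyConnected D → 1 ≤ width 𝒯
    1≤width 2≤n strong = let t , 2≤ = bigBag (pair 2≤n) in ℕ.≤-pred (ℕ.≤-trans 2≤ (bags≤ t))
      where
      pair : ∀ {n} → 2 ≤ n → ∃₂ λ (x y : Fin n) → x ≢ y
      pair (s≤s (s≤s _)) = zero , suc zero , λ ()
      across : ∀ {d t} → E d t → ∃ λ t → 2 ≤ ∣ Γ t ∣
      across {d} {t} e with β-nonempty t | β-nonempty d
      ... | u , u∈ | z , z∈ with crossing-guarded e {λ _ → ⊤} (λ {x} {y} _ _ → Star.map (within tt tt) (proj₁ (strong x y)))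
                                  {u} {z} tt (subst (Walk E t) (β-disjoint u∈ (proj₂ (β-covers u))) ε) tt
                                  (λ w → no-return e (subst (Walk E t) (β-disjoint (proj₂ (β-covers z)) z∈) w))
      ...   | g , _ , γg with g ≟ u
      ...     | yes refl = d , two≤∣p∣ (β⊆Γ z∈) (γ⊆Γ e (inj₁ refl) γg) λ { refl → no-return e (subst (Walk E t) (β-disjoint u∈ z∈) ε) }
      ...     | no g≢u = t , two≤∣p∣ (γ⊆Γ e (inj₂ refl) γg) (β⊆Γ u∈) g≢u
      firstEdge : ∀ {t} → Walk E top t → top ≢ t → ∃ λ t → 2 ≤ ∣ Γ t ∣
      firstEdge ε ≢ = contradiction refl ≢
      firstEdge (e ◅ _) _ = across e
      bigBag : (∃₂ λ (x y : V) → x ≢ y) → ∃ λ t → 2 ≤ ∣ Γ t ∣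
      bigBag (x , y , x≢y) with top ≟ home x | top ≟ home y
      ... | no p | _ = firstEdge (fromTop (home x)) p
      ... | _ | no p = firstEdge (fromTop (home y)) p
      ... | yes p | yes q = top , two≤∣p∣ (β⊆Γ (subst (λ t → x ∈ˢ β t) (sym p) (proj₂ (β-covers x))))
                                          (β⊆Γ (subst (λ t → y ∈ˢ β t) (sym q) (proj₂ (β-covers y)))) x≢y

-- Elimination orders yield decompositions of width one

module _ {n : ℕ} where

  private V = Fin n

  walk? : {R : Rel V 0ℓ} → Decidable R → Decidable (Walk R)
  walk? R? x y with l , g , closed ← saturate R? x with y ∈? l
  ... | yes i = yes (Star.map step (Grown-walk g i))
  ... | no y∉ = no λ w → y∉ (follow w (Grown-root g))
    where
    follow : ∀ {z} → Walk _ z y → z ∈ l → y ∈ l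
    follow ε i = i
    follow (e ◅ w) i = follow w (closed i e)

  greatest : {_⊑_ : Rel V 0ℓ} → Transitive _⊑_ → Total _⊑_ → {Q : Pred V 0ℓ} → Decidable₁ Q → ∃ Q →
             ∃ λ v → Q v × (∀ {u} → Q u → u ⊑ v)
  greatest {_⊑_} tr total {Q} Q? (v , q) = let v , q , best = go (allFin n) v q in v , q , λ p → best (∈-allFin _) p
    where
    go : ∀ xs v → Q v → ∃ λ v → Q v × (∀ {u} → u ∈ xs → Q u → u ⊑ v)
    go [] v q = v , q , λ ()
    go (x ∷ xs) v q with go xs v q
    ... | w , qw , best with Q? x
    ...   | no ¬qx = w , qw , λ { (here refl) p → contradiction p ¬qx ; (there i) p → best i p }
    ...   | yes qx with total x w
    ...     | inj₁ x≤w = w , qw , λ { (here refl) _ → x≤w ; (there i) p → best i p }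
    ...     | inj₂ w≤x = x , qx , λ { (here refl) _ → reduce (total x x) ; (there i) p → tr (best i p) w≤x }

  ∈-⋃⁻ : ∀ {x} (ps : List (Subset n)) → x ∈ˢ ⋃ ps → ∃ λ p → p ∈ ps × x ∈ˢ p
  ∈-⋃⁻ [] i = contradiction i ∉⊥
  ∈-⋃⁻ (p ∷ ps) i with x∈p∪q⁻ p _ i
  ... | inj₁ j = p , here refl , j
  ... | inj₂ j = let q , q∈ , k = ∈-⋃⁻ ps j in q , there q∈ , k

∣p∪q∣≤∣p∣+∣q∣ : ∀ {n} (p q : Subset n) → ∣ p ∪ q ∣ ≤ ∣ p ∣ + ∣ q ∣
∣p∪q∣≤∣p∣+∣q∣ [] [] = z≤n
∣p∪q∣≤∣p∣+∣q∣ (true ∷ p) (true ∷ q) = s≤s (ℕ.≤-trans (∣p∪q∣≤∣p∣+∣q∣ p q) (ℕ.+-monoʳ-≤ ∣ p ∣ (ℕ.n≤1+n ∣ q ∣)))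
∣p∪q∣≤∣p∣+∣q∣ (true ∷ p) (false ∷ q) = s≤s (∣p∪q∣≤∣p∣+∣q∣ p q)
∣p∪q∣≤∣p∣+∣q∣ (false ∷ p) (true ∷ q) = subst (suc ∣ p ∪ q ∣ ≤_) (sym (ℕ.+-suc ∣ p ∣ ∣ q ∣)) (s≤s (∣p∪q∣≤∣p∣+∣q∣ p q))
∣p∪q∣≤∣p∣+∣q∣ (false ∷ p) (false ∷ q) = ∣p∪q∣≤∣p∣+∣q∣ p q

-- K v is the strong component of v among the vertices of rank at least
-- ρ v.  These components are laminar, and the arborescence ordered by
-- them, rather than the hypertree itself, carries the decomposition.

module Components {n : ℕ} (D : Digraph n) (strong : StronglyConnected D) (k : Rank (Edge D)) where

  open Rank k

  private V = Fin n

  Above : V → Pred V 0ℓ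
  Above v z = ρ v ≤ ρ z

  K : V → Pred V 0ℓ
  K v x = Walk (Edge D ⇂ Above v) v x × Walk (Edge D ⇂ Above v) x v

  K? : ∀ v → Decidable₁ (K v)
  K? v x = walk? R? v x ×-dec walk? R? x v
    where
    R? : Decidable (Edge D ⇂ Above v)
    R? a b with ρ v ℕ.≤? ρ a | ρ v ℕ.≤? ρ b | T? (Digraph.adj D a b)
    ... | yes p | yes q | yes e = yes (within p q e)
    ... | no ¬p | _ | _ = no (¬p ∘ source)
    ... | _ | no ¬q | _ = no (¬q ∘ target)
    ... | _ | _ | no ¬e = no (¬e ∘ step)

  K-refl : ∀ {v} → K v v
  K-refl = ε , ε

  Top : V → Pred V 0ℓ → Set
  Top v P = P v × (∀ {z} → P z → Above v z)

  K⁺ : ∀ {P v x} → Str (Edge D) P → Top v P → P x → K v x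
  K⁺ s (Pv , low) Px = Star.map (⇂-mono id low) (s Pv Px) , Star.map (⇂-mono id low) (s Px Pv)

  K⁻ : ∀ {v x} → K v x → ∃ λ P → Str (Edge D) P × Top v P × P x
  K⁻ {v} {x} (p , q) = (λ z → z ∈ vertices p ⊎ z ∈ vertices q) , Str-mono step (Str-closed p q) ,
    (inj₁ (first∈ p) , λ { (inj₁ i) → stays p ℕ.≤-refl i ; (inj₂ i) → stays q (walk-end p ℕ.≤-refl) i }) ,
    inj₁ (last∈ p)

  K-above : ∀ {v x} → K v x → ρ v ≤ ρ x
  K-above (p , _) = walk-end p ℕ.≤-refl

  K-trans : ∀ {u v x} → K u v → K v x → K u x
  K-trans uv@(p , q) (p′ , q′) = p ◅◅ Star.map lift p′ , Star.map lift q′ ◅◅ q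
    where lift = ⇂-mono id (ℕ.≤-trans (K-above uv))

  r-min : ∀ x → ρ r ≤ ρ x
  r-min x = go x (<-wellFounded _)
    where
    go : ∀ x → Acc _<_ (ρ x) → ρ r ≤ ρ x
    go x (acc rs) with x ≟ r
    ... | yes refl = ℕ.≤-refl
    ... | no x≢r = ℕ.≤-trans (go (par x) (rs (ρ-par x≢r))) (ℕ.<⇒≤ (ρ-par x≢r))

  antisym : ∀ {x y} → ρ x ≤ ρ y → ρ y ≤ ρ x → x ≡ y
  antisym p q = ρ-inj (ℕ.≤-antisym p q)

  strict : ∀ {x y} → ρ x ≤ ρ y → y ≢ x → ρ x < ρ y
  strict p y≢x = ℕ.≤∧≢⇒< p λ e → y≢x (ρ-inj (sym e))

  -- From the common vertex, passing to parents stays in both sets until the lowest vertex of one of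
  -- them is reached. This is the laminarity of the components.
  tops-meet : ∀ {P Q s t z} → Str (Edge D) P → Str (Edge D) Q → Top s P → Top t Q → P z → Q z → Q s ⊎ P t
  tops-meet {P} {Q} {s} {t} sP sQ (Ps , lowP) (Qt , lowQ) Pz Qz = go _ Pz Qz (<-wellFounded _)
    where
    go : ∀ z → P z → Q z → Acc _<_ (ρ z) → Q s ⊎ P t
    go z Pz Qz (acc rs) with z ≟ s | z ≟ t
    ... | yes refl | _ = inj₁ Qz
    ... | _ | yes refl = inj₂ Pz
    ... | no z≢s | no z≢t = go (par z) (dom sP Pz Ps s<z) (dom sQ Qz Qt (strict (lowQ Qz) z≢t))
                               (rs (ρ-par λ { refl → ℕ.<⇒≱ s<z (r-min s) }))
      where s<z = strict (lowP Pz) z≢s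

  K-r : ∀ u → K r u
  K-r u = Star.map (within (r-min _) (r-min _)) (proj₁ (strong r u)) , Star.map (within (r-min _) (r-min _)) (proj₁ (strong u r))

  Enclosing : V → Pred V 0ℓ
  Enclosing u v = v ≢ u × K v u

  enclosing : ∀ u → u ≢ r → ∃ λ v → Enclosing u v × (∀ {w} → Enclosing u w → ρ w ≤ ρ v)
  enclosing u u≢r = greatest {_⊑_ = λ v w → ρ v ≤ ρ w} ℕ.≤-trans (λ v w → ℕ.≤-total (ρ v) (ρ w)) (λ v → ¬? (v ≟ u) ×-dec K? v u) (r , (u≢r ∘ sym) , K-r u)

  -- As components containing `u` are nested, the enclosing vertex of greatest rank names the
  -- smallest of them. The value at `r` is arbitrary.
  q : V → V
  q u with u ≟ r
  ... | yes _  = r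
  ... | no u≢r = proj₁ (enclosing u u≢r)

  q-enclosing : ∀ {u} → u ≢ r → Enclosing u (q u) × (∀ {w} → Enclosing u w → ρ w ≤ ρ (q u))
  q-enclosing {u} u≢r with u ≟ r
  ... | yes u≡r = contradiction u≡r u≢r
  ... | no u≢r′ = proj₂ (enclosing u u≢r′)

  ρ-q : ∀ {u} → u ≢ r → ρ (q u) < ρ u
  ρ-q u≢r = let (q≢u , Kqu) , _ = q-enclosing u≢r in strict (K-above Kqu) (q≢u ∘ sym)

  open ParentTree r q ρ ρ-q

  Walk⇒K : ∀ {u x} → Walk (Edge digraph) u x → K u x
  Walk⇒K ε = K-refl
  Walk⇒K {u} (_◅_ {j = s} e w) with edge⁻ e
  ... | s≢r , refl = K-trans (proj₂ (proj₁ (q-enclosing s≢r))) (Walk⇒K w)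

  -- It suffices that `K u` contains `q x`. By laminarity the only alternative is that `u` lies in
  -- the component of `q x`, and then `u` is `q x`, because `q x` has the greatest rank among the
  -- vertices enclosing `x`.
  K⇒Walk : ∀ {u x} → K u x → Walk (Edge digraph) u x
  K⇒Walk {u} {x} = go x (<-wellFounded _)
    where
    go : ∀ x → Acc _<_ (ρ x) → K u x → Walk (Edge digraph) u x
    go x (acc rs) Kux with x ≟ u
    ... | yes refl = ε
    ... | no x≢u with x ≟ r
    ...   | yes refl = contradiction (antisym (r-min u) (K-above Kux)) x≢u
    ...   | no x≢r = go (q x) (rs (ρ-q x≢r)) Kuq ◅◅ (edge⁺ (x≢r , refl) ◅ ε)
      where
      Kqx = proj₂ (proj₁ (q-enclosing x≢r))
      u≤q = proj₂ (q-enclosing x≢r) ((x≢u ∘ sym) , Kux)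
      Kuq : K u (q x)
      Kuq with K⁻ Kux | K⁻ Kqx
      ... | P , sP , tP , Px | Q , sQ , tQ , Qx with tops-meet sP sQ tP tQ Px Qx
      ...   | inj₁ Qu = subst (K u) (antisym u≤q (proj₂ tQ Qu)) K-refl
      ...   | inj₂ Pq = K⁺ sP tP Pq

  -- Close `w` up inside `K t` and let `s` be the lowest vertex of the result. If `s` is `t`, then
  -- all of `w` lies in `K t`. Otherwise `s` encloses `t`, hence ranks no higher than `d`, and
  -- laminarity puts `d` on the closed walk; the closing part is excluded because `d` ranks below
  -- `t`.
  guards : ∀ {d t} → Edge digraph d t → ∀ {u v} (w : Walk (Edge D) u v) → K t u → K t v →
           (∃ λ y → y ∈ vertices w × ¬ K t y) → d ∈ vertices w
  guards {d} {t} e {u} {v} w (p , q′) (p′ , q″) (y , y∈ , ¬Ky) with d ∈? vertices w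
  ... | yes i = i
  ... | no d∉ with edge⁻ e
  -- With the order reversed, `greatest` returns a vertex of least rank.
  ...   | t≢r , refl = ⊥-elim (absurd (greatest {_⊑_ = λ v w → ρ w ≤ ρ v} (λ p q → ℕ.≤-trans q p) (λ v w → ℕ.≤-total (ρ w) (ρ v)) P? (t , Pt)))
    where
    back : Walk (Edge D ⇂ Above t) v u
    back = q″ ◅◅ p
    P : Pred V 0ℓ
    P z = z ∈ vertices w ⊎ z ∈ vertices back
    P? : Decidable₁ P
    P? z = (z ∈? vertices w) ⊎-dec (z ∈? vertices back)
    sP : Str (Edge D) P
    sP = Str-hub u λ
      { (inj₁ i) → suffixWalk w inj₁ i ◅◅ back′ (last∈ back) , prefixWalk w inj₁ i
      ; (inj₂ i) → Star.map (⇂-mono step id) (suffixWalk back inj₂ i)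
                 , confine w inj₁ ◅◅ Star.map (⇂-mono step id) (prefixWalk back inj₂ i) }
      where
      back′ : ∀ {z} → z ∈ vertices back → Walk (Edge D ⇂ P) v z
      back′ i = Star.map (⇂-mono step id) (prefixWalk back inj₂ i)
    Pt : P t
    Pt = inj₂ (middle∈ q″ p)
    ¬Pd : ¬ P (q t)
    ¬Pd (inj₁ i) = d∉ i
    ¬Pd (inj₂ i) = ℕ.<⇒≱ (ρ-q t≢r) (stays back (walk-end p′ ℕ.≤-refl) i)
    absurd : (∃ λ s → P s × (∀ {z} → P z → ρ s ≤ ρ z)) → ⊥
    absurd (s , Ps , low) with s ≟ t
    ... | yes refl = ¬Ky (K⁺ sP (Ps , low) (inj₁ y∈))
    ... | no s≢t = meet (K⁻ Kdt)
      where
      Kdt = proj₂ (proj₁ (q-enclosing t≢r))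
      s≤d = proj₂ (q-enclosing t≢r) (s≢t , K⁺ sP (Ps , low) Pt)
      meet : (∃ λ Q → Str (Edge D) Q × Top (q t) Q × Q t) → ⊥
      meet (Q , sQ , tQ , Qt) with tops-meet sP sQ (Ps , low) tQ Pt Qt
      ... | inj₁ Qs = ¬Pd (subst P (antisym s≤d (proj₂ tQ Qs)) Ps)
      ... | inj₂ Pd = ¬Pd Pd

  -- Guarding each edge by its upper end keeps the bags small: the edges leading down from `t`
  -- contribute only `t` itself.
  decomposition : DirectedTreeDecomposition D
  decomposition = record
    { arborescence = arborescence
    ; β = ⁅_⁆ ; γ = λ d _ → ⁅ d ⁆
    ; β-nonempty = λ t → t , x∈⁅x⁆ t
    ; β-disjoint = λ {s} {t} i j → trans (sym (x∈⁅y⁆⇒x≡y s i)) (x∈⁅y⁆⇒x≡y t j)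
    ; β-covers = λ v → v , x∈⁅x⁆ v
    ; γ-guards = λ {d} {t} e w (t′ , wu , i) (t″ , wv , j) out →
        let y , y∈ , ¬y = find out in
        lose (guards e w (subst (K t) (sym (x∈⁅y⁆⇒x≡y t′ i)) (Walk⇒K wu)) (subst (K t) (sym (x∈⁅y⁆⇒x≡y t″ j)) (Walk⇒K wv))
                     (y , y∈ , λ Ky → ¬y (y , K⇒Walk Ky , x∈⁅x⁆ y)))
             (x∈⁅x⁆ d) }

  Γ⊆ : ∀ t → DirectedTreeDecomposition.Γ decomposition t ⊆ ⁅ t ⁆ ∪ ⁅ q t ⁆
  Γ⊆ t {g} i with x∈p∪q⁻ ⁅ t ⁆ _ i
  ... | inj₁ j = x∈p∪q⁺ (inj₁ j)
  ... | inj₂ j with ∈-⋃⁻ _ j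
  ...   | _ , p∈ , g∈ with ∈-map⁻ (uncurry (λ (d _ : V) → ⁅ d ⁆)) p∈
  ...     | (d , s) , ds∈ , refl with x∈⁅y⁆⇒x≡y d g∈ | ∈-filter⁻ (λ (d , s) → (t ≟ d) ⊎-dec (t ≟ s)) {xs = edges digraph} ds∈
  ...       | refl | ds∈′ , inj₁ refl = x∈p∪q⁺ (inj₁ (x∈⁅x⁆ t))
  ...       | refl | ds∈′ , inj₂ refl with edge⁻ (proj₂ (∈-filter⁻ (λ (u , v) → T? (Digraph.adj digraph u v)) {xs = cartesianProduct (allFin n) (allFin n)} ds∈′))
  ...         | _ , refl = x∈p∪q⁺ (inj₂ (x∈⁅x⁆ (q t)))

  width≤1 : width decomposition ≤ 1
  width≤1 = ℕ.∸-monoˡ-≤ 1 (max≤v⁺ {v = 2} {⊥ = 0} z≤n (All.tabulate λ i → small (∈-map⁻ _ i)))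
    where
    small : ∀ {m} → (∃ λ t → t ∈ allFin n × m ≡ ∣ DirectedTreeDecomposition.Γ decomposition t ∣) → m ≤ 2
    small (t , _ , refl) = ℕ.≤-trans (p⊆q⇒∣p∣≤∣q∣ (Γ⊆ t)) (ℕ.≤-trans (∣p∪q∣≤∣p∣+∣q∣ ⁅ t ⁆ ⁅ q t ⁆)
      (ℕ.≤-reflexive (cong₂ _+_ (∣⁅x⁆∣≡1 t) (∣⁅x⁆∣≡1 (q t)))))

Rank⇒dtw1 : ∀ {n} (D : Digraph n) → 2 ≤ n → StronglyConnected D → Rank (Edge D) → HasDirectedTreewidth D 1
Rank⇒dtw1 D 2≤n strong k =
  (decomposition , ℕ.≤-antisym width≤1 (1≤width D decomposition 2≤n strong)) , λ 𝒯 → 1≤width D 𝒯 2≤n strong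
  where open Components D strong k

-- Obstructions lift along butterfly minors

module _ {n : ℕ} where

  private V = Fin n

  Str-flip : {R : Rel V 0ℓ} {P : Pred V 0ℓ} → Str R P → Str (flip R) P
  Str-flip s Px Py = Star.reverse (λ (within p q e) → within q p e) (s Py Px)

  Obs-flip : {R : Rel V 0ℓ} → Obs R → Obs (flip R)
  Obs-flip o = record
    { strA = Str-flip strA ; strB = Str-flip strB ; strC = Str-flip strC
    ; AB = AB ; BC = BC ; CA = CA ; none = none }
    where open Obs o

module _ {n : ℕ} where

  private V = Fin n

  Subgraph-Obs : ∀ {m} {H : Digraph m} {D : Digraph n} → Subgraph H D → Obs (Edge H) → Obs (Edge D)
  Subgraph-Obs {m} {H} {D} (f , f-inj , f-edge) o = record
    { strA = image-Str strA ; strB = image-Str strB ; strC = image-Str strC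
    ; AB = image-meet AB ; BC = image-meet BC ; CA = image-meet CA
    ; none = λ (x , p , a) (y , q , b) (z , r , c) →
        none a (subst B (f-inj (trans q (sym p))) b) (subst C (f-inj (trans r (sym p))) c) }
    where
    open Obs o
    Image : Pred (Fin m) 0ℓ → Pred V 0ℓ
    Image P y = ∃ λ x → f x ≡ y × P x
    image-Str : ∀ {P} → Str (Edge H) P → Str (Edge D) (Image P)
    image-Str s (x , refl , Px) (y , refl , Py) =
      Star.gmap f (λ (within p q e) → within (_ , refl , p) (_ , refl , q) (f-edge e)) (s Px Py)
    image-meet : ∀ {P Q} → (∃ λ x → P x × Q x) → ∃ λ y → Image P y × Image Q y
    image-meet (x , p , q) = f x , (x , refl , p) , (x , refl , q)

  -- If v is the only out-neighbour of u, an edge of the quotient leaving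
  -- the merged vertex comes from v; so every closed walk of the quotient
  -- lifts to one through v, possibly also using u.

  module Lift {m : ℕ} {R : Rel V 0ℓ} {R′ : Rel (Fin m) 0ℓ} {u v : V} (uv : R u v) (u≢v : u ≢ v)
              (only : ∀ {w} → R u w → w ≡ v) (π : V → Fin m) (surj : ∀ b → ∃ λ x → π x ≡ b)
              (merged : ∀ {x y} → π x ≡ π y → x ≡ y ⊎ (x ≡ u × y ≡ v) ⊎ (x ≡ v × y ≡ u))
              (πuv : π u ≡ π v)
              (edge : ∀ {a b} → R′ a b → a ≢ b × ∃₂ λ x y → π x ≡ a × π y ≡ b × R x y) where

    representative : ∀ b → ∃ λ x → π x ≡ b × x ≢ u
    representative b with surj b
    ... | x , refl with x ≟ u
    ...   | yes refl = v , sym πuv , u≢v ∘ sym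
    ...   | no x≢u = x , refl , x≢u

    same : ∀ {x y} → π x ≡ π y → x ≢ u → y ≢ u → x ≡ y
    same p x≢u y≢u with merged p
    ... | inj₁ q = q
    ... | inj₂ (inj₁ (x≡u , _)) = contradiction x≡u x≢u
    ... | inj₂ (inj₂ (_ , y≡u)) = contradiction y≡u y≢u

    -- From `u` one can always step to `v`, but `u` may be included only if it can also be reached,
    -- that is, if an edge enters it from another vertex lying over `P`.
    Lifted : Pred (Fin m) 0ℓ → Pred V 0ℓ
    Lifted P x = P (π x) × (x ≡ u → ∃ λ y → R y u × y ≢ u × P (π y))

    lifted : ∀ {P x} → P (π x) → x ≢ u → Lifted P x
    lifted p x≢u = p , λ x≡u → contradiction x≡u x≢u

    liftEdge : ∀ {P a b} → (R′ ⇂ P) a b → ∀ {x} → π x ≡ a → x ≢ u →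
               ∃ λ y → π y ≡ b × y ≢ u × Walk (R ⇂ Lifted P) x y
    liftEdge {P} (within Pa Pb e) refl x≢u with edge e
    ... | a≢b , x′ , y , πx , refl , e′ with x′ ≟ u | y ≟ u
    ...   | yes refl | _ = contradiction (trans (sym πx) (trans πuv (cong π (sym (only e′))))) a≢b
    ...   | no x′≢u | no y≢u with refl ← same πx x′≢u x≢u =
      y , refl , y≢u , within (lifted {P} Pa x≢u) (lifted {P} Pb y≢u) e′ ◅ ε
    ...   | no x′≢u | yes refl with refl ← same πx x′≢u x≢u =
      v , sym πuv , u≢v ∘ sym ,
      within (lifted {P} Pa x≢u) Pu e′ ◅ within Pu (lifted {P} (subst P πuv Pb) (u≢v ∘ sym)) uv ◅ ε
      where
      Pu : Lifted P u
      Pu = Pb , λ _ → _ , e′ , x≢u , Pa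

    liftWalk : ∀ {P a b} → Walk (R′ ⇂ P) a b → ∀ {x y} → π x ≡ a → x ≢ u → π y ≡ b → y ≢ u →
               Walk (R ⇂ Lifted P) x y
    liftWalk ε πx x≢u πy y≢u with refl ← same (trans πx (sym πy)) x≢u y≢u = ε
    liftWalk (e ◅ w) πx x≢u πy y≢u with liftEdge e πx x≢u
    ... | z , πz , z≢u , p = p ◅◅ liftWalk w πz z≢u πy y≢u

    Str-Lifted : ∀ {P} → Str R′ P → Str R (Lifted P)
    Str-Lifted {P} s {x} {y} Lx@(Px , _) Ly@(Py , iny) = start (x ≟ u) (y ≟ u)
      where
      to : ∀ {x} → P (π x) → x ≢ u → Dec (y ≡ u) → Walk (R ⇂ Lifted P) x y
      to Px x≢u (no y≢u) = liftWalk (s Px Py) refl x≢u refl y≢u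
      to Px x≢u (yes refl) with iny refl
      ... | z , zu , z≢u , Pz = liftWalk (s Px Pz) refl x≢u refl z≢u ◅◅ within (lifted {P} Pz z≢u) Ly zu ◅ ε
      start : Dec (x ≡ u) → Dec (y ≡ u) → Walk (R ⇂ Lifted P) x y
      start (no x≢u) d = to Px x≢u d
      start (yes refl) d = within Lx (lifted {P} Pv (u≢v ∘ sym)) uv ◅ to Pv (u≢v ∘ sym) d
        where Pv = subst P πuv Px

    meet : ∀ {P Q} → (∃ λ b → P b × Q b) → ∃ λ x → Lifted P x × Lifted Q x
    meet {P} {Q} (b , p , q) with representative b
    ... | x , refl , x≢u = x , lifted {P} p x≢u , lifted {Q} q x≢u

    liftObs : Obs R′ → Obs R
    liftObs o = record
      { strA = Str-Lifted strA ; strB = Str-Lifted strB ; strC = Str-Lifted strC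
      ; AB = meet AB ; BC = meet BC ; CA = meet CA
      ; none = λ (a , _) (b , _) (c , _) → none a b c }
      where open Obs o

  ContractsTo-Obs : ∀ {m} {D : Digraph n} {D′ : Digraph m} → ContractsTo D D′ → Obs (Edge D′) → Obs (Edge D)
  ContractsTo-Obs {m} {D} {D′} c = lift (proj₂ contractible)
    where
    open ContractsTo c
    surj : ∀ b → ∃ λ x → π x ≡ b
    surj b = let x , p = surjective b in x , p refl
    u≢v : u ≢ v
    u≢v refl = Digraph.loopless D (proj₁ contractible)
    πuv : π u ≡ π v
    πuv = Equivalence.from identifies (inj₂ (inj₁ (refl , refl)))
    edges⁻ : ∀ {a b} → Edge D′ a b → a ≢ b × ∃₂ λ x y → π x ≡ a × π y ≡ b × Edge D x y
    edges⁻ = Equivalence.to edge⇔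
    lift : _ → Obs (Edge D′) → Obs (Edge D)
    lift (inj₁ only) o =
      Lift.liftObs (proj₁ contractible) u≢v only π surj (Equivalence.to identifies) πuv edges⁻ o
    -- If `u` is the only in-neighbour of `v`, the same argument applies to the reversed digraph
    -- with `u` and `v` exchanged.
    lift (inj₂ only) o = Obs-flip
      (Lift.liftObs (proj₁ contractible) (u≢v ∘ sym) only π surj (map₂ swap ∘ Equivalence.to identifies) (sym πuv)
        (λ e → let a≢b , x , y , p , q , e′ = edges⁻ e in a≢b ∘ sym , y , x , q , p , e′) (Obs-flip o))

ButterflyMinor-Obs : ∀ {m n} {D′ : Digraph m} {D : Digraph n} → ButterflyMinor D′ D → Obs (Edge D′) → Obs (Edge D)
ButterflyMinor-Obs {D′ = D′} {D} (k , H , sub , steps) o = Subgraph-Obs {H = H} {D = D} sub (go steps)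
  where
  go : ∀ {S} → Star ContractionStep S (_ , D′) → Obs (Edge (proj₂ S))
  go ε = o
  go (c ◅ cs) = ContractsTo-Obs c (go cs)

-- Obstructions in bicycles and `A₄`

bicycle-edge⁺ : ∀ {ℓ} (3≤ℓ : 3 ≤ ℓ) {i j : Fin ℓ} → Next i j ⊎ Next j i → Edge (bicycle ℓ 3≤ℓ) i j
bicycle-edge⁺ 3≤ℓ {i} {j} = fromWitness {a? = next? i j ⊎-dec next? j i}

bicycle-edge⁻ : ∀ {ℓ} (3≤ℓ : 3 ≤ ℓ) {i j : Fin ℓ} → Edge (bicycle ℓ 3≤ℓ) i j → Next i j ⊎ Next j i
bicycle-edge⁻ 3≤ℓ {i} {j} = toWitness {a? = next? i j ⊎-dec next? j i}

-- The two digons at vertex 0 share only that vertex, and the third set, the path of digons on all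
-- other vertices, misses it.
bicycle-Obs : ∀ ℓ (3≤ℓ : 3 ≤ ℓ) → Obs (Edge (bicycle ℓ 3≤ℓ))
bicycle-Obs ℓ@(suc (suc (suc k))) 3≤ℓ@(s≤s (s≤s (s≤s z≤n))) = record
  { A = λ z → z ∈ vertices a ⊎ z ∈ vertices a⁻
  ; C = λ z → z ∈ vertices c ⊎ z ∈ vertices c⁻
  ; strA = Str-closed a a⁻
  ; strB = Str-hub (suc zero) λ {x} p → let w = fromOne x p in Star.reverse symB w , w
  ; strC = Str-closed c c⁻
  ; AB = suc zero , inj₂ (here refl) , s≤s z≤n
  ; BC = fromℕ (suc (suc k)) , s≤s z≤n , inj₂ (here refl)
  ; CA = zero , inj₁ (here refl) , inj₁ (here refl)
  ; none = λ {x} a b c → noCommon x a b c }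
  where
  R = Edge (bicycle ℓ 3≤ℓ)
  symR : ∀ i j → R i j → R j i
  symR i j e = bicycle-edge⁺ 3≤ℓ (swap (bicycle-edge⁻ 3≤ℓ {i} {j} e))
  e₁ : R zero (suc zero)
  e₁ = bicycle-edge⁺ 3≤ℓ {zero} {suc zero} (inj₁ (inj₁ refl))
  e₂ : R zero (fromℕ (suc (suc k)))
  e₂ = bicycle-edge⁺ 3≤ℓ (inj₂ (inj₂ (cong suc (toℕ-fromℕ (suc (suc k))) , refl)))
  a : Walk R zero (suc zero)
  a = e₁ ◅ ε
  a⁻ : Walk R (suc zero) zero
  a⁻ = symR zero (suc zero) e₁ ◅ ε
  c : Walk R zero (fromℕ (suc (suc k)))
  c = e₂ ◅ ε
  c⁻ : Walk R (fromℕ (suc (suc k))) zero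
  c⁻ = symR zero (fromℕ (suc (suc k))) e₂ ◅ ε
  B : Pred (Fin ℓ) 0ℓ
  B z = 1 ≤ toℕ z
  symB : ∀ {i j} → (R ⇂ B) i j → (R ⇂ B) j i
  symB {i} {j} (within p q e) = within q p (symR i j e)
  go : ∀ t x → toℕ x ≡ suc t → Walk (R ⇂ B) (suc zero) x
  go zero x eq with refl ← toℕ-injective {i = x} {j = suc zero} eq = ε
  go (suc t) x eq = go t y y≡ ◅◅ within (subst (1 ≤_) (sym y≡) (s≤s z≤n)) (subst (1 ≤_) (sym eq) (s≤s z≤n))
                                    (bicycle-edge⁺ 3≤ℓ (inj₁ (inj₁ (trans eq (cong suc (sym y≡)))))) ◅ ε
    where
    t< : suc t < ℓ
    t< = ℕ.<-trans (ℕ.n<1+n (suc t)) (subst (_< ℓ) eq (toℕ<n x))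
    y = fromℕ< t<
    y≡ : toℕ y ≡ suc t
    y≡ = toℕ-fromℕ< t<
  fromOne : ∀ x → B x → Walk (R ⇂ B) (suc zero) x
  fromOne (suc x) _ = go (toℕ x) (suc x) refl
  noCommon : ∀ x → x ∈ vertices a ⊎ x ∈ vertices a⁻ → B x → x ∈ vertices c ⊎ x ∈ vertices c⁻ → ⊥
  noCommon x pa b pc with digon-vertices pa | digon-vertices pc
  ... | inj₁ refl | _ with () ← b
  ... | _ | inj₁ refl with () ← b
  ... | inj₂ refl | inj₂ ()

-- The sets are the two triangles on the digon of `0F` and `2F`, together with the digon of `1F` and
-- `3F`, whose ends lie on different triangles.
A₄-Obs : Obs (Edge A₄)
A₄-Obs = record
  { strA = Str-closed a a⁻ ; strB = Str-closed b b⁻ ; strC = Str-closed c c⁻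
  ; AB = 0F , inj₁ (here refl) , inj₂ (here refl)
  ; BC = 3F , inj₁ (there (here refl)) , inj₂ (here refl)
  ; CA = 1F , inj₁ (here refl) , inj₁ (there (here refl))
  ; none = λ {x} p q r → disjoint x (p , q , r) }
  where
  a : Walk (Edge A₄) 0F 2F
  a = _◅_ {j = 1F} _ (_ ◅ ε)
  a⁻ : Walk (Edge A₄) 2F 0F
  a⁻ = _ ◅ ε
  b : Walk (Edge A₄) 2F 0F
  b = _◅_ {j = 3F} _ (_ ◅ ε)
  b⁻ : Walk (Edge A₄) 0F 2F
  b⁻ = _ ◅ ε
  c : Walk (Edge A₄) 1F 3F
  c = _ ◅ ε
  c⁻ : Walk (Edge A₄) 3F 1F
  c⁻ = _ ◅ ε
  disjoint : ∀ x → ¬ ((x ∈ vertices a ⊎ x ∈ vertices a⁻) × (x ∈ vertices b ⊎ x ∈ vertices b⁻) × (x ∈ vertices c ⊎ x ∈ vertices c⁻))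
  disjoint = toWitness {a? = all? λ x → ¬? (((x ∈? vertices a) ⊎-dec (x ∈? vertices a⁻))
    ×-dec (((x ∈? vertices b) ⊎-dec (x ∈? vertices b⁻)) ×-dec ((x ∈? vertices c) ⊎-dec (x ∈? vertices c⁻))))} _

-- Butterfly minors on a fixed vertex set

Decided : ∀ {n} (R : Rel (Fin n) 0ℓ) → Decidable R → (∀ {x} → ¬ R x x) → .{{NonZero n}} → Digraph n
Decided R R? irr = record { adj = λ u v → ⌊ R? u v ⌋ ; loopless = λ {v} e → irr (toWitness {a? = R? v v} e) }

ContractsTo-Subgraph : ∀ {n m k} {D : Digraph n} {D′ : Digraph m} {H : Digraph k} → ContractsTo D D′ → Subgraph H D′ →
  Subgraph H D ⊎ (∃ λ (H′ : Digraph (suc k)) → Subgraph H′ D × ContractsTo H′ H)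
ContractsTo-Subgraph {n} {m} {k} {D} {D′} {H} c (f , f-inj , f-edge) = cases (any? λ i → f i ≟ π u)
  where
  open ContractsTo c
  u≢v : u ≢ v
  u≢v refl = Digraph.loopless D (proj₁ contractible)
  πuv : π u ≡ π v
  πuv = Equivalence.from identifies (inj₂ (inj₁ (refl , refl)))
  representative : ∀ b → ∃ λ x → π x ≡ b × x ≢ u
  representative b with surjective b
  ... | x , p with x ≟ u
  ...   | yes refl = v , trans (sym πuv) (p refl) , u≢v ∘ sym
  ...   | no x≢u = x , p refl , x≢u
  σ : Fin m → Fin n
  σ b = proj₁ (representative b)
  πσ : ∀ b → π (σ b) ≡ b
  πσ b = proj₁ (proj₂ (representative b))
  σ≢u : ∀ b → σ b ≢ u
  σ≢u b = proj₂ (proj₂ (representative b))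
  σ-inj : ∀ {a b} → σ a ≡ σ b → a ≡ b
  σ-inj {a} {b} p = trans (sym (πσ a)) (trans (cong π p) (πσ b))
  σ-unique : ∀ {x b} → π x ≡ b → x ≢ u → x ≡ σ b
  σ-unique {x} {b} p x≢u with Equivalence.to (identifies {x} {σ b}) (trans p (sym (πσ b)))
  ... | inj₁ q = q
  ... | inj₂ (inj₁ (q , _)) = contradiction q x≢u
  ... | inj₂ (inj₂ (_ , q)) = contradiction q (σ≢u b)
  Goal = Subgraph H D ⊎ (∃ λ (H′ : Digraph (suc k)) → Subgraph H′ D × ContractsTo H′ H)
  cases : Dec (∃ λ i → f i ≡ π u) → Goal
  cases (no missed) = inj₁ (σ ∘ f , f-inj ∘ σ-inj , λ e → edge (Equivalence.to edge⇔ (f-edge e)))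
    where
    edge : ∀ {i j} → f i ≢ f j × (∃₂ λ x y → π x ≡ f i × π y ≡ f j × Edge D x y) → Edge D (σ (f i)) (σ (f j))
    edge {i} {j} (_ , x , y , p , q , e) = subst₂ (Edge D)
      (σ-unique p λ { refl → missed (i , sym p) }) (σ-unique q λ { refl → missed (j , sym q) }) e
  cases (yes (i₀ , fi₀)) = inj₂ (H′ , (g , g-inj , λ {i} {j} → proj₁ ∘ edge⁻ {i} {j}) , contracts)
    where
    g : Fin (suc k) → Fin n
    g zero    = u
    g (suc i) = σ (f i)
    κ : Fin (suc k) → Fin k
    κ zero    = i₀
    κ (suc i) = i
    g-inj : Injective _≡_ _≡_ g
    g-inj {zero}  {zero}  _ = refl
    g-inj {zero}  {suc j} p = contradiction (sym p) (σ≢u _)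
    g-inj {suc i} {zero}  p = contradiction p (σ≢u _)
    g-inj {suc i} {suc j} p = cong suc (f-inj (σ-inj p))
    gv : g (suc i₀) ≡ v
    gv = sym (σ-unique (trans (sym πuv) (sym fi₀)) (u≢v ∘ sym))
    R : Rel (Fin (suc k)) 0ℓ
    R p q = Edge D (g p) (g q) × ((p ≡ zero × q ≡ suc i₀) ⊎ (p ≡ suc i₀ × q ≡ zero) ⊎ Edge H (κ p) (κ q))
    R? : Decidable R
    R? p q = T? _ ×-dec (((p ≟ zero) ×-dec (q ≟ suc i₀)) ⊎-dec (((p ≟ suc i₀) ×-dec (q ≟ zero)) ⊎-dec T? _))
    H′ : Digraph (suc k)
    H′ = Decided R R? λ (e , _) → Digraph.loopless D e
    edge⁻ : ∀ {p q} → Edge H′ p q → R p q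
    edge⁻ {p} {q} = toWitness {a? = R? p q}
    edge⁺ : ∀ {p q} → R p q → Edge H′ p q
    edge⁺ {p} {q} = fromWitness {a? = R? p q}
    preimage : ∀ {x i} → π x ≡ f i → ∃ λ p → g p ≡ x × κ p ≡ i
    preimage {x} {i} p with x ≟ u
    ... | yes refl = zero , refl , f-inj (trans fi₀ p)
    ... | no x≢u = suc i , sym (σ-unique p x≢u) , refl
    only : (∀ {w} → Edge D u w → w ≡ v) ⊎ (∀ {w} → Edge D w v → w ≡ u) →
           (∀ {w} → Edge H′ zero w → w ≡ suc i₀) ⊎ (∀ {w} → Edge H′ w (suc i₀) → w ≡ zero)
    only (inj₁ h) = inj₁ λ {w} e → g-inj (trans (h (proj₁ (edge⁻ {zero} {w} e))) (sym gv))
    only (inj₂ h) = inj₂ λ {w} e → g-inj (h (subst (Edge D (g w)) gv (proj₁ (edge⁻ {w} {suc i₀} e))))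
    κ-fibres : ∀ {x y} → κ x ≡ κ y → x ≡ y ⊎ (x ≡ zero × y ≡ suc i₀) ⊎ (x ≡ suc i₀ × y ≡ zero)
    κ-fibres {zero}  {zero}  _    = inj₁ refl
    κ-fibres {zero}  {suc j} refl = inj₂ (inj₁ (refl , refl))
    κ-fibres {suc i} {zero}  refl = inj₂ (inj₂ (refl , refl))
    κ-fibres {suc i} {suc j} refl = inj₁ refl
    contracts : ContractsTo H′ H
    contracts = record
      { u = zero ; v = suc i₀
      ; contractible = edge⁺ {zero} {suc i₀} (subst (Edge D u) (sym gv) (proj₁ contractible) , inj₁ (refl , refl)) ,
                       only (proj₂ contractible)
      ; π = κ
      ; surjective = λ b → suc b , λ { refl → refl }
      ; identifies = mk⇔ κ-fibres λ { (inj₁ refl) → refl ; (inj₂ (inj₁ (refl , refl))) → refl ; (inj₂ (inj₂ (refl , refl))) → refl }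
      ; edge⇔ = mk⇔ to from }
      where
      to : ∀ {a b} → Edge H a b → a ≢ b × ∃₂ λ x y → κ x ≡ a × κ y ≡ b × Edge H′ x y
      to {a} {b} e with Equivalence.to edge⇔ (f-edge e)
      ... | fa≢fb , x , y , p , q , e′ with preimage p | preimage q
      ...   | x′ , refl , refl | y′ , refl , refl =
        (fa≢fb ∘ cong f) , x′ , y′ , refl , refl , edge⁺ {x′} {y′} (e′ , inj₂ (inj₂ e))
      from : ∀ {a b} → a ≢ b × (∃₂ λ x y → κ x ≡ a × κ y ≡ b × Edge H′ x y) → Edge H a b
      from (a≢b , x , y , refl , refl , e) with edge⁻ {x} {y} e
      ... | _ , inj₁ (refl , refl) = contradiction refl a≢b
      ... | _ , inj₂ (inj₁ (refl , refl)) = contradiction refl a≢b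
      ... | _ , inj₂ (inj₂ h) = h

-- Ensures that every vertex of an embedded copy of `B` lies on an edge, so that it is not one of
-- the isolated vertices left behind by contractions.
HasOutEdges : ∀ {b} → Digraph b → Set
HasOutEdges B = ∀ i → ∃ λ j → Edge B i j

module _ {b : ℕ} (B : Digraph b) where

  -- Deletions and contractions alternate here, whereas `ButterflyMinor` asks for all deletions
  -- first; they are moved to the front afterwards.
  data Yields : ∀ {n} → Digraph n → Set where
    contains : ∀ {n} {D : Digraph n} → Subgraph B D → Yields D
    contract : ∀ {n m} {D D⁻ : Digraph n} {D′ : Digraph m} → Subgraph D⁻ D → ContractsTo D⁻ D′ → Yields D′ → Yields D

  Subgraph-trans : ∀ {m n k} {D₁ : Digraph m} {D₂ : Digraph n} {D₃ : Digraph k} →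
                   Subgraph D₁ D₂ → Subgraph D₂ D₃ → Subgraph D₁ D₃
  Subgraph-trans (f , f-inj , f-edge) (g , g-inj , g-edge) = g ∘ f , f-inj ∘ g-inj , g-edge ∘ f-edge

  Yields⇒ButterflyMinor : ∀ {n} {D : Digraph n} → Yields D → ButterflyMinor B D
  Yields⇒ButterflyMinor (contains s) = b , B , s , ε
  Yields⇒ButterflyMinor {D = D} (contract {D⁻ = D⁻} {D′ = D′} s c y) with Yields⇒ButterflyMinor y
  ... | k , H , H⊆D′ , steps with ContractsTo-Subgraph {D = D⁻} {D′ = D′} {H = H} c H⊆D′
  ...   | inj₁ H⊆ = k , H , Subgraph-trans {D₁ = H} {D₂ = D⁻} {D₃ = D} H⊆ s , steps
  ...   | inj₂ (H′ , H′⊆ , c′) = suc k , H′ , Subgraph-trans {D₁ = H′} {D₂ = D⁻} {D₃ = D} H′⊆ s , c′ ◅ steps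

module _ {n : ℕ} where

  private V = Fin n

  -- Contraction with the vertex set kept fixed: w is absorbed by y and
  -- stays behind as an isolated vertex.

  record Absorbs (R R′ : Rel V 0ℓ) : Set₁ where
    field
      {w y} : V
      w≢y   : w ≢ y
      R⁻    : Rel V 0ℓ
      R⁻?   : Decidable R⁻
      R⁻⊆R  : R⁻ ⇒ R
      only  : (R⁻ w y × (∀ {t} → R⁻ w t → t ≡ y)) ⊎ (R⁻ y w × (∀ {t} → R⁻ t w → t ≡ y))
      edge  : ∀ {a b} → R′ a b → a ≢ w × b ≢ w × a ≢ b × (R⁻ a b ⊎ (b ≡ y × R⁻ a w) ⊎ (a ≡ y × R⁻ w b))

  data _≼_ : Rel V 0ℓ → Rel V 0ℓ → Set₁ where
    delete : ∀ {R R′} → R′ ⇒ R → R′ ≼ R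
    absorb : ∀ {R R′} → Absorbs R R′ → R′ ≼ R
    ≼-trans : ∀ {R R′ R″} → R″ ≼ R′ → R′ ≼ R → R″ ≼ R

  ≼-flip : ∀ {R R′} → R′ ≼ R → flip R′ ≼ flip R
  ≼-flip (delete f) = delete f
  ≼-flip (absorb a) = absorb record
    { w≢y = w≢y ; R⁻ = flip R⁻ ; R⁻? = flip R⁻? ; R⁻⊆R = R⁻⊆R ; only = swap only
    ; edge = λ e → let a≢w , b≢w , a≢b , h = edge e in b≢w , a≢w , a≢b ∘ sym , map₂ swap h }
    where
    open Absorbs a
  ≼-flip (≼-trans p q) = ≼-trans (≼-flip p) (≼-flip q)

  -- R is a subdigraph of D up to isolated vertices.

  record Represents {m : ℕ} (D : Digraph m) (R : Rel V 0ℓ) : Set where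
    field
      f     : Fin m → V
      f-inj : ∀ {i j} → f i ≡ f j → i ≡ j
      edge  : ∀ {a b} → R a b → ∃₂ λ i j → f i ≡ a × f j ≡ b × Edge D i j

  module _ {b : ℕ} (B : Digraph b) where

    -- An absorption becomes a genuine contraction by punching the preimage of `w` out of the vertex
    -- set. The preimage exists because `w` is an end of the absorbed edge.
    quotient : ∀ {m} {D : Digraph m} {R R′} → Represents D R → Absorbs R R′ →
               (∀ {m′} {D′ : Digraph m′} → Represents D′ R′ → Yields B D′) → Yields B D
    quotient {zero} {D} rep _ _ with () ← fin D
    quotient {suc m} {D} {R} {R′} rep abs k = go
      where
      open Absorbs abs
      open Represents rep renaming (edge to repEdge)
      go : Yields B D
      go = build (ends only)
        where
        ends : (R⁻ w y × _) ⊎ (R⁻ y w × _) → ∃₂ λ i j → f i ≡ w × f j ≡ y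
        ends (inj₁ (e , _)) = let i , j , p , q , _ = repEdge (R⁻⊆R e) in i , j , p , q
        ends (inj₂ (e , _)) = let i , j , p , q , _ = repEdge (R⁻⊆R e) in j , i , q , p
        build : (∃₂ λ i j → f i ≡ w × f j ≡ y) → Yields B D
        build (iw , iy , fw , fy) = contract {D = D} {D⁻ = D⁻} {D′ = D′}
            (id , id , λ {p} {q} e → proj₁ (toWitness {a? = S? p q} e)) (contracts only) (k rep′)
          where
          iw≢iy : iw ≢ iy
          iw≢iy refl = w≢y (trans (sym fw) fy)
          S : Rel (Fin (suc m)) 0ℓ
          S p q = Edge D p q × R⁻ (f p) (f q)
          S? : Decidable S
          S? p q = T? _ ×-dec R⁻? (f p) (f q)
          D⁻ : Digraph (suc m)
          D⁻ = Decided S S? λ (e , _) → Digraph.loopless D e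
          π : Fin (suc m) → Fin m
          π p with iw ≟ p
          ... | yes _ = punchOut iw≢iy
          ... | no iw≢p = punchOut iw≢p
          π-w : π iw ≡ punchOut iw≢iy
          π-w with iw ≟ iw
          ... | yes _ = refl
          ... | no ¬p = contradiction refl ¬p
          π-≢ : ∀ {p} (iw≢p : iw ≢ p) → π p ≡ punchOut iw≢p
          π-≢ {p} iw≢p with iw ≟ p
          ... | yes q = contradiction q iw≢p
          ... | no _ = punchOut-cong iw refl
          S′ : Rel (Fin m) 0ℓ
          S′ a c = a ≢ c × ∃₂ λ p q → π p ≡ a × π q ≡ c × Edge D⁻ p q
          S′? : Decidable S′
          S′? a c = ¬? (a ≟ c) ×-dec any? λ p → any? λ q → (π p ≟ a) ×-dec ((π q ≟ c) ×-dec T? _)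
          D′ : Digraph m
          D′ = Decided S′ S′? (λ (a≢a , _) → a≢a refl) {{fin-nonZero (punchOut iw≢iy)}}
          fibres : ∀ {p q} → π p ≡ π q → p ≡ q ⊎ (p ≡ iw × q ≡ iy) ⊎ (p ≡ iy × q ≡ iw)
          fibres {p} {q} e with iw ≟ p | iw ≟ q
          ... | yes refl | yes refl = inj₁ refl
          ... | yes refl | no n = inj₂ (inj₁ (refl , sym (punchOut-injective iw≢iy n e)))
          ... | no n | yes refl = inj₂ (inj₂ (punchOut-injective n iw≢iy e , refl))
          ... | no n | no n′ = inj₁ (punchOut-injective n n′ e)
          π-wy : π iw ≡ π iy
          π-wy = trans π-w (sym (π-≢ iw≢iy))
          surj : Surjective _≡_ _≡_ π
          surj a = punchIn iw a , λ { refl → trans (π-≢ (punchInᵢ≢i iw a ∘ sym)) (trans (punchOut-cong iw refl) (punchOut-punchIn iw)) }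
          S-edge : ∀ {p q} → S p q → Edge D⁻ p q
          S-edge {p} {q} = fromWitness {a? = S? p q}
          S-edge⁻ : ∀ {p q} → Edge D⁻ p q → S p q
          S-edge⁻ {p} {q} = toWitness {a? = S? p q}
          lift : ∀ {a c i j} → f i ≡ a → f j ≡ c → R⁻ a c → S i j
          lift refl refl r with repEdge (R⁻⊆R r)
          ... | i′ , j′ , p , q , e with f-inj p | f-inj q
          ...   | refl | refl = e , r
          contracts : (R⁻ w y × (∀ {t} → R⁻ w t → t ≡ y)) ⊎ (R⁻ y w × (∀ {t} → R⁻ t w → t ≡ y)) → ContractsTo D⁻ D′
          contracts (inj₁ (e , h)) = record
            { u = iw ; v = iy
            ; contractible = S-edge {iw} {iy} (lift fw fy e) ,
                inj₁ λ {t} s → f-inj (trans (h (subst (λ a → R⁻ a (f t)) fw (proj₂ (S-edge⁻ {iw} {t} s)))) (sym fy))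
            ; π = π ; surjective = surj
            ; identifies = mk⇔ fibres λ { (inj₁ refl) → refl ; (inj₂ (inj₁ (refl , refl))) → π-wy ; (inj₂ (inj₂ (refl , refl))) → sym π-wy }
            ; edge⇔ = λ {a} {c} → mk⇔ (toWitness {a? = S′? a c}) (fromWitness {a? = S′? a c}) }
          contracts (inj₂ (e , h)) = record
            { u = iy ; v = iw
            ; contractible = S-edge {iy} {iw} (lift fy fw e) ,
                inj₂ λ {t} s → f-inj (trans (h (subst (R⁻ (f t)) fw (proj₂ (S-edge⁻ {t} {iw} s)))) (sym fy))
            ; π = π ; surjective = surj
            ; identifies = mk⇔ (λ p → map₂ swap (fibres p)) λ { (inj₁ refl) → refl ; (inj₂ (inj₁ (refl , refl))) → sym π-wy ; (inj₂ (inj₂ (refl , refl))) → π-wy }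
            ; edge⇔ = λ {a} {c} → mk⇔ (toWitness {a? = S′? a c}) (fromWitness {a? = S′? a c}) }
          f′ : Fin m → V
          f′ = f ∘ punchIn iw
          rep′ : Represents D′ R′
          rep′ = record
            { f = f′ ; f-inj = λ p → punchIn-injective iw _ _ (f-inj p)
            ; edge = λ r → let a≢w , c≢w , a≢c , h = edge r in find′ a≢w c≢w a≢c (locate h) }
            where
            locate : ∀ {a c} → R⁻ a c ⊎ (c ≡ y × R⁻ a w) ⊎ (a ≡ y × R⁻ w c) →
                     ∃₂ λ i j → (f i ≡ a × f j ≡ c) × ∃₂ λ p q → π p ≡ π i × π q ≡ π j × S p q
            locate (inj₁ r) with i , j , p , q , _ ← repEdge (R⁻⊆R r) =
              i , j , (p , q) , i , j , refl , refl , lift p q r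
            locate (inj₂ (inj₁ (refl , r))) with i , j , p , q , _ ← repEdge (R⁻⊆R r) =
              i , iy , (p , fy) , i , iw , refl , π-wy , lift p fw r
            locate (inj₂ (inj₂ (refl , r))) with i , j , p , q , _ ← repEdge (R⁻⊆R r) =
              iy , j , (fy , q) , iw , j , π-wy , refl , lift fw q r
            find′ : ∀ {a c} → a ≢ w → c ≢ w → a ≢ c →
                    (∃₂ λ i j → (f i ≡ a × f j ≡ c) × ∃₂ λ p q → π p ≡ π i × π q ≡ π j × S p q) →
                    ∃₂ λ i j → f′ i ≡ a × f′ j ≡ c × Edge D′ i j
            find′ a≢w c≢w a≢c (i , j , (refl , refl) , p , q , πp , πq , s) =
              punchOut iw≢i , punchOut iw≢j , cong f (punchIn-punchOut iw≢i) , cong f (punchIn-punchOut iw≢j) ,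
              fromWitness {a? = S′? (punchOut iw≢i) (punchOut iw≢j)}
                ((λ e → a≢c (cong f (punchOut-injective iw≢i iw≢j e))) ,
                 p , q , trans πp (π-≢ iw≢i) , trans πq (π-≢ iw≢j) , S-edge {p} {q} s)
              where
              iw≢i : iw ≢ i
              iw≢i refl = a≢w fw
              iw≢j : iw ≢ j
              iw≢j refl = c≢w fw

    ≼-Yields : ∀ {R R′} → R′ ≼ R → ∀ {m} {D : Digraph m} → Represents D R →
               (∀ {m′} {D′ : Digraph m′} → Represents D′ R′ → Yields B D′) → Yields B D
    ≼-Yields (delete g) rep k = k record { f = f ; f-inj = f-inj ; edge = edge ∘ g }
      where open Represents rep
    ≼-Yields (absorb a) rep k = quotient rep a k
    ≼-Yields (≼-trans p q) rep k = ≼-Yields q rep λ rep′ → ≼-Yields p rep′ k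

  Embeds : ∀ {b} → Digraph b → Rel V 0ℓ → Set
  Embeds {b} B R = ∃ λ (g : Fin b → V) → (∀ {i j} → g i ≡ g j → i ≡ j) × (∀ {i j} → Edge B i j → R (g i) (g j))

  ≼-ButterflyMinor : ∀ {b} (B : Digraph b) → HasOutEdges B → (D : Digraph n) → ∀ {R} → R ≼ Edge D → Embeds B R → ButterflyMinor B D
  ≼-ButterflyMinor {b} B out D {R} R≼D (g , g-inj , g-edge) =
    Yields⇒ButterflyMinor B {D = D} (≼-Yields B R≼D {D = D} record { f = id ; f-inj = id ; edge = λ e → _ , _ , refl , refl , e } final)
    where
    final : ∀ {m′} {D′ : Digraph m′} → Represents D′ R → Yields B D′
    final {m′} {D′} rep = contains (h , (λ {i} {j} p → g-inj (trans (sym (fh i)) (trans (cong f p) (fh j)))) , h-edge)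
      where
      open Represents rep
      pre : ∀ i → ∃ λ p → f p ≡ g i
      pre i = let j , e = out i ; p , _ , q , _ = edge (g-edge e) in p , q
      h : Fin b → Fin m′
      h i = proj₁ (pre i)
      fh : ∀ i → f (h i) ≡ g i
      fh i = proj₂ (pre i)
      h-edge : ∀ {i j} → Edge B i j → Edge D′ (h i) (h j)
      h-edge {i} {j} e with edge (g-edge e)
      ... | p , q , fp , fq , e′ = subst₂ (Edge D′) (f-inj (trans fp (sym (fh i)))) (f-inj (trans fq (sym (fh j)))) e′

-- Two cycles meeting in one vertex

module _ {n : ℕ} where

  private V = Fin n

  -- The relation of consecutive vertices. It is functional on a walk without repetitions, so a
  -- cycle uses exactly one outgoing edge at each of its vertices.
  data Follows {S : Rel V 0ℓ} : ∀ {x y} → Walk S x y → Rel V 0ℓ where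
    here  : ∀ {x y z} {e : S x y} {w : Walk S y z} → Follows (e ◅ w) x y
    there : ∀ {x y z a b} {e : S x y} {w : Walk S y z} → Follows w a b → Follows (e ◅ w) a b

  module _ {S : Rel V 0ℓ} where

    Follows⇒ : ∀ {x y} {w : Walk S x y} → Follows w ⇒ S
    Follows⇒ {w = e ◅ _} here = e
    Follows⇒ (there f) = Follows⇒ f

    Follows-source : ∀ {x y a b} {w : Walk S x y} → Follows w a b → a ∈ vertices w
    Follows-source here = here refl
    Follows-source (there f) = there (Follows-source f)

    Follows-target : ∀ {x y a b} {w : Walk S x y} → Follows w a b → b ∈ vertices w
    Follows-target {w = _ ◅ w} here = there (first∈ w)
    Follows-target (there f) = there (Follows-target f)

    Follows-last : ∀ {x y b} {w : Walk S x y} → Unique (vertices w) → ¬ Follows w y b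
    Follows-last {w = _ ◅ w} (x∉ ∷ _) here = All¬⇒¬Any x∉ (last∈ w)
    Follows-last (_ ∷ u) (there f) = Follows-last u f

    Follows-functional : ∀ {x y a b c} {w : Walk S x y} → Unique (vertices w) → Follows w a b → Follows w a c → b ≡ c
    Follows-functional _ here here = refl
    Follows-functional (x∉ ∷ _) here (there f) = contradiction (Follows-source f) (All¬⇒¬Any x∉)
    Follows-functional (x∉ ∷ _) (there f) here = contradiction (Follows-source f) (All¬⇒¬Any x∉)
    Follows-functional (_ ∷ u) (there f) (there g) = Follows-functional u f g

    next : ∀ {x y a} (w : Walk S x y) → a ∈ vertices w → a ≡ y ⊎ ∃ (Follows w a)
    next ε (here refl) = inj₁ refl
    next (_ ◅ _) (here refl) = inj₂ (_ , here)
    next (_ ◅ w) (there i) with next w i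
    ... | inj₁ p = inj₁ p
    ... | inj₂ (b , f) = inj₂ (b , there f)

    retrace : ∀ {x y} (w : Walk S x y) → Walk (Follows w) x y
    retrace ε = ε
    retrace (_ ◅ w) = here ◅ Star.map there (retrace w)

    vertices-retrace : ∀ {x y} (w : Walk S x y) → vertices (retrace w) ≡ vertices w
    vertices-retrace ε = refl
    vertices-retrace (e ◅ w) = cong (_ ∷_) (trans (vertices-map there (retrace w)) (vertices-retrace w))

    module CycleSuccessor (C : Cycle S) where

      open Cycle C hiding (cycleVertices)

      Succ : Rel V 0ℓ
      Succ a b = Follows walk a b ⊎ (a ≡ last × b ≡ first)

      Succ⇒ : Succ ⇒ S
      Succ⇒ (inj₁ f) = Follows⇒ f
      Succ⇒ (inj₂ (refl , refl)) = closing

      Succ-functional : ∀ {a b c} → Succ a b → Succ a c → b ≡ c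
      Succ-functional (inj₁ f) (inj₁ g) = Follows-functional distinct f g
      Succ-functional (inj₁ f) (inj₂ (refl , refl)) = contradiction f (Follows-last distinct)
      Succ-functional (inj₂ (refl , refl)) (inj₁ g) = contradiction g (Follows-last distinct)
      Succ-functional (inj₂ (_ , refl)) (inj₂ (_ , refl)) = refl

      successor : ∀ {a} → a ∈ cycleVertices C → ∃ (Succ a)
      successor i with next walk i
      ... | inj₁ p = first , inj₂ (p , refl)
      ... | inj₂ (b , f) = b , inj₁ f

      Succ-Str : Str Succ (_∈ cycleVertices C)
      Succ-Str = Str-hub first λ i →
        (walk⇂ (subst (_ ∈_) (sym (vertices-retrace walk)) i) ◅◅ (within (last∈ walk) (first∈ walk) (inj₂ (refl , refl)) ◅ ε))
        , Star.map (⇂-mono inj₁ id) (prefixWalk (retrace walk) inside (subst (_ ∈_) (sym (vertices-retrace walk)) i))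
        where
        inside : ∀ {v} → v ∈ vertices (retrace walk) → v ∈ cycleVertices C
        inside = subst (_ ∈_) (vertices-retrace walk)
        walk⇂ : ∀ {x} → x ∈ vertices (retrace walk) → Walk (Succ ⇂ (_∈ cycleVertices C)) x last
        walk⇂ i = Star.map (⇂-mono inj₁ id) (suffixWalk (retrace walk) inside i)

  Str-avoiding : ∀ {S S′ : Rel V 0ℓ} {P : Pred V 0ℓ} → (∀ {a b} → P a → S a b → S′ a b) → Str S P → Str S′ P
  Str-avoiding f s Px Py = Star.map (λ (within p q e) → within p q (f p e)) (s Px Py)

  module _ {R : Rel V 0ℓ} (v : V) where

    afterLast : ∀ {P x y} → Walk (R ⇂ P) x y → y ≢ v →
                (∃ λ z → R v z × P z × Walk (R ⇂ (λ u → P u × u ≢ v)) z y) ⊎ (x ≢ v × Walk (R ⇂ (λ u → P u × u ≢ v)) x y)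
    afterLast ε y≢v = inj₂ (y≢v , ε)
    afterLast {x = x} (within p q e ◅ w) y≢v with afterLast w y≢v
    ... | inj₁ r = inj₁ r
    ... | inj₂ (z≢v , w′) with x ≟ v
    ...   | yes refl = inj₁ (_ , e , q , w′)
    ...   | no x≢v = inj₂ (x≢v , within (p , x≢v) (q , z≢v) e ◅ w′)

    beforeFirst : ∀ {P x} → Walk (R ⇂ P) x v → x ≢ v → ∃ λ z → R z v × Walk (R ⇂ (λ u → P u × u ≢ v)) x z
    beforeFirst ε x≢v = contradiction refl x≢v
    beforeFirst {x = x} (_◅_ {j = y} (within p q e) w) x≢v with y ≟ v
    ... | yes refl = x , e , ε
    ... | no y≢v with beforeFirst w y≢v
    ...   | z , zv , w′ = z , zv , within (p , x≢v) (q , y≢v) e ◅ w′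

-- The field missing is the induction hypothesis: an obstruction that does
-- not use all edges lies in a smaller strong digraph.

record TwoConnected {n : ℕ} (R : Rel (Fin n) 0ℓ) (A : Pred (Fin n) 0ℓ) (Bad : Set₁) : Set₁ where
  field
    A?         : Decidable₁ A
    irr        : ∀ {x} → ¬ R x x
    R⊆A        : ∀ {x y} → R x y → A x × A y
    robust     : ∀ {y} → A y → Str R (λ x → A x × x ≢ y)
    third      : ∀ x y → ∃ λ z → A z × z ≢ x × z ≢ y
    missing    : ∀ {x z} → R x z → Obs (λ a b → R a b × ¬ (a ≡ x × b ≡ z)) → Bad
    bicycleBad : ∀ ℓ (3≤ℓ : 3 ≤ ℓ) → Embeds (bicycle ℓ 3≤ℓ) R → Bad
    A₄Bad      : Embeds A₄ R → Bad

module Ears {n : ℕ} {R : Rel (Fin n) 0ℓ} {A : Pred (Fin n) 0ℓ} {Bad : Set₁} (tc : TwoConnected R A Bad) where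

  open TwoConnected tc

  private V = Fin n

  Without : V → Pred V 0ℓ
  Without v x = A x × x ≢ v

  -- After the deletion of `z` a walk from `x` to a third vertex still exists, and its first step
  -- avoids `z`. If `z` is `x` or lies outside `A`, any out-neighbour of `x` will do.
  outNeighbour : ∀ {x} → A x → ∀ z → ∃ λ z′ → R x z′ × z′ ≢ z
  outNeighbour {x} Ax z with A? z ×-dec ¬? (z ≟ x)
  ... | yes (Az , z≢x) with third x z
  ...   | y , Ay , y≢x , y≢z with robust Az (Ax , z≢x ∘ sym) (Ay , y≢z)
  ...     | ε = contradiction refl y≢x
  ...     | within _ (_ , z′≢z) e ◅ _ = _ , e , z′≢z
  outNeighbour {x} Ax z | no ¬Az with third x x
  ... | y , Ay , y≢x , _ with third x y
  ...   | t , At , t≢x , t≢y with robust At (Ax , t≢x ∘ sym) (Ay , t≢y ∘ sym)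
  ...     | ε = contradiction refl y≢x
  ...     | within _ _ e ◅ _ = _ , e , λ { refl → ¬Az (proj₂ (R⊆A e) , λ { refl → irr e }) }

  Out : V → V → Rel V 0ℓ
  Out x z a b = R a b × (a ≡ x → b ≡ z)

  -- There is an out-neighbour of `x` other than `z`, and `Out x z` lacks the edge to it. So three
  -- strong sets that leave `x` along one edge only already settle the case.
  pinned : ∀ {x} → A x → ∀ z → Obs (Out x z) → Bad
  pinned {x} Ax z o with outNeighbour Ax z
  ... | z′ , e , z′≢z = missing e (Obs-mono (λ { (f , h) → f , λ { (refl , refl) → z′≢z (h refl) } }) o)

  Str-avoid : ∀ {P x z} → ¬ P x → Str R P → Str (Out x z) P
  Str-avoid {P} ¬Px = Str-avoiding λ Pa e → e , λ { refl → contradiction Pa ¬Px }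

  module Cyc (C : Cycle R) where
    open CycleSuccessor C public

    Succ-Out : ∀ {x z} → Succ x z → Str (Out x z) (_∈ cycleVertices C)
    Succ-Out f = Str-mono (λ g → Succ⇒ g , λ { refl → Succ-functional g f }) Succ-Str

    Str-cycle : Str R (_∈ cycleVertices C)
    Str-cycle = Str-mono Succ⇒ Succ-Str

  Apart : List V → List V → Set
  Apart l m = ∀ {z} → z ∈ l → z ∈ m → ⊥

  module _ (v : V) where

    R° : Rel V 0ℓ
    R° = R ⇂ Without v

    -- A cycle through v, given by the path that remains after deleting v.

    record Ear : Set where
      field
        {s t}    : V
        path     : Walk R° s t
        distinct : Unique (vertices path)
        enter    : R v s
        exit     : R t v

      inner : List V
      inner = vertices path

      s∈ : s ∈ inner
      s∈ = first∈ path

      t∈ : t ∈ inner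
      t∈ = last∈ path

      s≢v : s ≢ v
      s≢v p = irr (subst (R v) p enter)

      inside : ∀ {x} → x ∈ inner → Without v x
      inside = stays path (proj₂ (R⊆A enter) , s≢v)

      cycle : Cycle R
      cycle = record
        { walk = enter ◅ Star.map step path
        ; distinct = subst (λ l → Unique (v ∷ l)) (sym (vertices-map step path))
                       (¬Any⇒All¬ _ (λ i → proj₂ (inside i) refl) ∷ distinct)
        ; closing = exit }

      On : Pred V 0ℓ
      On = _∈ cycleVertices cycle

      v-on : On v
      v-on = here refl

      inner-on : ∀ {x} → x ∈ inner → On x
      inner-on {x} i = there (subst (x ∈_) (sym (vertices-map step path)) i)

      on⁻ : ∀ {x} → On x → x ≡ v ⊎ x ∈ inner
      on⁻ (here p) = inj₁ p
      on⁻ {x} (there i) = inj₂ (subst (x ∈_) (vertices-map step path) i)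

    -- Whitney's induction: two paths from v, meeting only in v, are led
    -- along a walk.

    data Lead : List V → V → Set where
      start  : ∀ {t} → R v t → Lead [] t
      extend : ∀ {l y t} → Lead l y → y ≢ v → R y t → Lead (y ∷ l) t

    firstArrival : ∀ {l t y} → Lead l t → y ∈ t ∷ l → ∃ λ l′ → Lead l′ y × y ∉ l′ × (∀ {z} → z ∈ l′ → z ∈ l)
    firstArrival (start e) (here refl) = [] , start e , (λ ()) , λ ()
    firstArrival {y = y} L@(extend {l} {y₀} M n e) i with y ∈? (y₀ ∷ l)
    ... | yes j = let l′ , L′ , y∉ , sub = firstArrival M j in l′ , L′ , y∉ , there ∘ sub
    firstArrival (extend M n e) (here refl) | no y∉ = _ , extend M n e , y∉ , id
    firstArrival (extend M n e) (there i) | no y∉ = contradiction i y∉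

    Lead-walk : ∀ {l y} → Lead l y → y ≢ v → ∃ λ s → R v s × Walk (R ⇂ (λ z → z ∈ y ∷ l × Without v z)) s y
    Lead-walk (start e) _ = _ , e , ε
    Lead-walk (extend L y≢v e) t≢v =
      let s , vs , w = Lead-walk L y≢v in
      s , vs , Star.map (⇂-mono id λ (i , a) → there i , a) w
               ◅◅ (within (there (here refl) , proj₁ (R⊆A e) , y≢v) (here refl , proj₂ (R⊆A e) , t≢v) e ◅ ε)

    Two : V → Set
    Two c = ∃₂ λ l m → Lead l c × Lead m c × Apart l m × c ∉ l × c ∉ m

    module Advance {c l m} (L : Lead l c) (M : Lead m c) (apart : Apart l m) (c∉l : c ∉ l) (c∉m : c ∉ m) where

      Pos : V → Set
      Pos y = ∃₂ λ k o → Lead k y × Lead o c × c ∉ o × Apart (y ∷ k) o × c ∉ y ∷ k × (o ≡ l ⊎ o ≡ m)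

      -- If the new vertex lies on one of the two leads to `c`, the path so far is discarded for the
      -- initial part of that lead, and the other lead becomes the partner. Otherwise the old path
      -- continues with its old partner.
      arrive : ∀ {y} → y ≢ c → (y ∉ l → y ∉ m → Pos y) → Pos y
      arrive {y} y≢c new with y ∈? l | y ∈? m
      ... | yes i | _ with k , K , _ , sub ← firstArrival L (there i) =
        k , m , K , M , c∉m , (λ { (here refl) j → apart i j ; (there h) j → apart (sub h) j }) ,
        (λ { (here p) → y≢c (sym p) ; (there h) → c∉l (sub h) }) , inj₂ refl
      ... | no _ | yes i with k , K , _ , sub ← firstArrival M (there i) =
        k , l , K , L , c∉l , (λ { (here refl) j → apart j i ; (there h) j → apart j (sub h) }) ,
        (λ { (here p) → y≢c (sym p) ; (there h) → c∉m (sub h) }) , inj₁ refl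
      ... | no i | no j = new i j

      initial : ∀ {y} → R v y → y ≢ c → Pos y
      initial {y} e y≢c = arrive y≢c λ y∉l y∉m →
        [] , l , start e , L , c∉l , (λ { (here refl) j → y∉l j }) , (λ { (here p) → y≢c (sym p) }) , inj₁ refl

      advance : ∀ {y z} → Walk (R ⇂ (λ u → Without c u × u ≢ v)) y z → Pos y → Pos z
      advance ε p = p
      advance {y} (within (_ , y≢v) ((_ , z≢c) , _) e ◅ w) (k , o , K , O , c∉o , ap , c∉k , which) =
        advance w (arrive z≢c λ z∉l z∉m →
          y ∷ k , o , extend K y≢v e , O , c∉o ,
          (λ { (here refl) j → fresh which z∉l z∉m j ; (there h) j → ap h j }) ,
          (λ { (here p) → z≢c (sym p) ; (there h) → c∉k h }) , which)
        where
        fresh : ∀ {o z} → o ≡ l ⊎ o ≡ m → z ∉ l → z ∉ m → z ∉ o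
        fresh (inj₁ refl) p _ = p
        fresh (inj₂ refl) _ q = q

    -- Without `c` there is still a walk from `v` to `c′`. Following it yields a path to `c′` that
    -- is disjoint from one of the leads to `c`; that lead, prolonged by the edge from `c` to `c′`,
    -- is the second path.
    two-step : ∀ {c c′} → R c c′ → c ≢ v → c′ ≢ v → A v → Two c → Two c′
    two-step {c} {c′} e c≢v c′≢v Av (l , m , L , M , ap , c∉l , c∉m) = finish (position (robust Ac (Av , c≢v ∘ sym) (Ac′ , c′≢c)))
      where
      open Advance L M ap c∉l c∉m
      Ac = proj₁ (R⊆A e)
      Ac′ = proj₂ (R⊆A e)
      c′≢c : c′ ≢ c
      c′≢c refl = irr e
      position : Walk (R ⇂ Without c) v c′ → Pos c′
      position w with afterLast v w c′≢v
      ... | inj₁ (z , vz , (_ , z≢c) , w′) = advance w′ (initial vz z≢c)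
      ... | inj₂ (v≢v , _) = contradiction refl v≢v
      finish : Pos c′ → Two c′
      finish (k , o , K , O , c∉o , apo , c∉k , _) with firstArrival K (here refl)
      ... | k′ , K′ , c′∉ , sub = k′ , c ∷ o , K′ , extend O c≢v e ,
        (λ { h (here refl) → c∉k (there (sub h)) ; h (there j) → apo (there (sub h)) j }) ,
        c′∉ , λ { (here p) → c′≢c p ; (there j) → apo (here refl) j }

    two-along : ∀ {x y} → Walk (R ⇂ (λ u → A u × u ≢ v)) x y → A v → Two x → Two y
    two-along ε _ t = t
    two-along (within (_ , x≢v) (_ , y≢v) e ◅ w) Av t = two-along w Av (two-step e x≢v y≢v Av t)

    ear : ∀ {l y} → Lead l y → y ≢ v → R y v → ∃ λ (C : Ear) → ∀ {x} → x ∈ Ear.inner C → x ∈ y ∷ l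
    ear {l} {y} L y≢v yv with Lead-walk L y≢v
    ... | s , vs , w with simple w
    ...   | p , u = record { path = Star.map (⇂-mono id proj₂) p ; distinct = subst Unique (sym (vertices-map (⇂-mono id proj₂) p)) u ; enter = vs ; exit = yv } ,
      λ {x} i → proj₁ (stays p (start∈ p) (subst (x ∈_) (vertices-map (⇂-mono id proj₂) p) i))
      where
      start∈ : ∀ {s} → Walk (R ⇂ (λ z → z ∈ y ∷ l × Without v z)) s y → s ∈ y ∷ l × Without v s
      start∈ ε = here refl , proj₁ (R⊆A yv) , y≢v
      start∈ (e ◅ _) = source e

    record FigureEight : Set where
      field
        C C′  : Ear
        apart : Apart (Ear.inner C) (Ear.inner C′)

    -- Two paths are led from `v` to an in-neighbour `d` of `v`. One more walk, from another
    -- out-neighbour of `v` and avoiding `d`, replaces one of them by a path that returns to `v`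
    -- through a different vertex `z`.
    figureEight : A v → FigureEight
    figureEight Av with outNeighbour Av v
    ... | c , vc , c≢v with third v c
    ...   | t , At , t≢v , t≢c with beforeFirst v (robust At (proj₂ (R⊆A vc) , t≢c ∘ sym) (Av , t≢v ∘ sym)) c≢v
    -- Both paths start as the same edge, which is allowed because only inner vertices have to be
    -- disjoint.
    ...     | d , dv , w with two-along (Star.map (⇂-mono id λ ((a , _) , b) → a , b) w) Av ([] , [] , start vc , start vc , (λ ()) , (λ ()) , λ ())
    ...       | l , m , L , M , ap , d∉l , d∉m with outNeighbour Av d
    ...         | y₀ , vy₀ , y₀≢d = close (beforeFirst v (robust Ad (proj₂ (R⊆A vy₀) , y₀≢d) (Av , d≢v ∘ sym)) λ { refl → irr vy₀ })
      where
      open Advance L M ap d∉l d∉m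
      Ad = proj₁ (R⊆A dv)
      d≢v : d ≢ v
      d≢v refl = irr dv
      close : (∃ λ z → R z v × Walk (R ⇂ (λ u → Without d u × u ≢ v)) y₀ z) → FigureEight
      close (z , zv , w′) with advance w′ (initial vy₀ y₀≢d)
      ... | k , o , K , O , _ , apo , d∉k , _ with ear K (λ { refl → irr zv }) zv | ear O d≢v dv
      ...   | C , inC | C′ , inC′ = record { C = C ; C′ = C′ ; apart = λ i j → disjoint (inC i) (inC′ j) }
        where
        disjoint : ∀ {x} → x ∈ z ∷ k → x ∈ d ∷ o → ⊥
        disjoint i (here refl) = d∉k i
        disjoint i (there j) = apo i j

-- Joining the two cycles

module _ {n : ℕ} {S : Rel (Fin n) 0ℓ} where

  private V = Fin n

  len : ∀ {x y} → Walk S x y → ℕ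
  len ε       = 0
  len (_ ◅ w) = suc (len w)

  -- Positions past the end repeat the last vertex.
  at : ∀ {x y} → Walk S x y → ℕ → V
  at {x} ε       _       = x
  at {x} (_ ◅ w) zero    = x
  at {x} (_ ◅ w) (suc i) = at w i

  at-0 : ∀ {x y} (w : Walk S x y) → at w 0 ≡ x
  at-0 ε       = refl
  at-0 (_ ◅ _) = refl

  at-len : ∀ {x y} (w : Walk S x y) → at w (len w) ≡ y
  at-len ε       = refl
  at-len (_ ◅ w) = at-len w

  at∈ : ∀ {x y} (w : Walk S x y) i → at w i ∈ vertices w
  at∈ ε       _       = here refl
  at∈ (_ ◅ w) zero    = here refl
  at∈ (_ ◅ w) (suc i) = there (at∈ w i)

  position : ∀ {x y z} (w : Walk S x y) → z ∈ vertices w → ∃ λ i → i ≤ len w × at w i ≡ z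
  position ε       (here refl) = 0 , z≤n , refl
  position (_ ◅ w) (here refl) = 0 , z≤n , refl
  position (_ ◅ w) (there i) = let k , k≤ , p = position w i in suc k , s≤s k≤ , p

  at-Follows : ∀ {x y i} (w : Walk S x y) → i < len w → Follows w (at w i) (at w (suc i))
  at-Follows {i = zero}  (e ◅ w) _ = subst (Follows (e ◅ w) _) (sym (at-0 w)) here
  at-Follows {i = suc i} (_ ◅ w) (s≤s i<) = there (at-Follows w i<)

  at-inj : ∀ {x y i j} (w : Walk S x y) → Unique (vertices w) → i ≤ len w → j ≤ len w → at w i ≡ at w j → i ≡ j
  at-inj ε u z≤n z≤n _ = refl
  at-inj {i = zero}  {zero}  (_ ◅ w) _ _ _ _ = refl
  at-inj {i = zero}  {suc j} (_ ◅ w) (x∉ ∷ _) _ _ refl = contradiction (at∈ w j) (All¬⇒¬Any x∉)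
  at-inj {i = suc i} {zero}  (_ ◅ w) (x∉ ∷ _) _ _ refl = contradiction (at∈ w i) (All¬⇒¬Any x∉)
  at-inj {i = suc i} {suc j} (_ ◅ w) (_ ∷ u) (s≤s p) (s≤s q) e = cong suc (at-inj w u p q e)

  module Segments {x y : V} (w : Walk S x y) where

    Between : ℕ → ℕ → Pred V 0ℓ
    Between i j z = ∃ λ k → i ≤ k × k ≤ j × at w k ≡ z

    Forward : ℕ → ℕ → Rel V 0ℓ
    Forward i j a b = ∃ λ k → i ≤ k × k < j × at w k ≡ a × at w (suc k) ≡ b

    segment : ∀ {i j} → i ≤ j → Walk (Forward i j ⇂ Between i j) (at w i) (at w j)
    segment {i} {j} i≤j with ℕ.m≤n⇒m<n∨m≡n i≤j
    segment i≤j | inj₂ refl = ε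
    segment {i} {suc j} _ | inj₁ (s≤s i≤j) =
      Star.map (⇂-mono (λ (k , p , q , r) → k , p , ℕ.m<n⇒m<1+n q , r) (λ (k , p , q , r) → k , p , ℕ.m≤n⇒m≤1+n q , r)) (segment i≤j)
      ◅◅ (within (j , i≤j , ℕ.n≤1+n j , refl) (suc j , ℕ.m≤n⇒m≤1+n i≤j , ℕ.≤-refl , refl) (j , i≤j , ℕ.≤-refl , refl , refl) ◅ ε)

    Forward⇒ : ∀ {i j} → j ≤ len w → Forward i j ⇒ Follows w
    Forward⇒ j≤ (k , _ , k<j , refl , refl) = at-Follows w (ℕ.<-≤-trans k<j j≤)

    Backward : Rel V 0ℓ → Rel V 0ℓ
    Backward T a b = T a b × ∃₂ λ i j → at w i ≡ a × at w j ≡ b × j < i × i ≤ len w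

    module _ (u : Unique (vertices w)) {T : Rel V 0ℓ} where

      same : ∀ {i j} → i ≤ len w → j ≤ len w → at w i ≡ at w j → i ≡ j
      same = at-inj w u

      backward-≤ : ∀ {i k a b} (q : Walk (Backward T) a b) → at w i ≡ a → i ≤ len w → at w k ∈ vertices q → k ≤ len w → k ≤ i
      backward-≤ ε refl i≤ (here p) k≤ = ℕ.≤-reflexive (same k≤ i≤ p)
      backward-≤ (_ ◅ _) refl i≤ (here p) k≤ = ℕ.≤-reflexive (same k≤ i≤ p)
      backward-≤ ((_ , i′ , j , p , q , j<i , i′≤) ◅ r) refl i≤ (there m) k≤ with refl ← same i′≤ i≤ p =
        ℕ.≤-trans (backward-≤ r q (ℕ.≤-trans (ℕ.<⇒≤ j<i) i≤) m k≤) (ℕ.<⇒≤ j<i)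

      -- A walk whose positions only decrease cannot come back to a position it has skipped. If it
      -- visits every position between `j` and `i`, then each of its steps there descends by one.
      unit-steps : ∀ {i j a b} (q : Walk (Backward T) a b) → at w i ≡ a → i ≤ len w → at w j ≡ b → j ≤ len w →
                   (∀ {k} → j ≤ k → k ≤ i → at w k ∈ vertices q) → ∀ {k} → j ≤ k → k < i → T (at w (suc k)) (at w k)
      unit-steps ε p i≤ q j≤ _ j≤k k<i = contradiction (same i≤ j≤ (trans p (sym q))) λ { refl → ℕ.<-irrefl refl (ℕ.≤-<-trans j≤k k<i) }
      unit-steps {suc i} {j} ((t , i′ , m , p , q , m<i , i′≤) ◅ r) refl i≤ end j≤ visits {k} j≤k k<i
        with refl ← same i′≤ i≤ p = conclude (ℕ.m≤n⇒m<n∨m≡n (ℕ.≤-pred k<i))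
        where
        m≤ = ℕ.≤-trans (ℕ.<⇒≤ m<i) i≤
        j≤m = backward-≤ r q m≤ (subst (_∈ vertices r) (sym end) (last∈ r)) j≤
        i₀≤ = ℕ.≤-trans (ℕ.n≤1+n i) i≤
        m≡i : m ≡ i
        m≡i with visits (ℕ.≤-trans j≤m (ℕ.≤-pred m<i)) (ℕ.n≤1+n i)
        ... | here e = contradiction (same i₀≤ i≤ e) (ℕ.1+n≢n ∘ sym)
        ... | there e = ℕ.≤-antisym (ℕ.≤-pred m<i) (backward-≤ r q m≤ e i₀≤)
        visits′ : ∀ {k} → j ≤ k → k ≤ i → at w k ∈ vertices r
        visits′ {k} p q with visits p (ℕ.m≤n⇒m≤1+n q)
        ... | here e = contradiction (same (ℕ.≤-trans q i₀≤) i≤ e) (ℕ.<⇒≢ (s≤s q))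
        ... | there e = e
        conclude : k < i ⊎ k ≡ i → T (at w (suc k)) (at w k)
        conclude (inj₁ k<) = unit-steps r (trans (cong (at w) (sym m≡i)) q) i₀≤ end j≤ visits′ j≤k k<
        conclude (inj₂ refl) = subst₂ T refl (trans (sym q) (cong (at w) m≡i)) t

module _ {A : Set} {S T : Rel A 0ℓ} {B : Set₁} where

  traverse : (∀ {x y} → S x y → B ⊎ T x y) → ∀ {x y} (w : Walk S x y) → B ⊎ Σ (Walk T x y) λ w′ → vertices w′ ≡ vertices w
  traverse f ε = inj₂ (ε , refl)
  traverse f (e ◅ w) with f e | traverse f w
  ... | inj₁ b | _ = inj₁ b
  ... | inj₂ _ | inj₁ b = inj₁ b
  ... | inj₂ t | inj₂ (w′ , p) = inj₂ (t ◅ w′ , cong (_ ∷_) p)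

allOr : ∀ {A : Set} {P : Pred A 0ℓ} → Decidable₁ P → ∀ xs → (∀ {x} → x ∈ xs → P x) ⊎ (∃ λ x → x ∈ xs × ¬ P x)
allOr P? xs with Any.any? (λ x → ¬? (P? x)) xs
... | yes a = let x , x∈ , ¬p = find a in inj₂ (x , x∈ , ¬p)
... | no ¬a = inj₁ λ {x} i → decidable-stable (P? x) λ ¬p → ¬a (lose i ¬p)

module EarPairs {n : ℕ} {R : Rel (Fin n) 0ℓ} {A : Pred (Fin n) 0ℓ} {Bad : Set₁} (tc : TwoConnected R A Bad) (v : Fin n) (Av : A v) where

  open TwoConnected tc
  open Ears tc hiding (R°; Ear; module Ear)
  private V = Fin n
  R° = Ears.R° tc v
  Ear = Ears.Ear tc v
  module Ear = Ears.Ear {tc = tc} {v = v}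

  record Crossing (X Y : Ear) : Set where
    field
      F        : Cycle R
      F⊆       : ∀ {x} → x ∈ cycleVertices F → Without v x
      {c d}    : V
      c∈F      : c ∈ cycleVertices F
      c∈X      : c ∈ Ear.inner X
      d∈F      : d ∈ cycleVertices F
      d∈Y      : d ∈ Ear.inner Y

  -- The counterpart of a crossing: a cycle that meets `X` but not `Y`, prolonged as far as `Y` by a
  -- strong set that misses `X`.
  record Detour (X Y : Ear) : Set₁ where
    field
      F      : Cycle R
      F⊆     : ∀ {x} → x ∈ cycleVertices F → Without v x
      {c}    : V
      c∈F    : c ∈ cycleVertices F
      c∈X    : c ∈ Ear.inner X
      F-Y    : ∀ {x} → x ∈ cycleVertices F → x ∈ Ear.inner Y → ⊥
      H      : Pred V 0ℓ
      strH   : Str R H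
      H⊆     : ∀ {x} → H x → Without v x
      {h d}  : V
      Hh     : H h
      h∈F    : h ∈ cycleVertices F
      Hd     : H d
      d∈Y    : d ∈ Ear.inner Y
      H-X    : ∀ {x} → H x → x ∈ Ear.inner X → ⊥

  edgeCycle : ∀ {x y} → R° x y → ∃ λ (F : Cycle R) → x ∈ cycleVertices F × y ∈ cycleVertices F × (∀ {z} → z ∈ cycleVertices F → Without v z)
  edgeCycle {x} {y} (within p q e) with simple (robust Av q p)
  ... | w , u = record { walk = Star.map step w ; distinct = subst Unique (sym (vertices-map step w)) u ; closing = e } ,
    last∈ (Star.map step w) , first∈ (Star.map step w) , λ {z} i → stays w q (subst (z ∈_) (vertices-map step w) i)

  module _ (X Y : Ear) (apart : Apart (Ear.inner X) (Ear.inner Y)) where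

    Ahead : V → V → Set₁
    Ahead x y = ∃ λ (H : Pred V 0ℓ) → Str R H × (∀ {z} → H z → Without v z) × H x × H y × (∀ {z} → H z → z ∈ Ear.inner X → ⊥)

    -- Every edge avoiding `v` lies on a cycle avoiding `v`, so the walk is covered by a chain of
    -- cycles. Read from the `Y` end, the first cycle that meets `X` decides between the two
    -- outcomes.
    search : ∀ {x y} → Walk R° x y → y ∈ Ear.inner Y → Crossing X Y ⊎ Detour X Y ⊎ Ahead x y
    search {x} ε y∈ = inj₂ (inj₂ ((_≡ x) , Str-singleton x , (λ { refl → Ear.inside Y y∈ }) , refl , refl , λ { refl i → apart i y∈ }))
    search {x} {y} (e ◅ w) y∈ with search w y∈
    ... | inj₁ k = inj₁ k
    ... | inj₂ (inj₁ k) = inj₂ (inj₁ k)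
    ... | inj₂ (inj₂ (H , sH , H⊆ , Hx′ , Hy , H-X)) with edgeCycle e
    ...   | F , x∈F , x′∈F , F⊆ with allOr (λ z → ¬? (z ∈? Ear.inner X)) (cycleVertices F)
    ...     | inj₁ F-X = inj₂ (inj₂ (_ , Str-∪ x′∈F Hx′ (Cyc.Str-cycle F) sH , (λ { (inj₁ p) → F⊆ p ; (inj₂ p) → H⊆ p }) , inj₁ x∈F , inj₂ Hy , λ { (inj₁ p) → F-X p ; (inj₂ p) → H-X p }))
    ...     | inj₂ (c , c∈F , ¬c∉X) with allOr (λ z → ¬? (z ∈? Ear.inner Y)) (cycleVertices F)
    ...       | inj₁ F-Y = inj₂ (inj₁ record { F = F ; F⊆ = F⊆ ; c∈F = c∈F ; c∈X = decidable-stable (c ∈? _) ¬c∉X ; F-Y = F-Y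
                                     ; H = H ; strH = sH ; H⊆ = H⊆ ; Hh = Hx′ ; h∈F = x′∈F ; Hd = Hy ; d∈Y = y∈ ; H-X = H-X })
    ...       | inj₂ (d , d∈F , ¬d∉Y) = inj₁ record { F = F ; F⊆ = F⊆ ; c∈F = c∈F ; c∈X = decidable-stable (c ∈? _) ¬c∉X
                                                    ; d∈F = d∈F ; d∈Y = decidable-stable (d ∈? _) ¬d∉Y }

    connect : Crossing X Y ⊎ Detour X Y
    connect with search (robust Av (Ear.inside X (Ear.s∈ X)) (Ear.inside Y (Ear.s∈ Y))) (Ear.s∈ Y)
    ... | inj₁ k = inj₁ k
    ... | inj₂ (inj₁ k) = inj₂ k
    ... | inj₂ (inj₂ (_ , _ , _ , Hs , _ , H-X)) = contradiction (Ear.s∈ X) (H-X Hs)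

    ears-meet : ∀ {x} → Ear.On X x → Ear.On Y x → x ≡ v
    ears-meet i j with Ear.on⁻ X i | Ear.on⁻ Y j
    ... | inj₁ p | _ = p
    ... | _ | inj₁ p = p
    ... | inj₂ p | inj₂ q = contradiction q (apart p)

    ¬on : ∀ {x} → x ∈ Ear.inner X → ¬ Ear.On Y x
    ¬on i j with Ear.on⁻ Y j
    ... | inj₁ p = proj₂ (Ear.inside X i) p
    ... | inj₂ q = apart i q

    -- A vertex of `X` off `F` is met only by the cycle of `X`, so it can be pinned. If `F` contains
    -- all inner vertices of `X` and the ends `s` and `t` differ, then `F` with `v` attached
    -- replaces that cycle, and `s` is left along `F` only.
    detour-digon : Detour X Y → Bad ⊎ Ear.s X ≡ Ear.t X
    detour-digon k with allOr (_∈? cycleVertices (Detour.F k)) (Ear.inner X)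
    ... | inj₂ (c′ , c′∈ , c′∉F) = inj₁ (pinned (proj₁ (Ear.inside X c′∈)) z record
      { strA = Cyc.Succ-Out (Ear.cycle X) c′z
      ; strB = Str-avoid (¬on c′∈) (Cyc.Str-cycle (Ear.cycle Y))
      ; strC = Str-∪ h∈F Hh (Str-avoid c′∉F (Cyc.Str-cycle F)) (Str-avoid (λ Hc → H-X Hc c′∈) strH)
      ; AB = v , Ear.v-on X , Ear.v-on Y
      ; BC = d , Ear.inner-on Y d∈Y , inj₂ Hd
      ; CA = c , inj₁ c∈F , Ear.inner-on X c∈X
      ; none = λ a b → v∉ (ears-meet a b) })
      where
      open Detour k
      c′z = proj₂ (Cyc.successor (Ear.cycle X) (Ear.inner-on X c′∈))
      z = proj₁ (Cyc.successor (Ear.cycle X) (Ear.inner-on X c′∈))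
      v∉ : ∀ {x} → x ≡ v → x ∈ cycleVertices F ⊎ H x → ⊥
      v∉ p (inj₁ i) = proj₂ (F⊆ i) p
      v∉ p (inj₂ i) = proj₂ (H⊆ i) p
    ... | inj₁ X⊆F with Ear.s X ≟ Ear.t X
    ...   | yes p = inj₂ p
    ...   | no s≢t = inj₁ (pinned (proj₁ (Ear.inside X (Ear.s∈ X))) z record
      { A = λ x → x ≡ v ⊎ x ∈ cycleVertices F
      ; strA = Str-hub s λ { (inj₁ refl) → (within (inj₁ refl) (inj₂ s∈F) (Ear.enter X , λ p → contradiction (sym p) (Ear.s≢v X)) ◅ ε)
                                        , Star.map (⇂-mono id inj₂) (sF s∈F t∈F) ◅◅ (within (inj₂ t∈F) (inj₁ refl) (Ear.exit X , λ p → contradiction (sym p) s≢t) ◅ ε)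
                           ; (inj₂ i) → Star.map (⇂-mono id inj₂) (sF i s∈F) , Star.map (⇂-mono id inj₂) (sF s∈F i) }
      ; strB = Str-avoid (¬on (Ear.s∈ X)) (Cyc.Str-cycle (Ear.cycle Y))
      ; strC = Str-∪ h∈F Hh sF (Str-avoid (λ Hc → H-X Hc (Ear.s∈ X)) strH)
      ; AB = v , inj₁ refl , Ear.v-on Y
      ; BC = d , Ear.inner-on Y d∈Y , inj₂ Hd
      ; CA = c , inj₁ c∈F , inj₂ c∈F
      ; none = none })
      where
      open Detour k
      s = Ear.s X
      s∈F = X⊆F (Ear.s∈ X)
      t∈F = X⊆F (Ear.t∈ X)
      z = proj₁ (Cyc.successor F s∈F)
      sF : Str (Out s z) (_∈ cycleVertices F)
      sF = Cyc.Succ-Out F (proj₂ (Cyc.successor F s∈F))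
      none : ∀ {x} → x ≡ v ⊎ x ∈ cycleVertices F → Ear.On Y x → x ∈ cycleVertices F ⊎ H x → ⊥
      none (inj₁ p) _ (inj₁ i) = proj₂ (F⊆ i) p
      none (inj₁ p) _ (inj₂ i) = proj₂ (H⊆ i) p
      none (inj₂ i) j _ with Ear.on⁻ Y j
      ... | inj₁ p = proj₂ (F⊆ i) p
      ... | inj₂ q = F-Y i q

  -- Two digons at v.  The two simple paths joining a and b traverse the
  -- same vertices in opposite orders, so they form a path of digons.

  module _ {a b : V} (va : R v a) (av : R a v) (vb : R v b) (bv : R b v) (a≢b : a ≢ b) where

    private
      a° : Without v a
      a° = proj₂ (R⊆A va) , λ p → irr (subst (R v) p va)
      b° : Without v b
      b° = proj₂ (R⊆A vb) , λ p → irr (subst (R v) p vb)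

    -- The two digons share only `v`, which the closed walk through `a` and `b` misses. So the case
    -- is settled as soon as the two walks leave some `x` other than `a` and `b` by at most one
    -- common edge.
    digons-Obs : ∀ {x z} → Without v x → x ≢ a → x ≢ b →
                 Walk (Out x z ⇂ Without v) a b → Walk (Out x z ⇂ Without v) b a → Bad
    digons-Obs {x} {z} (Ax , x≢v) x≢a x≢b p q = pinned Ax z record
      { A = λ u → u ∈ vertices va-walk ⊎ u ∈ vertices av-walk
      ; B = λ u → u ∈ vertices vb-walk ⊎ u ∈ vertices bv-walk
      ; strA = Str-closed va-walk av-walk ; strB = Str-closed vb-walk bv-walk
      ; strC = Str-mono step (Str-closed p q)
      ; AB = v , inj₁ (here refl) , inj₁ (here refl)
      ; BC = b , inj₂ (here refl) , inj₁ (last∈ p)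
      ; CA = a , inj₁ (first∈ p) , inj₂ (here refl)
      ; none = λ i j k → outside k (only-v (digon-vertices i) (digon-vertices j)) }
      where
      keep : ∀ {y t} → R y t → x ≢ y → Out x z y t
      keep e x≢y = e , λ p → contradiction (sym p) x≢y
      va-walk : Walk (Out x z) v a
      va-walk = keep va x≢v ◅ ε
      av-walk : Walk (Out x z) a v
      av-walk = keep av x≢a ◅ ε
      vb-walk : Walk (Out x z) v b
      vb-walk = keep vb x≢v ◅ ε
      bv-walk : Walk (Out x z) b v
      bv-walk = keep bv x≢b ◅ ε
      only-v : ∀ {u} → u ≡ v ⊎ u ≡ a → u ≡ v ⊎ u ≡ b → u ≡ v
      only-v (inj₁ p) _ = p
      only-v _ (inj₁ p) = p
      only-v (inj₂ p) (inj₂ q) = contradiction (trans (sym p) q) a≢b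
      outside : ∀ {u} → u ∈ vertices p ⊎ u ∈ vertices q → u ≢ v
      outside (inj₁ i) = proj₂ (stays p a° i)
      outside (inj₂ i) = proj₂ (stays q b° i)

    module Paths (p : Walk R° a b) (u : Unique (vertices p)) (q : Walk R° b a) (u′ : Unique (vertices q)) where

      open Segments p

      restrict : ∀ {x z y t} {S : Rel V 0ℓ} (w : Walk S y t) → (∀ {c d} → S c d → R° c d × (c ≡ x → d ≡ z)) →
                 Walk (Out x z ⇂ Without v) y t
      restrict w f = Star.map (λ e → let within s t r , g = f e in within s t (r , g)) w

      p-in° : ∀ {x} → x ∈ vertices p → Without v x
      p-in° = stays p a°

      q-in° : ∀ {x} → x ∈ vertices q → Without v x
      q-in° = stays q b°

      p-along : ∀ {x z} → (x ∈ vertices p → Follows p x z) → Walk (Out x z ⇂ Without v) a b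
      p-along {x} {z} h = restrict (retrace p) λ f → Follows⇒ f ,
        λ { refl → Follows-functional u f (h (Follows-source f)) }

      q-along : ∀ {x z} → (x ∈ vertices q → Follows q x z) → Walk (Out x z ⇂ Without v) b a
      q-along {x} {z} h = restrict (retrace q) λ f → Follows⇒ f ,
        λ { refl → Follows-functional u′ f (h (Follows-source f)) }

      q⊆p : Bad ⊎ (∀ {y} → y ∈ vertices q → y ∈ vertices p)
      q⊆p with allOr (_∈? vertices p) (vertices q)
      ... | inj₁ h = inj₂ h
      ... | inj₂ (y , y∈q , y∉p) with next q y∈q
      ...   | inj₁ refl = contradiction (first∈ p) y∉p
      ...   | inj₂ (z , f) = inj₁ (digons-Obs (q-in° y∈q) (λ { refl → y∉p (first∈ p) }) (λ { refl → y∉p (last∈ p) })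
                                    (p-along λ y∈p → contradiction y∈p y∉p) (q-along λ _ → f))

      p⊆q : Bad ⊎ (∀ {y} → y ∈ vertices p → y ∈ vertices q)
      p⊆q with allOr (_∈? vertices q) (vertices p)
      ... | inj₁ h = inj₂ h
      ... | inj₂ (y , y∈p , y∉q) with next p y∈p
      ...   | inj₁ refl = contradiction (first∈ q) y∉q
      ...   | inj₂ (z , f) = inj₁ (digons-Obs (p-in° y∈p) (λ { refl → y∉q (last∈ q) }) (λ { refl → y∉q (first∈ q) })
                                    (p-along λ _ → f) (q-along λ y∈q → contradiction y∈q y∉q))

      -- If a step of `q` jumps forward along `p`, then `p` can be shortened by the same step, and
      -- both paths leave `s` by one edge.
      backward : (∀ {y} → y ∈ vertices q → y ∈ vertices p) → ∀ {s t} → Follows q s t → Bad ⊎ Backward R s t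
      backward q⊆p {s} {t} f with position p (q⊆p (Follows-source f)) | position p (q⊆p (Follows-target f))
      ... | i , i≤ , refl | j , j≤ , refl with ℕ.<-cmp i j
      ...   | tri> _ _ j<i = inj₂ (step (Follows⇒ f) , i , j , refl , refl , j<i , i≤)
      ...   | tri≈ _ refl _ = contradiction (step (Follows⇒ f)) irr
      ...   | tri< i<j _ _ = inj₁ (digons-Obs (q-in° (Follows-source f)) (λ e → Follows-last u′ (subst (λ s → Follows q s (at p j)) e f))
               (λ e → ℕ.<⇒≱ i<j (ℕ.≤-trans j≤ (ℕ.≤-reflexive (sym (at-inj p u i≤ ℕ.≤-refl (trans e (sym (at-len p))))))))
               (subst₂ (Walk _) (at-0 p) (at-len p)
                 (restrict (segment {0} {i} z≤n) (λ (within _ _ F@(k , _ , k<i , e , _)) → Follows⇒ (Forward⇒ i≤ F) ,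
                    λ e′ → contradiction (at-inj p u (ℕ.≤-trans (ℕ.<⇒≤ k<i) i≤) i≤ (trans e e′)) (ℕ.<⇒≢ k<i))
                  ◅◅ (within (q-in° (Follows-source f)) (q-in° (Follows-target f)) (step (Follows⇒ f) , λ _ → refl) ◅ ε)
                  ◅◅ restrict (segment {j} {len p} j≤) (λ (within _ _ F@(k , j≤k , k< , e , _)) → Follows⇒ (Forward⇒ ℕ.≤-refl F) ,
                    λ e′ → contradiction (at-inj p u (ℕ.<⇒≤ k<) i≤ (trans e e′)) (ℕ.<⇒≢ (ℕ.<-≤-trans i<j j≤k) ∘ sym))))
               (q-along λ _ → f))

      bicycle-found : (∀ {k} → k < len p → R (at p (suc k)) (at p k)) → Bad
      bicycle-found back = bicycleBad ℓ 3≤ℓ (g , g-inj , λ e → edge (bicycle-edge⁻ 3≤ℓ e))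
        where
        -- The bicycle consists of `v` and the `len p + 1` vertices of `p`.
        ℓ = suc (suc (len p))
        positive : ∀ {x y} (w : Walk R° x y) → x ≢ y → 1 ≤ len w
        positive ε x≢y = contradiction refl x≢y
        positive (_ ◅ _) _ = s≤s z≤n
        3≤ℓ : 3 ≤ ℓ
        3≤ℓ = s≤s (s≤s (positive p a≢b))
        g : Fin ℓ → V
        g zero    = v
        g (suc i) = at p (toℕ i)
        at≢v : ∀ i → at p i ≢ v
        at≢v i = proj₂ (p-in° (at∈ p i))
        g-inj : ∀ {i j} → g i ≡ g j → i ≡ j
        g-inj {zero}  {zero}  _ = refl
        g-inj {zero}  {suc j} e = contradiction (sym e) (at≢v (toℕ j))
        g-inj {suc i} {zero}  e = contradiction e (at≢v (toℕ i))
        g-inj {suc i} {suc j} e = cong suc (toℕ-injective (at-inj p u (ℕ.≤-pred (toℕ<n i)) (ℕ.≤-pred (toℕ<n j)) e))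
        link : ∀ {i j} → Next i j → R (g i) (g j) × R (g j) (g i)
        link {zero} {suc j} (inj₁ e) = let e′ = trans (cong (at p) (ℕ.suc-injective e)) (at-0 p) in
          subst (R v) (sym e′) va , subst (λ x → R x v) (sym e′) av
        link {suc i} {suc j} (inj₁ e) = let e′ = ℕ.suc-injective e ; i< = subst (_≤ len p) e′ (ℕ.≤-pred (toℕ<n j)) in
          subst (λ k → R (at p (toℕ i)) (at p k)) (sym e′) (step (Follows⇒ (at-Follows p i<))) ,
          subst (λ k → R (at p k) (at p (toℕ i))) (sym e′) (back i<)
        link {suc i} {zero} (inj₂ (e , _)) = let e′ = trans (cong (at p) (ℕ.suc-injective (ℕ.suc-injective e))) (at-len p) in
          subst (λ x → R x v) (sym e′) bv , subst (R v) (sym e′) vb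
        link {zero} {zero} (inj₂ (() , _))
        link {zero} {zero} (inj₁ ())
        link {suc _} {zero} (inj₁ ())
        link {_} {suc _} (inj₂ (_ , ()))
        edge : ∀ {i j} → Next i j ⊎ Next j i → R (g i) (g j)
        edge (inj₁ m) = proj₁ (link m)
        edge (inj₂ m) = proj₂ (link m)

      conclude : Bad
      conclude with q⊆p | p⊆q
      ... | inj₁ bad | _ = bad
      ... | _ | inj₁ bad = bad
      ... | inj₂ q⊆ | inj₂ p⊆ with traverse (backward q⊆) (retrace q)
      ...   | inj₁ bad = bad
      ...   | inj₂ (w , eq) = bicycle-found λ {k} k< →
        unit-steps u w (at-len p) ℕ.≤-refl (at-0 p) z≤n
          (λ {k} _ _ → subst (at p k ∈_) (sym (trans eq (vertices-retrace q))) (p⊆ (at∈ p k))) z≤n k<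

    two-digons : Bad
    two-digons with simple (robust Av a° b°) | simple (robust Av b° a°)
    ... | p , u | q , u′ = Paths.conclude p u q u′

-- A third cycle crossing both

module _ {n : ℕ} {S : Rel (Fin n) 0ℓ} where

  private V = Fin n

  Follows-map : ∀ {T : Rel V 0ℓ} (f : S ⇒ T) {x y a b} {w : Walk S x y} → Follows w a b → Follows (Star.map f w) a b
  Follows-map f here = here
  Follows-map f (there g) = there (Follows-map f g)

  vertices-◅◅ : ∀ {a b x y} (w₁ : Walk S x a) (e : S a b) (w₂ : Walk S b y) →
                vertices (w₁ ◅◅ (e ◅ w₂)) ≡ vertices w₁ ++ vertices w₂
  vertices-◅◅ ε e w₂ = refl
  vertices-◅◅ (d ◅ w₁) e w₂ = cong (_ ∷_) (vertices-◅◅ w₁ e w₂)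

  module Rotate {P : Pred V 0ℓ} (P? : Decidable₁ P) where

    Cut : ∀ {x y} → Walk S x y → Set
    Cut {x} {y} w = ∃₂ λ a b → ¬ P a × P b × S a b × Σ (Walk S x a) λ w₁ → Σ (Walk S b y) λ w₂ →
                    vertices w ≡ vertices w₁ ++ vertices w₂

    cut-there : ∀ {x y z} (e : S x y) (w : Walk S y z) → Cut w → Cut (e ◅ w)
    cut-there e w (a , b , ¬Pa , Pb , f , w₁ , w₂ , q) = a , b , ¬Pa , Pb , f , e ◅ w₁ , w₂ , cong (_ ∷_) q

    cut-before : ∀ {x y d} (w : Walk S x y) → d ∈ vertices w → ¬ P d → P y → Cut w
    cut-before ε (here refl) ¬Pd Py = contradiction Py ¬Pd
    cut-before {x} (_◅_ {j = x′} e w) d∈ ¬Pd Py with P? x′ | P? x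
    ... | no ¬Px′ | _      = cut-there e w (cut-before w (first∈ w) ¬Px′ Py)
    ... | yes Px′ | no ¬Px = x , x′ , ¬Px , Px′ , e , ε , w , refl
    cut-before (e ◅ w) (here refl) ¬Pd Py | yes _ | yes Px = contradiction Px ¬Pd
    cut-before (e ◅ w) (there d∈)  ¬Pd Py | yes _ | yes Px = cut-there e w (cut-before w d∈ ¬Pd Py)

    cut-after : ∀ {x y c} (w : Walk S x y) → c ∈ vertices w → P c → ¬ P x → Cut w
    cut-after ε (here refl) Pc ¬Px = contradiction Pc ¬Px
    cut-after (e ◅ w) (here refl) Pc ¬Px = contradiction Pc ¬Px
    cut-after {x} (_◅_ {j = x′} e w) (there c∈) Pc ¬Px with P? x′
    ... | yes Px′ = x , x′ , ¬Px , Px′ , e , ε , w , refl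
    ... | no ¬Px′ = cut-there e w (cut-after w c∈ Pc ¬Px′)

    Rotated : Cycle S → Set
    Rotated C = Σ (Cycle S) λ C′ → P (Cycle.first C′) × ¬ P (Cycle.last C′) ×
                (∀ {x} → x ∈ cycleVertices C → x ∈ cycleVertices C′) × (∀ {x} → x ∈ cycleVertices C′ → x ∈ cycleVertices C)

    rotateAt : (C : Cycle S) → Cut (Cycle.walk C) → Rotated C
    rotateAt C (a , b , ¬Pa , Pb , e , w₁ , w₂ , q) =
      record { walk = w₂ ◅◅ (closing ◅ w₁) ; distinct = subst Unique (sym q′) unique ; closing = e } , Pb , ¬Pa ,
      (λ {x} i → subst (x ∈_) (sym q′) (exchange (vertices w₁) (subst (x ∈_) q i))) ,
      (λ {x} i → subst (x ∈_) (sym q) (exchange (vertices w₂) (subst (x ∈_) q′ i)))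
      where
      open Cycle C using (closing; distinct)
      q′ = vertices-◅◅ w₂ closing w₁
      exchange : ∀ xs {ys : List V} {x} → x ∈ xs ++ ys → x ∈ ys ++ xs
      exchange xs {ys} i with ∈-++⁻ xs i
      ... | inj₁ j = ∈-++⁺ʳ ys j
      ... | inj₂ j = ∈-++⁺ˡ j
      unique : Unique (vertices w₂ ++ vertices w₁)
      unique = Permutation.Unique-resp-↭ (setoid V) (Permutation.++-comm (setoid V) (vertices w₁) (vertices w₂)) (subst Unique q distinct)

    -- Some edge of the cycle enters `P` from outside. Opening the cycle at that edge puts its head
    -- first and its tail last.
    rotate : (C : Cycle S) → ∀ {c d} → c ∈ cycleVertices C → P c → d ∈ cycleVertices C → ¬ P d → Rotated C
    rotate C c∈ Pc d∈ ¬Pd with P? (Cycle.first C) | P? (Cycle.last C)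
    ... | no ¬Pf | _      = rotateAt C (cut-after (Cycle.walk C) c∈ Pc ¬Pf)
    ... | yes Pf | no ¬Pl = C , Pf , ¬Pl , id , id
    ... | yes Pf | yes Pl = rotateAt C (cut-before (Cycle.walk C) d∈ ¬Pd Pl)

module Crossings {n : ℕ} {R : Rel (Fin n) 0ℓ} {A : Pred (Fin n) 0ℓ} {Bad : Set₁} (tc : TwoConnected R A Bad) (v : Fin n) (Av : A v) where

  open TwoConnected tc
  open EarPairs tc v Av
  open Ears tc hiding (R°; Ear; module Ear)
  private V = Fin n

  module _ (X Y : Ear) (apart : Apart (Ear.inner X) (Ear.inner Y)) where

    crossing-Obs : ∀ {x z c d} {G : Pred V 0ℓ} → A x → Str (Out x z) (Ear.On X) → Str (Out x z) (Ear.On Y) → Str (Out x z) G →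
                   (∀ {y} → G y → Without v y) → G c → c ∈ Ear.inner X → G d → d ∈ Ear.inner Y → Bad
    crossing-Obs Ax sX sY sG G⊆ Gc c∈X Gd d∈Y = pinned Ax _ record
      { strA = sX ; strB = sY ; strC = sG
      ; AB = v , Ear.v-on X , Ear.v-on Y
      ; BC = _ , Ear.inner-on Y d∈Y , Gd
      ; CA = _ , Gc , Ear.inner-on X c∈X
      ; none = λ i j g → proj₂ (G⊆ g) (ears-meet X Y apart i j) }

    avoid-Y : ∀ {x z} → x ∈ Ear.inner X → Str (Out x z) (Ear.On Y)
    avoid-Y x∈X = Str-avoid (¬on X Y apart x∈X) (Cyc.Str-cycle (Ear.cycle Y))

    along : ∀ (Z : Ear) {x z} → Follows (Ear.path Z) x z → Str (Out x z) (Ear.On Z)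
    along Z f = Cyc.Succ-Out (Ear.cycle Z) (inj₁ (there (Follows-map step f)))

    -- A vertex other than v on only one of the three cycles has an unused
    -- outgoing edge.

    X⊆F : (k : Crossing X Y) → Bad ⊎ (∀ {x} → x ∈ Ear.inner X → x ∈ cycleVertices (Crossing.F k))
    X⊆F k with allOr (_∈? cycleVertices (Crossing.F k)) (Ear.inner X)
    ... | inj₁ h = inj₂ h
    ... | inj₂ (x , x∈ , x∉F) = inj₁ (crossing-Obs (proj₁ (Ear.inside X x∈))
            (Cyc.Succ-Out (Ear.cycle X) (proj₂ (Cyc.successor (Ear.cycle X) (Ear.inner-on X x∈))))
            (avoid-Y x∈) (Str-avoid x∉F (Cyc.Str-cycle F)) F⊆ c∈F c∈X d∈F d∈Y)
      where open Crossing k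

    F⊆X∪Y : (k : Crossing X Y) → Bad ⊎ (∀ {x} → x ∈ cycleVertices (Crossing.F k) → x ∈ Ear.inner X ⊎ x ∈ Ear.inner Y)
    F⊆X∪Y k with allOr (λ x → (x ∈? Ear.inner X) ⊎-dec (x ∈? Ear.inner Y)) (cycleVertices (Crossing.F k))
    ... | inj₁ h = inj₂ h
    ... | inj₂ (x , x∈ , x∉) = inj₁ (crossing-Obs (proj₁ (F⊆ x∈)) (off X (x∉ ∘ inj₁)) (off Y (x∉ ∘ inj₂))
            (Cyc.Succ-Out F (proj₂ (Cyc.successor F x∈))) F⊆ c∈F c∈X d∈F d∈Y)
      where
      open Crossing k
      off : ∀ (Z : Ear) {z} → x ∉ Ear.inner Z → Str (Out x z) (Ear.On Z)
      off Z x∉Z = Str-avoid (λ i → [ proj₂ (F⊆ x∈) , x∉Z ]′ (Ear.on⁻ Z i)) (Cyc.Str-cycle (Ear.cycle Z))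

  swap-crossing : ∀ {X Y} → Crossing X Y → Crossing Y X
  swap-crossing k = record { F = F ; F⊆ = F⊆ ; c∈F = d∈F ; c∈X = d∈Y ; d∈F = c∈F ; d∈Y = c∈X }
    where open Crossing k

  module Ladder {f l : V} (p : Walk R f l) (u : Unique (vertices p)) (p⊆ : ∀ {x} → x ∈ vertices p → Without v x) where

    open Segments p

    Between-≢v : ∀ {i j x} → Between i j x → Without v x
    Between-≢v (k , _ , _ , refl) = p⊆ (at∈ p k)

    descend : ∀ {i j k} → (∀ {k} → i ≤ k → k < j → R (at p (suc k)) (at p k)) → i ≤ k → k ≤ j →
              Walk (R ⇂ Between i j) (at p k) (at p i)
    descend {i} {j} {k} down i≤k k≤j with ℕ.m≤n⇒m<n∨m≡n i≤k
    ... | inj₂ refl = ε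
    descend {i} {j} {suc k} down i≤k k≤j | inj₁ (s≤s i≤k′) =
      within (suc k , i≤k , k≤j , refl) (k , i≤k′ , ℕ.<⇒≤ k≤j , refl) (down i≤k′ k≤j) ◅ descend down i≤k′ (ℕ.<⇒≤ k≤j)

    ladder : ∀ {i j} → j ≤ len p → (∀ {k} → i ≤ k → k < j → R (at p (suc k)) (at p k)) → Str R (Between i j)
    ladder {i} {j} j≤ down = Str-hub (at p i) λ { (k , i≤k , k≤j , refl) →
      descend down i≤k k≤j ,
      Star.map (⇂-mono (Follows⇒ ∘ Forward⇒ (ℕ.≤-trans k≤j j≤)) λ (m , p , q , r) → m , p , ℕ.≤-trans q k≤j , r) (segment i≤k) }

    at-Between : ∀ {i j k} → k ≤ len p → j ≤ len p → Between i j (at p k) → i ≤ k × k ≤ j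
    at-Between k≤ j≤ (m , i≤m , m≤j , e) with refl ← at-inj p u (ℕ.≤-trans m≤j j≤) k≤ e = i≤m , m≤j

  -- The final configuration: `p` is divided after position `α` between two ears, each running
  -- against the direction of `p`. Hence `v` has edges to `α` and `len p`, the upper ends of the
  -- parts, and from `0` and `α + 1`, the lower ends. Only the upper part is assumed to consist of
  -- digons.
  module Shape {f l : V} (p : Walk R f l) (u : Unique (vertices p)) (p⊆ : ∀ {x} → x ∈ vertices p → Without v x) (closing : R l f)
               (α : ℕ) (1+α<L : suc α < len p)
               (v→α : R v (at p α)) (0→v : R (at p 0) v) (v→L : R v (at p (len p))) (β→v : R (at p (suc α)) v)
               (rungs : ∀ {k} → suc α ≤ k → k < len p → R (at p (suc k)) (at p k)) where

    open Segments p
    open Ladder p u p⊆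

    private
      L = len p
      α<L = ℕ.<⇒≤ 1+α<L
      α≤L = ℕ.<⇒≤ α<L

      ends : ∀ {x y w z : V} → z ∈ x ∷ y ∷ w ∷ [] ⊎ z ∈ w ∷ x ∷ [] → z ≡ x ⊎ z ≡ y ⊎ z ≡ w
      ends (inj₁ (here e)) = inj₁ e
      ends (inj₁ (there (here e))) = inj₂ (inj₁ e)
      ends (inj₁ (there (there (here e)))) = inj₂ (inj₂ e)
      ends (inj₂ (here e)) = inj₂ (inj₂ e)
      ends (inj₂ (there (here e))) = inj₁ e

      at≢v : ∀ {i} → at p i ≢ v
      at≢v {i} = proj₂ (p⊆ (at∈ p i))

      at≢at : ∀ {i j} → i ≤ L → j ≤ L → i < j → at p i ≢ at p j
      at≢at i≤ j≤ i<j e = ℕ.<⇒≢ i<j (at-inj p u i≤ j≤ e)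

    α→β : R (at p α) (at p (suc α))
    α→β = Follows⇒ (at-Follows p α<L)

    L→0 : R (at p L) (at p 0)
    L→0 = subst₂ R (sym (at-len p)) (sym (at-0 p)) closing

    two-triangles : 0 < α → Bad
    two-triangles 0<α = pinned (proj₁ (p⊆ (at∈ p 0))) v record
      { A = λ x → x ∈ vertices w₁ ⊎ x ∈ vertices w₂ ; strA = Str-closed w₁ w₂
      ; B = λ x → x ∈ vertices w₃ ⊎ x ∈ vertices w₄ ; strB = Str-closed w₃ w₄
      ; strC = Str-avoid (λ m → ℕ.<⇒≱ (s≤s z≤n) (proj₁ (at-Between z≤n ℕ.≤-refl m))) (ladder ℕ.≤-refl rungs)
      ; AB = v , inj₁ (here refl) , inj₁ (here refl)
      ; BC = at p L , inj₁ (there (here refl)) , (L , α<L , ℕ.≤-refl , refl)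
      ; CA = at p (suc α) , (suc α , ℕ.≤-refl , α<L , refl) , inj₂ (here refl)
      ; none = λ a b c → none (ends a) (ends b) c }
      where
      O = Out (at p 0) v
      w₁ : Walk O v (at p (suc α))
      w₁ = (v→α , λ e → contradiction (sym e) at≢v) ◅ (α→β , λ e → contradiction (sym e) (at≢at z≤n α≤L 0<α)) ◅ ε
      w₂ : Walk O (at p (suc α)) v
      w₂ = (β→v , λ _ → refl) ◅ ε
      w₃ : Walk O v (at p 0)
      w₃ = (v→L , λ e → contradiction (sym e) at≢v) ◅
           (L→0 , λ e → contradiction (sym e) (at≢at z≤n ℕ.≤-refl (ℕ.≤-trans (s≤s z≤n) α<L))) ◅ ε
      w₄ : Walk O (at p 0) v
      w₄ = (0→v , λ _ → refl) ◅ ε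
      none : ∀ {x} → x ≡ v ⊎ x ≡ at p α ⊎ x ≡ at p (suc α) → x ≡ v ⊎ x ≡ at p L ⊎ x ≡ at p 0 → Between (suc α) L x → ⊥
      none (inj₁ refl) _ c = proj₂ (Between-≢v c) refl
      none (inj₂ (inj₁ refl)) _ c = ℕ.<-irrefl refl (proj₁ (at-Between α≤L ℕ.≤-refl c))
      none (inj₂ (inj₂ refl)) (inj₁ e) _ = at≢v e
      none (inj₂ (inj₂ refl)) (inj₂ (inj₁ e)) _ = at≢at α<L ℕ.≤-refl 1+α<L e
      none (inj₂ (inj₂ refl)) (inj₂ (inj₂ e)) _ = at≢at z≤n α<L (s≤s z≤n) (sym e)

    long-ladder : α ≡ 0 → 2 < L → Bad
    long-ladder refl 2<L = pinned Av (at p L) record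
      { A = λ x → x ∈ vertices w₁ ⊎ x ∈ vertices w₂ ; strA = Str-closed w₁ w₂
      ; strB = Str-avoid (λ c → proj₂ (Between-≢v c) refl) (ladder ℕ.≤-refl (λ 2≤k k< → rungs (ℕ.<⇒≤ 2≤k) k<))
      ; strC = Str-avoid (λ c → proj₂ (Between-≢v c) refl) (ladder {1} {2} 2≤L (λ 1≤k k<2 → rungs 1≤k (ℕ.<-≤-trans k<2 2≤L)))
      ; AB = at p L , inj₁ (there (here refl)) , (L , 2≤L , ℕ.≤-refl , refl)
      ; BC = at p 2 , (2 , ℕ.≤-refl , 2≤L , refl) , (2 , s≤s z≤n , ℕ.≤-refl , refl)
      ; CA = at p 1 , (1 , ℕ.≤-refl , s≤s z≤n , refl) , inj₂ (here refl)
      ; none = none }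
      where
      2≤L = ℕ.<⇒≤ 2<L
      O = Out v (at p L)
      w₁ : Walk O v (at p 1)
      w₁ = (v→L , λ _ → refl) ◅ (L→0 , λ e → contradiction e at≢v) ◅ (α→β , λ e → contradiction e at≢v) ◅ ε
      w₂ : Walk O (at p 1) v
      w₂ = (β→v , λ e → contradiction e at≢v) ◅ ε
      on : ∀ {x} → x ∈ vertices w₁ ⊎ x ∈ vertices w₂ → x ≡ v ⊎ x ≡ at p L ⊎ x ≡ at p 0 ⊎ x ≡ at p 1
      on (inj₁ (here e)) = inj₁ e
      on (inj₁ (there (here e))) = inj₂ (inj₁ e)
      on (inj₁ (there (there (here e)))) = inj₂ (inj₂ (inj₁ e))
      on (inj₁ (there (there (there (here e))))) = inj₂ (inj₂ (inj₂ e))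
      on (inj₂ (here e)) = inj₂ (inj₂ (inj₂ e))
      on (inj₂ (there (here e))) = inj₁ e
      none : ∀ {x} → x ∈ vertices w₁ ⊎ x ∈ vertices w₂ → Between 2 L x → Between 1 2 x → ⊥
      none i b c with on i
      ... | inj₁ refl = proj₂ (Between-≢v b) refl
      ... | inj₂ (inj₁ refl) = ℕ.<⇒≱ 2<L (proj₂ (at-Between ℕ.≤-refl 2≤L c))
      ... | inj₂ (inj₂ (inj₁ refl)) = ℕ.<⇒≱ (s≤s z≤n) (proj₁ (at-Between z≤n ℕ.≤-refl b))
      ... | inj₂ (inj₂ (inj₂ refl)) = ℕ.<⇒≱ (s≤s (s≤s z≤n)) (proj₁ (at-Between (ℕ.<⇒≤ 1+α<L) ℕ.≤-refl b))

    -- The four-cycle of `A₄` runs through `v` and the positions 2, 0, 1; its digons join `v` to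
    -- position 0 and position 2 to position 1.
    A₄-found : α ≡ 0 → 2 ≡ L → Bad
    A₄-found refl 2≡L = A₄Bad (g , (λ {i} {j} → g-inj i j) , λ {i} {j} → g-edge i j)
      where
      0≤L : 0 ≤ L
      0≤L = z≤n
      1≤L = ℕ.<⇒≤ 1+α<L
      2≤L = ℕ.≤-reflexive 2≡L
      g : Fin 4 → V
      g 0F = v
      g 1F = at p 2
      g 2F = at p 0
      g 3F = at p 1
      g-inj : ∀ i j → g i ≡ g j → i ≡ j
      g-inj 0F 0F _ = refl
      g-inj 0F 1F e = contradiction (sym e) at≢v
      g-inj 0F 2F e = contradiction (sym e) at≢v
      g-inj 0F 3F e = contradiction (sym e) at≢v
      g-inj 1F 0F e = contradiction e at≢v
      g-inj 1F 1F _ = refl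
      g-inj 1F 2F e = contradiction (sym e) (at≢at 0≤L 2≤L (s≤s z≤n))
      g-inj 1F 3F e = contradiction (sym e) (at≢at 1≤L 2≤L (s≤s (s≤s z≤n)))
      g-inj 2F 0F e = contradiction e at≢v
      g-inj 2F 1F e = contradiction e (at≢at 0≤L 2≤L (s≤s z≤n))
      g-inj 2F 2F _ = refl
      g-inj 2F 3F e = contradiction e (at≢at 0≤L 1≤L (s≤s z≤n))
      g-inj 3F 0F e = contradiction e at≢v
      g-inj 3F 1F e = contradiction e (at≢at 1≤L 2≤L (s≤s (s≤s z≤n)))
      g-inj 3F 2F e = contradiction (sym e) (at≢at 0≤L 1≤L (s≤s z≤n))
      g-inj 3F 3F _ = refl
      g-edge : ∀ i j → Edge A₄ i j → R (g i) (g j)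
      g-edge 0F 1F _ = subst (λ k → R v (at p k)) (sym 2≡L) v→L
      g-edge 1F 2F _ = subst (λ k → R (at p k) (at p 0)) (sym 2≡L) L→0
      g-edge 2F 3F _ = α→β
      g-edge 3F 0F _ = β→v
      g-edge 0F 2F _ = v→α
      g-edge 2F 0F _ = 0→v
      g-edge 1F 3F _ = rungs ℕ.≤-refl 1+α<L
      g-edge 3F 1F _ = Follows⇒ (at-Follows p 1+α<L)

    shape : Bad
    shape with ℕ.m≤n⇒m<n∨m≡n (z≤n {α})
    ... | inj₁ 0<α = two-triangles 0<α
    ... | inj₂ refl with ℕ.m≤n⇒m<n∨m≡n 1+α<L
    ...   | inj₁ 2<L = long-ladder refl 2<L
    ...   | inj₂ 2≡L = A₄-found refl 2≡L

  -- The vertices of the ear Z occupy the positions lo … hi of p and are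
  -- traversed backwards.

  record Span {f l : V} (p : Walk R f l) (Z : Ear) : Set where
    field
      {hi lo} : ℕ
      hi≤     : hi ≤ len p
      lo≤     : lo ≤ len p
      at-hi   : at p hi ≡ Ear.s Z
      at-lo   : at p lo ≡ Ear.t Z
      lo≤hi   : lo ≤ hi
      span⁺   : ∀ {k} → lo ≤ k → k ≤ hi → at p k ∈ Ear.inner Z
      span⁻   : ∀ {k} → k ≤ len p → at p k ∈ Ear.inner Z → lo ≤ k × k ≤ hi
      rungs   : ∀ {k} → lo ≤ k → k < hi → R (at p (suc k)) (at p k)

  -- X carries the positions 0 … α of the rotated cycle F, and Y the
  -- positions α + 1 … len p.

  module TwoSpans (X Y : Ear) (apart : Apart (Ear.inner X) (Ear.inner Y))
                  {f l : V} (p : Walk R f l) (u : Unique (vertices p)) (closing : R l f)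
                  (p⊆ : ∀ {x} → x ∈ vertices p → Without v x) (f∈X : f ∈ Ear.inner X) (l∈Y : l ∈ Ear.inner Y)
                  (p⊆X∪Y : ∀ {x} → x ∈ vertices p → x ∈ Ear.inner X ⊎ x ∈ Ear.inner Y)
                  (sY≢tY : Ear.s Y ≢ Ear.t Y) (sx : Span p X) (sy : Span p Y) where

    private
      L = len p
      module X = Span sx
      module Y = Span sy

    loX≡0 : X.lo ≡ 0
    loX≡0 = ℕ.n≤0⇒n≡0 (proj₁ (X.span⁻ z≤n (subst (_∈ Ear.inner X) (sym (at-0 p)) f∈X)))
    L∈Y : at p L ∈ Ear.inner Y
    L∈Y = subst (_∈ Ear.inner Y) (sym (at-len p)) l∈Y
    hiY≡L : Y.hi ≡ L
    hiY≡L = ℕ.≤-antisym Y.hi≤ (proj₂ (Y.span⁻ ℕ.≤-refl L∈Y))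
    α<L : X.hi < L
    α<L with ℕ.m≤n⇒m<n∨m≡n X.hi≤
    ... | inj₁ lt = lt
    ... | inj₂ eq = contradiction L∈Y (apart (subst (λ k → at p k ∈ Ear.inner X) eq (X.span⁺ X.lo≤hi ℕ.≤-refl)))
    β≤ : Y.lo ≤ suc X.hi
    β≤ with p⊆X∪Y (at∈ p (suc X.hi))
    ... | inj₁ m = contradiction (proj₂ (X.span⁻ α<L m)) (ℕ.<⇒≱ (ℕ.n<1+n _))
    ... | inj₂ m = proj₁ (Y.span⁻ α<L m)
    β≡ : Y.lo ≡ suc X.hi
    β≡ with ℕ.m≤n⇒m<n∨m≡n β≤
    ... | inj₂ eq = eq
    ... | inj₁ (s≤s lo≤α) = contradiction (Y.span⁺ lo≤α (subst (X.hi ≤_) (sym hiY≡L) X.hi≤)) (apart (X.span⁺ X.lo≤hi ℕ.≤-refl))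
    at-β : at p (suc X.hi) ≡ Ear.t Y
    at-β = trans (cong (at p) (sym β≡)) Y.at-lo
    at-L : at p L ≡ Ear.s Y
    at-L = trans (cong (at p) (sym hiY≡L)) Y.at-hi
    -- This is where `Y` must not be a digon: otherwise its part of `p` could be a single position.
    1+α<L : suc X.hi < L
    1+α<L with ℕ.m≤n⇒m<n∨m≡n α<L
    ... | inj₁ lt = lt
    ... | inj₂ eq = contradiction (trans (sym at-L) (trans (cong (at p) (sym eq)) at-β)) sY≢tY

    two-spans : Bad
    two-spans = Shape.shape p u p⊆ closing X.hi 1+α<L
      (subst (R v) (sym X.at-hi) (Ear.enter X))
      (subst (λ x → R x v) (sym (trans (cong (at p) (sym loX≡0)) X.at-lo)) (Ear.exit X))
      (subst (R v) (sym at-L) (Ear.enter Y))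
      (subst (λ x → R x v) (sym at-β) (Ear.exit Y))
      (λ α<k k<L → Y.rungs (ℕ.≤-trans (ℕ.≤-reflexive β≡) α<k) (subst (_ <_) (sym hiY≡L) k<L))

  module Positions (X Y : Ear) (apart : Apart (Ear.inner X) (Ear.inner Y))
                   {f l : V} (p : Walk R f l) (u : Unique (vertices p)) (closing : R l f)
                   (p⊆ : ∀ {x} → x ∈ vertices p → Without v x) (f∈X : f ∈ Ear.inner X) (l∈Y : l ∈ Ear.inner Y)
                   (X⊆p : ∀ {x} → x ∈ Ear.inner X → x ∈ vertices p) (Y⊆p : ∀ {x} → x ∈ Ear.inner Y → x ∈ vertices p)
                   (p⊆X∪Y : ∀ {x} → x ∈ vertices p → x ∈ Ear.inner X ⊎ x ∈ Ear.inner Y) where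

    open Segments p
    open Ladder p u p⊆

    L = len p

    same-at : ∀ {i j} → i ≤ L → j ≤ L → at p i ≡ at p j → i ≡ j
    same-at = at-inj p u

    forward : ∀ {i j k z} → j ≤ L → k ≤ L → ¬ (i ≤ k × k < j) → Forward i j ⇒ Out (at p k) z
    forward j≤ k≤ ¬in F@(m , i≤m , m<j , e , _) = Follows⇒ (Forward⇒ j≤ F) ,
      λ e′ → contradiction (subst (λ k → _ ≤ k × k < _) (same-at (ℕ.≤-trans (ℕ.<⇒≤ m<j) j≤) k≤ (trans e e′)) (i≤m , m<j)) ¬in

    Block : Ear → Rel V 0ℓ
    Block Z s t = R s t × ∃₂ λ i j → at p i ≡ s × at p j ≡ t × i ≤ L × j ≤ L × (∀ {k} → j ≤ k → k ≤ i → at p k ∈ Ear.inner Z)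

    module Side (Z W : Ear) (ap : Apart (Ear.inner Z) (Ear.inner W))
                (Z⊆p : ∀ {x} → x ∈ Ear.inner Z → x ∈ vertices p)
                (p⊆Z∪W : ∀ {x} → x ∈ vertices p → x ∈ Ear.inner Z ⊎ x ∈ Ear.inner W)
                (f∨l : f ∈ Ear.inner W ⊎ l ∈ Ear.inner W) where

      jump : ∀ {s t} {G : Pred V 0ℓ} {d} → Follows (Ear.path Z) s t → Str (Out s t) G → (∀ {x} → G x → Without v x) →
             G s → G d → d ∈ Ear.inner W → Bad
      jump f sG G⊆ Gs Gd d∈W = crossing-Obs Z W ap (proj₁ (Ear.inside Z s∈)) (along Z W ap Z f) (avoid-Y Z W ap s∈) sG G⊆ Gs s∈ Gd d∈W
        where s∈ = Follows-source f

      -- The edge s → t of Z together with the part of the cycle F leading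
      -- from t back to s is a cycle leaving s only towards t; so that
      -- part cannot meet W.

      wrap : ∀ {i j} → i < j → j ≤ L → Follows (Ear.path Z) (at p i) (at p j) → Bad
      wrap {i} {j} i<j j≤ F = jump F (Str-mono step (Str-closed w₁ w₂)) G⊆ (inj₁ (middle∈ opening rest)) (proj₂ (proj₂ meetsW)) (proj₁ (proj₂ meetsW))
        where
        i≤ = ℕ.≤-trans (ℕ.<⇒≤ i<j) j≤
        O = Out (at p i) (at p j) ⇂ (_∈ vertices p)
        on-p : ∀ {i j x} → Between i j x → x ∈ vertices p
        on-p (k , _ , _ , refl) = at∈ p k
        opening : Walk O f (at p i)
        opening = subst (λ x → Walk O x (at p i)) (at-0 p) (Star.map (⇂-mono (forward i≤ i≤ (λ (_ , k) → ℕ.<-irrefl refl k)) on-p) (segment z≤n))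
        rest : Walk O (at p i) l
        rest = within (at∈ p i) (at∈ p j) (step (Follows⇒ F) , λ _ → refl) ◅
               subst (Walk O (at p j)) (at-len p) (Star.map (⇂-mono (forward ℕ.≤-refl i≤ (λ (k , _) → ℕ.<⇒≱ i<j k)) on-p) (segment j≤))
        w₁ : Walk O f l
        w₁ = opening ◅◅ rest
        w₂ : Walk O l f
        w₂ = within (last∈ p) (first∈ p) (closing , λ e → contradiction (same-at ℕ.≤-refl i≤ (trans (at-len p) e)) (ℕ.<⇒≢ (ℕ.<-≤-trans i<j j≤) ∘ sym)) ◅ ε
        G⊆ : ∀ {x} → x ∈ vertices w₁ ⊎ x ∈ vertices w₂ → Without v x
        G⊆ (inj₁ m) = p⊆ (stays w₁ (first∈ p) m)
        G⊆ (inj₂ m) = p⊆ (stays w₂ (last∈ p) m)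
        meetsW : ∃ λ d → d ∈ Ear.inner W × (d ∈ vertices w₁ ⊎ d ∈ vertices w₂)
        meetsW = [ (λ f∈W → f , f∈W , inj₁ (first∈ w₁)) , (λ l∈W → l , l∈W , inj₁ (last∈ w₁)) ]′ f∨l

      -- The stretch of `p` from `j` to `i` and the edge of `Z` from `i` back to `j` form a cycle.
      -- It meets `W` and leaves its top vertex by the same edge as `Z`.
      inner-arc : ∀ {i j k} → j < i → i ≤ L → j ≤ k → k ≤ i → at p k ∈ Ear.inner W → Follows (Ear.path Z) (at p i) (at p j) → Bad
      inner-arc {i} {j} {k} j<i i≤ j≤k k≤i ∈W F =
        jump F (Str-mono step (Str-closed w₁ w₂)) G⊆ (inj₁ (last∈ w₁)) (inj₁ at-k) ∈W
        where
        O = Out (at p i) (at p j) ⇂ Between j i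
        arc : ∀ {a b} → a ≤ b → j ≤ a → b ≤ i → Walk O (at p a) (at p b)
        arc a≤b j≤a b≤i = Star.map (⇂-mono (forward (ℕ.≤-trans b≤i i≤) i≤ (λ (_ , i<b) → ℕ.<⇒≱ i<b b≤i))
                                           (λ (m , q , r , e) → m , ℕ.≤-trans j≤a q , ℕ.≤-trans r b≤i , e)) (segment a≤b)
        w₁ : Walk O (at p j) (at p i)
        w₁ = arc j≤k ℕ.≤-refl k≤i ◅◅ arc k≤i j≤k ℕ.≤-refl
        w₂ : Walk O (at p i) (at p j)
        w₂ = within (i , ℕ.<⇒≤ j<i , ℕ.≤-refl , refl) (j , ℕ.≤-refl , ℕ.<⇒≤ j<i , refl) (step (Follows⇒ F) , λ _ → refl) ◅ ε
        at-k : at p k ∈ vertices w₁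
        at-k = middle∈ (arc j≤k ℕ.≤-refl k≤i) (arc k≤i j≤k ℕ.≤-refl)
        G⊆ : ∀ {x} → x ∈ vertices w₁ ⊎ x ∈ vertices w₂ → Without v x
        G⊆ (inj₁ m) = Between-≢v (stays w₁ (j , ℕ.≤-refl , ℕ.<⇒≤ j<i , refl) m)
        G⊆ (inj₂ m) = Between-≢v (stays w₂ (i , ℕ.<⇒≤ j<i , ℕ.≤-refl , refl) m)

      -- A step of `Z` forward along `p` is excluded by `wrap`, and a step back over a vertex of `W`
      -- by `inner-arc`. The remaining steps go back over vertices of `Z` only.
      backwards : ∀ {s t} → Follows (Ear.path Z) s t → Bad ⊎ Backward (Block Z) s t
      backwards {s} {t} F with position p (Z⊆p (Follows-source F)) | position p (Z⊆p (Follows-target F))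
      ... | i , i≤ , refl | j , j≤ , refl with ℕ.<-cmp i j
      ...   | tri< i<j _ _ = inj₁ (wrap i<j j≤ F)
      ...   | tri≈ _ refl _ = contradiction (step (Follows⇒ F)) irr
      ...   | tri> _ _ j<i with any? (λ (m : Fin (suc L)) → (j ℕ.≤? toℕ m) ×-dec ((toℕ m ℕ.≤? i) ×-dec (at p (toℕ m) ∈? Ear.inner W)))
      ...     | yes (m , j≤m , m≤i , ∈W) = inj₁ (inner-arc j<i i≤ j≤m m≤i ∈W F)
      ...     | no none = inj₂ ((step (Follows⇒ F) , i , j , refl , refl , i≤ , j≤ , block) , i , j , refl , refl , j<i , i≤)
        where
        block : ∀ {k} → j ≤ k → k ≤ i → at p k ∈ Ear.inner Z
        block {k} j≤k k≤i with p⊆Z∪W (at∈ p k)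
        ... | inj₁ m = m
        ... | inj₂ m = contradiction (fromℕ< k< , subst (λ k → j ≤ k × k ≤ i × at p k ∈ Ear.inner W) (sym (toℕ-fromℕ< k<)) (j≤k , k≤i , m)) none
          where
          k< : k < suc L
          k< = s≤s (ℕ.≤-trans k≤i i≤)

      lower : ∀ {i j k a b} (q : Walk (Backward (Block Z)) a b) → at p i ≡ a → i ≤ L → at p j ≡ b → j ≤ L → at p k ∈ vertices q → k ≤ L → j ≤ k
      lower ε refl i≤ e j≤ (here e′) k≤ = ℕ.≤-reflexive (same-at j≤ k≤ (trans e (sym e′)))
      lower q@(_ ◅ _) refl i≤ refl j≤ (here e′) k≤ with refl ← same-at k≤ i≤ e′ = backward-≤ u q refl i≤ (last∈ q) j≤
      lower ((_ , i′ , m , a , b , m<i , i′≤) ◅ q) refl i≤ refl j≤ (there h) k≤ = lower q b (ℕ.≤-trans (ℕ.<⇒≤ m<i) i′≤) refl j≤ h k≤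

      covers : ∀ {i j k a b} (q : Walk (Backward (Block Z)) a b) → at p i ≡ a → i ≤ L → at p j ≡ b → j ≤ L → a ∈ Ear.inner Z → j ≤ k → k ≤ i → at p k ∈ Ear.inner Z
      covers ε refl i≤ e j≤ a∈ j≤k k≤i with refl ← same-at j≤ i≤ e with refl ← ℕ.≤-antisym j≤k k≤i = a∈
      covers {k = k} (((_ , i₁ , m₁ , a₁ , b₁ , i₁≤ , m₁≤ , block) , i′ , m , a , b , m<i , i′≤) ◅ q) refl i≤ e j≤ a∈ j≤k k≤i
        with refl ← same-at i₁≤ i≤ a₁ | refl ← same-at m₁≤ (ℕ.≤-trans (ℕ.<⇒≤ m<i) i′≤) (trans b₁ (sym b)) with m₁ ℕ.≤? k
      ... | yes m≤k = block m≤k k≤i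
      ... | no m≰k = covers q b m₁≤ e j≤ (subst (_∈ Ear.inner Z) b₁ (block ℕ.≤-refl (ℕ.<⇒≤ (subst (m₁ <_) (same-at i′≤ i≤ a) m<i)))) j≤k (ℕ.<⇒≤ (ℕ.≰⇒> m≰k))

      span : Bad ⊎ Span p Z
      span with traverse backwards (retrace (Ear.path Z)) | position p (Z⊆p (Ear.s∈ Z)) | position p (Z⊆p (Ear.t∈ Z))
      ... | inj₁ bad | _ | _ = inj₁ bad
      ... | inj₂ (q , eq) | hi , hi≤ , at-hi | lo , lo≤ , at-lo = inj₂ record
        { hi≤ = hi≤ ; lo≤ = lo≤ ; at-hi = at-hi ; at-lo = at-lo
        ; lo≤hi = proj₂ (bounds lo≤ (subst (_∈ vertices q) (sym at-lo) (last∈ q)))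
        ; span⁺ = covering
        ; span⁻ = λ k≤ k∈ → bounds k≤ (onto k∈)
        ; rungs = λ lo≤k k<hi → proj₁ (unit-steps u q at-hi hi≤ at-lo lo≤ (λ j≤k k≤i → onto (covering j≤k k≤i)) lo≤k k<hi) }
        where
        onto : ∀ {x} → x ∈ Ear.inner Z → x ∈ vertices q
        onto = subst (_ ∈_) (sym (trans eq (vertices-retrace (Ear.path Z))))
        bounds : ∀ {k} → k ≤ L → at p k ∈ vertices q → lo ≤ k × k ≤ hi
        bounds k≤ m = lower q at-hi hi≤ at-lo lo≤ m k≤ , backward-≤ u q at-hi hi≤ m k≤
        covering : ∀ {k} → lo ≤ k → k ≤ hi → at p k ∈ Ear.inner Z
        covering = covers q at-hi hi≤ at-lo lo≤ (Ear.s∈ Z)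

    positions : Ear.s Y ≢ Ear.t Y → Bad
    positions sY≢tY = [ id , (λ sx → [ id , (λ sy → TwoSpans.two-spans X Y apart p u closing p⊆ f∈X l∈Y p⊆X∪Y sY≢tY sx sy) ]′
                                       (Side.span Y X (λ i j → apart j i) Y⊆p (swap ∘ p⊆X∪Y) (inj₁ f∈X))) ]′
                      (Side.span X Y apart X⊆p p⊆X∪Y (inj₂ l∈Y))

  module _ (X Y : Ear) (apart : Apart (Ear.inner X) (Ear.inner Y)) (k : Crossing X Y) (sY≢tY : Ear.s Y ≢ Ear.t Y) where

    open Crossing k

    rotated-crossing : (∀ {x} → x ∈ Ear.inner X → x ∈ cycleVertices F) → (∀ {x} → x ∈ Ear.inner Y → x ∈ cycleVertices F) →
                       (∀ {x} → x ∈ cycleVertices F → x ∈ Ear.inner X ⊎ x ∈ Ear.inner Y) →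
                       Rotate.Rotated (_∈? Ear.inner X) F → Bad
    rotated-crossing X⊆ Y⊆ F⊆∪ (F′ , first∈X , last∉X , to , from) =
      Positions.positions X Y apart walk distinct closing (λ i → F⊆ (from i)) first∈X
        ([ (λ m → contradiction m last∉X) , id ]′ (F⊆∪ (from (last∈ walk)))) (λ i → to (X⊆ i)) (λ i → to (Y⊆ i)) (λ i → F⊆∪ (from i)) sY≢tY
      where open Cycle F′ using (walk; distinct; closing)

    covered-crossing : Bad ⊎ (∀ {x} → x ∈ Ear.inner X → x ∈ cycleVertices F) → Bad ⊎ (∀ {x} → x ∈ Ear.inner Y → x ∈ cycleVertices F) →
                       Bad ⊎ (∀ {x} → x ∈ cycleVertices F → x ∈ Ear.inner X ⊎ x ∈ Ear.inner Y) → Bad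
    covered-crossing (inj₁ bad) _ _ = bad
    covered-crossing _ (inj₁ bad) _ = bad
    covered-crossing _ _ (inj₁ bad) = bad
    covered-crossing (inj₂ X⊆) (inj₂ Y⊆) (inj₂ F⊆∪) =
      rotated-crossing X⊆ Y⊆ F⊆∪ (Rotate.rotate (_∈? Ear.inner X) F c∈F c∈X d∈F (λ d∈X → apart d∈X d∈Y))

    crossing : Bad
    crossing = covered-crossing (X⊆F X Y apart k) (X⊆F Y X (λ i j → apart j i) (swap-crossing k)) (F⊆X∪Y X Y apart k)

  module _ (X Y : Ear) (apart : Apart (Ear.inner X) (Ear.inner Y)) where

    private
      apart′ : Apart (Ear.inner Y) (Ear.inner X)
      apart′ i j = apart j i

      digons : Ear.s X ≡ Ear.t X → Ear.s Y ≡ Ear.t Y → Bad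
      digons eX eY = two-digons (Ear.enter X) (subst (λ x → R x v) (sym eX) (Ear.exit X))
                                (Ear.enter Y) (subst (λ x → R x v) (sym eY) (Ear.exit Y))
                                (λ e → apart (Ear.s∈ X) (subst (_∈ Ear.inner Y) (sym e) (Ear.s∈ Y)))

      crossed : Crossing X Y → Dec (Ear.s X ≡ Ear.t X) → Dec (Ear.s Y ≡ Ear.t Y) → Bad
      crossed k _ (no ≢) = crossing X Y apart k ≢
      crossed k (no ≢) _ = crossing Y X apart′ (swap-crossing k) ≢
      crossed k (yes eX) (yes eY) = digons eX eY

      -- A crossing is symmetric, so an ear that is not a digon can take the role of `Y`. Two
      -- detours, one from either side, make both ears digons.
      connected : Crossing X Y ⊎ Detour X Y → Crossing Y X ⊎ Detour Y X → Bad
      connected (inj₁ k) _ = crossed k (Ear.s X ≟ Ear.t X) (Ear.s Y ≟ Ear.t Y)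
      connected _ (inj₁ k) = crossed (swap-crossing k) (Ear.s X ≟ Ear.t X) (Ear.s Y ≟ Ear.t Y)
      connected (inj₂ k) (inj₂ k′) = [ id , (λ eX → [ id , digons eX ]′ (detour-digon Y X apart′ k′)) ]′ (detour-digon X Y apart k)

    figureEight-Bad : Bad
    figureEight-Bad = connected (connect X Y apart) (connect Y X apart′)

  private
    fromFigureEight : Ears.FigureEight tc v → Bad
    fromFigureEight e = figureEight-Bad C C′ apart
      where open Ears.FigureEight e

  twoConnected-Bad : Bad
  twoConnected-Bad = fromFigureEight (figureEight v Av)

-- Gluing at a cut vertex

module _ {n : ℕ} where

  private V = Fin n

  Bad : Rel V 0ℓ → Set₁
  Bad R = ∃ λ R′ → R′ ≼ R × ((∃₂ λ ℓ (3≤ℓ : 3 ≤ ℓ) → Embeds (bicycle ℓ 3≤ℓ) R′) ⊎ Embeds A₄ R′)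

  Bad-≼ : ∀ {R R′} → R′ ≼ R → Bad R′ → Bad R
  Bad-≼ s (R″ , t , h) = R″ , ≼-trans t s , h

  Contracted : Pred V 0ℓ → V → Rel V 0ℓ → Rel V 0ℓ
  Contracted Y y R a b = ¬ Y a × ¬ Y b × a ≢ b × (R a b ⊎ (b ≡ y × ∃ λ c → Y c × R a c))

  -- Take `w` in `Y` with an edge to `y`, drop its other outgoing edges and absorb it. Nothing of
  -- `Contracted` is lost, as no edge leaving `Y` occurs there, and walks of `Y` that used to pass
  -- through `w` now arrive at `y` sooner.
  Contracted-≼ : ∀ {Y y R} → Decidable₁ Y → Decidable R → (∀ {x} → ¬ R x x) → ¬ Y y →
                 (∀ {c d} → Y c → R c d → Y d ⊎ d ≡ y) → (∀ {c} → Y c → Walk R c y) → Contracted Y y R ≼ R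
  Contracted-≼ {Y} {y} {R} Y? R? irr ¬Yy closed reach = go Y? R? irr ¬Yy closed reach (<-wellFounded _)
    where
    go : ∀ {Y R} (Y? : Decidable₁ Y) → Decidable R → (∀ {x} → ¬ R x x) → ¬ Y y →
         (∀ {c d} → Y c → R c d → Y d ⊎ d ≡ y) → (∀ {c} → Y c → Walk R c y) →
         Acc _<_ (count Y? (allFin n)) → Contracted Y y R ≼ R
    go {Y} {R} Y? R? irr ¬Yy closed reach (acc rs) with any? Y?
    ... | no none = delete λ { (_ , _ , _ , inj₁ e) → e ; (_ , _ , _ , inj₂ (_ , c , Yc , _)) → contradiction (c , Yc) none }
    ... | yes (c₀ , Yc₀) = absorbing (entry (reach Yc₀) Yc₀)
      where
      entry : ∀ {c} → Walk R c y → Y c → ∃ λ w → Y w × R w y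
      entry ε Yc = contradiction Yc ¬Yy
      entry (e ◅ w) Yc with closed Yc e
      ... | inj₁ Yd = entry w Yd
      ... | inj₂ refl = _ , Yc , e
      absorbing : (∃ λ w → Y w × R w y) → Contracted Y y R ≼ R
      absorbing (w , Yw , wy) = ≼-trans (≼-trans (delete larger) (go Y₁? R₁? irr₁ (¬Yy ∘ proj₁) closed₁ reach₁ (rs smaller))) (absorb absorbs)
        where
        Y₁ : Pred V 0ℓ
        Y₁ x = Y x × x ≢ w
        Y₁? : Decidable₁ Y₁
        Y₁? x = Y? x ×-dec ¬? (x ≟ w)
        smaller = count-< Y₁? Y? proj₁ (∈-allFin w) Yw λ (_ , w≢w) → w≢w refl
        R₁ : Rel V 0ℓ
        R₁ a b = a ≢ w × b ≢ w × a ≢ b × (R a b ⊎ (b ≡ y × R a w))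
        R₁? : Decidable R₁
        R₁? a b = ¬? (a ≟ w) ×-dec (¬? (b ≟ w) ×-dec (¬? (a ≟ b) ×-dec (R? a b ⊎-dec ((b ≟ y) ×-dec R? a w))))
        w≢y : w ≢ y
        w≢y refl = ¬Yy Yw
        irr₁ : ∀ {x} → ¬ R₁ x x
        irr₁ (_ , _ , x≢x , _) = x≢x refl
        absorbs : Absorbs R R₁
        absorbs = record
          { w≢y = w≢y
          ; R⁻ = λ a b → R a b × (a ≡ w → b ≡ y)
          ; R⁻? = λ a b → R? a b ×-dec ((a ≟ w) →-dec (b ≟ y))
          ; R⁻⊆R = proj₁
          ; only = inj₁ ((wy , λ _ → refl) , λ (_ , h) → h refl)
          ; edge = λ { (a≢w , b≢w , a≢b , inj₁ e) → a≢w , b≢w , a≢b , inj₁ (e , λ p → contradiction p a≢w)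
                     ; (a≢w , b≢w , a≢b , inj₂ (p , e)) → a≢w , b≢w , a≢b , inj₂ (inj₁ (p , e , λ p → contradiction p a≢w)) } }
        closed₁ : ∀ {c d} → Y₁ c → R₁ c d → Y₁ d ⊎ d ≡ y
        closed₁ _ (_ , _ , _ , inj₂ (p , _)) = inj₂ p
        closed₁ (Yc , _) (_ , d≢w , _ , inj₁ e) with closed Yc e
        ... | inj₁ Yd = inj₁ (Yd , d≢w)
        ... | inj₂ p = inj₂ p
        Y≢y : ∀ {c} → Y c → c ≢ y
        Y≢y Yc refl = ¬Yy Yc
        reach₁′ : ∀ {c} → Walk R c y → Y c → c ≢ w → Walk R₁ c y
        reach₁′ ε Yc _ = contradiction Yc ¬Yy
        reach₁′ {c} (_◅_ {j = d} e p) Yc c≢w with d ≟ w | closed Yc e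
        ... | yes refl | _ = (c≢w , w≢y ∘ sym , Y≢y Yc , inj₂ (refl , e)) ◅ ε
        ... | no d≢w | inj₂ refl = (c≢w , d≢w , Y≢y Yc , inj₁ e) ◅ ε
        ... | no d≢w | inj₁ Yd = (c≢w , d≢w , (λ { refl → irr e }) , inj₁ e) ◅ reach₁′ p Yd d≢w
        reach₁ : ∀ {c} → Y₁ c → Walk R₁ c y
        reach₁ (Yc , c≢w) = reach₁′ (reach Yc) Yc c≢w
        larger : Contracted Y y R ⇒ Contracted Y₁ y R₁
        larger {a} {b} (¬Ya , ¬Yb , a≢b , h) = ¬Ya ∘ proj₁ , ¬Yb ∘ proj₁ , a≢b , lift h
          where
          a≢w : a ≢ w
          a≢w refl = ¬Ya Yw
          b≢w : b ≢ w
          b≢w refl = ¬Yb Yw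
          lift : R a b ⊎ (b ≡ y × ∃ λ c → Y c × R a c) → R₁ a b ⊎ (b ≡ y × ∃ λ c → Y₁ c × R₁ a c)
          lift (inj₁ e) = inj₁ (a≢w , b≢w , a≢b , inj₁ e)
          lift (inj₂ (p , c , Yc , e)) with c ≟ w
          ... | yes refl = inj₁ (a≢w , b≢w , a≢b , inj₂ (p , e))
          ... | no c≢w = inj₂ (p , c , (Yc , c≢w) , a≢w , c≢w , (λ { refl → ¬Ya Yc }) , inj₁ e)

  rootOf : ∀ {R l} → Elim R l → V
  rootOf (root r) = r
  rootOf (leaf _ _ _ _ e) = rootOf e

  rootOf∈ : ∀ {R l} (e : Elim R l) → rootOf e ∈ l
  rootOf∈ (root r) = here refl
  rootOf∈ (leaf _ _ _ _ e) = there (rootOf∈ e)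

  record Rooted (R : Rel V 0ℓ) (A : Pred V 0ℓ) (r : V) : Set₁ where
    field
      {l}      : List V
      elim     : Elim R l
      rooted   : rootOf elim ≡ r
      complete : ∀ {x} → A x → x ∈ l
      sound    : ∀ {x} → x ∈ l → A x

  record State (R : Rel V 0ℓ) (A : Pred V 0ℓ) : Set where
    field
      R?     : Decidable R
      A?     : Decidable₁ A
      irr    : ∀ {x} → ¬ R x x
      R⊆A    : ∀ {x y} → R x y → A x × A y
      strong : Str R A

  State-flip : ∀ {R A} → State R A → State (flip R) A
  State-flip s = record { R? = flip R? ; A? = A? ; irr = irr ; R⊆A = λ e → proj₂ (R⊆A e) , proj₁ (R⊆A e) ; strong = Str-flip strong }
    where open State s

  -- A vertex y separates Y from the rest of A: edges out of Y lead only
  -- to Y and y.  Contracting Y into y then keeps the traces of strong sets.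

  module Half {R : Rel V 0ℓ} {A : Pred V 0ℓ} (st : State R A) {Y : Pred V 0ℓ} (Y? : Decidable₁ Y) {y : V} (Ay : A y) (Y⊆A : ∀ {c} → Y c → A c) (¬Yy : ¬ Y y)
              (closed : ∀ {c d} → Y c → R c d → Y d ⊎ d ≡ y) where

    open State st

    A′ : Pred V 0ℓ
    A′ x = A x × ¬ Y x

    R′ : Rel V 0ℓ
    R′ = Contracted Y y R

    -- A walk that has entered `Y` can leave it only at `y`. Such an excursion shrinks to an edge
    -- into `y`, or vanishes if it started at `y`, and it shows that `y` lies in the set.
    trace-walk : ∀ {S : Pred V 0ℓ} {a b} → Walk (R ⇂ S) a b → A′ b →
                 (A′ a → Walk (R′ ⇂ (λ x → S x × A′ x)) a b) × (Y a → S y × Walk (R′ ⇂ (λ x → S x × A′ x)) y b)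
    trace-walk ε (_ , ¬Yb) = (λ _ → ε) , λ Yb → contradiction Yb ¬Yb
    trace-walk {S} {a} (_◅_ {j = c} (within Sa Sc e) w) A′b = outside , inside
      where
      Ac = proj₂ (R⊆A e)
      rec = trace-walk w A′b
      outside : A′ a → _
      outside A′a@(_ , ¬Ya) with Y? c
      ... | no ¬Yc = within (Sa , A′a) (Sc , Ac , ¬Yc) (¬Ya , ¬Yc , (λ { refl → irr e }) , inj₁ e) ◅ proj₁ rec (Ac , ¬Yc)
      ... | yes Yc with proj₂ rec Yc | a ≟ y
      ...   | Sy , p | yes refl = p
      ...   | Sy , p | no a≢y = within (Sa , A′a) (Sy , Ay , ¬Yy) (¬Ya , ¬Yy , a≢y , inj₂ (refl , c , Yc , e)) ◅ p
      inside : Y a → _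
      inside Ya with closed Ya e
      ... | inj₁ Yc = proj₂ rec Yc
      ... | inj₂ refl = Sc , proj₁ rec (Ay , ¬Yy)

    trace : ∀ {S} → Str R S → Str R′ (λ x → S x × A′ x)
    trace s (Sx , A′x) (Sz , A′z) = proj₁ (trace-walk (s Sx Sz) A′z) A′x

    bridge : ∀ {S x z} → Str R S → S x → Y x → S z → A′ z → S y
    bridge s Sx Yx Sz A′z = proj₁ (proj₂ (trace-walk (s Sx Sz) A′z) Yx)

    state : State R′ A′
    state = record
      { R? = λ a b → ¬? (Y? a) ×-dec (¬? (Y? b) ×-dec (¬? (a ≟ b) ×-dec (R? a b ⊎-dec ((b ≟ y) ×-dec any? λ c → Y? c ×-dec R? a c))))
      ; A? = λ x → A? x ×-dec ¬? (Y? x)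
      ; irr = λ (_ , _ , x≢x , _) → x≢x refl
      ; R⊆A = λ { (¬Ya , ¬Yb , _ , inj₁ e) → (proj₁ (R⊆A e) , ¬Ya) , (proj₂ (R⊆A e) , ¬Yb)
                ; (¬Ya , ¬Yb , _ , inj₂ (refl , _ , _ , e)) → (proj₁ (R⊆A e) , ¬Ya) , (Ay , ¬Yb) }
      ; strong = λ A′x A′z → Star.map (⇂-mono id proj₂) (trace strong (proj₁ A′x , A′x) (proj₁ A′z , A′z)) }

    minor : R′ ≼ R
    minor = Contracted-≼ Y? R? irr ¬Yy closed λ Yc → Star.map step (strong (Y⊆A Yc) Ay)

  -- The second order is continued on top of the first, which already contains its root `y`. A
  -- strong set joining a later vertex to the first part contains `y`, so the parent chosen within
  -- the second part still lies in it.
  glue : ∀ {R R₁ R₂ A A₁ A₂ y r} →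
         (∀ {S} → Str R S → Str R₁ (λ x → S x × A₁ x)) → (∀ {S} → Str R S → Str R₂ (λ x → S x × A₂ x)) →
         (∀ {S x z} → Str R S → S x → A₂ x → S z → A₁ z → S y) →
         (∀ {x} → A x → A₁ x ⊎ A₂ x) → (∀ {x} → A₁ x → A x) → (∀ {x} → A₂ x → A x) →
         (∀ {x} → A₁ x → A₂ x → x ≡ y) → A₁ y → A₂ y → Rooted R₁ A₁ r → Rooted R₂ A₂ y → Rooted R A r
  glue {R} {R₁} {R₂} {A} {A₁} {A₂} {y} {r} trace₁ trace₂ bridge split sub₁ sub₂ only A₁y A₂y o₁ o₂ =
    let g = attach O₂.elim O₂.rooted O₂.sound in record
      { elim = Glued.e g ; rooted = Glued.r≡ g
      ; complete = λ Ax → [ (λ p → Glued.in₁ g (O₁.complete p)) , (λ p → Glued.in₂ g (O₂.complete p)) ]′ (split Ax)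
      ; sound = λ i → [ (λ p → sub₁ (O₁.sound p)) , (λ p → sub₂ (O₂.sound p)) ]′ (Glued.out g i) }
    where
    module O₁ = Rooted o₁
    module O₂ = Rooted o₂
    convert : ∀ {l} (e : Elim R₁ l) → (∀ {x} → x ∈ l → A₁ x) → Σ (Elim R l) λ e′ → rootOf e′ ≡ rootOf e
    convert (root r) _ = root r , refl
    convert (leaf p p∈ x∉ dom e) snd with convert e (snd ∘ there)
    ... | e′ , q = leaf p p∈ x∉ (λ s Sx z∈ Sz → proj₁ (dom (trace₁ s) (Sx , snd (here refl)) z∈ (Sz , snd (there z∈)))) e′ , q
    record Glued (l₂ : List V) : Set₁ where
      field
        {l} : List V
        e   : Elim R l
        r≡  : rootOf e ≡ r
        in₁ : ∀ {x} → x ∈ O₁.l → x ∈ l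
        in₂ : ∀ {x} → x ∈ l₂ → x ∈ l
        out : ∀ {x} → x ∈ l → x ∈ O₁.l ⊎ x ∈ l₂
    attach : ∀ {l₂} (e : Elim R₂ l₂) → rootOf e ≡ y → (∀ {x} → x ∈ l₂ → A₂ x) → Glued l₂
    attach (root .y) refl _ = record
      { e = proj₁ (convert O₁.elim O₁.sound) ; r≡ = trans (proj₂ (convert O₁.elim O₁.sound)) O₁.rooted
      ; in₁ = id ; in₂ = λ { (here refl) → O₁.complete A₁y } ; out = inj₁ }
    attach (leaf {x} {l₂} p p∈ x∉ dom e) e≡y snd = record
      { e = leaf p (in₂ p∈) fresh dom′ G.e ; r≡ = r≡
      ; in₁ = there ∘ in₁ ; in₂ = λ { (here p) → here p ; (there i) → there (in₂ i) }
      ; out = λ { (here p) → inj₂ (here p) ; (there i) → [ inj₁ , inj₂ ∘ there ]′ (out i) } }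
      where
      module G = Glued (attach e e≡y (snd ∘ there))
      open G hiding (e)
      y∈ : y ∈ l₂
      y∈ = subst (_∈ l₂) e≡y (rootOf∈ e)
      fresh : x ∉ G.l
      fresh i with out i
      ... | inj₁ j = x∉ (subst (_∈ l₂) (sym (only (O₁.sound j) (snd (here refl)))) y∈)
      ... | inj₂ j = x∉ j
      dom′ : ∀ {P} → Str R P → P x → ∀ {z} → z ∈ G.l → P z → P p
      dom′ s Px z∈ Pz with out z∈
      ... | inj₁ j = proj₁ (dom (trace₂ s) (Px , snd (here refl)) y∈ (bridge s Px (snd (here refl)) Pz (O₁.sound j) , A₂y))
      ... | inj₂ j = proj₁ (dom (trace₂ s) (Px , snd (here refl)) j (Pz , snd (there j)))

  AllRooted : Rel V 0ℓ → Pred V 0ℓ → Set₁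
  AllRooted R A = ∀ r → A r → Rooted R A r

  Outcome : Rel V 0ℓ → Pred V 0ℓ → Set₁
  Outcome R A = AllRooted R A ⊎ Bad R

  size : {A : Pred V 0ℓ} → Decidable₁ A → ℕ
  size A? = count A? (allFin n)

  pairs : List (V × V)
  pairs = cartesianProduct (allFin n) (allFin n)

  edgeCount : {R : Rel V 0ℓ} → Decidable R → ℕ
  edgeCount {R} R? = count {P = uncurry R} (uncurry R?) pairs

  -- Apart from `y`, the set `Y` is closed under outgoing edges and the remainder `X` under incoming
  -- ones. Contracting `Y` into `y` therefore fits `Half` as it stands, and contracting `X` fits it
  -- after all edges are reversed.
  module Cut {R : Rel V 0ℓ} {A : Pred V 0ℓ} (st : State R A) {y : V} (Ay : A y) {Y : Pred V 0ℓ} (Y? : Decidable₁ Y) {s t : V} (Ys : Y s) (¬Yt : ¬ Y t) (At : A t) (t≢y : t ≢ y)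
             (Y⊆ : ∀ {c} → Y c → A c × c ≢ y) (closed : ∀ {c d} → Y c → R c d → d ≢ y → Y d)
             (ih : ∀ {R′ : Rel V 0ℓ} {A′ : Pred V 0ℓ} (st′ : State R′ A′) → size (State.A? st′) < size (State.A? st) → Outcome R′ A′) where

    open State st

    X : Pred V 0ℓ
    X x = A x × x ≢ y × ¬ Y x

    X? : Decidable₁ X
    X? x = A? x ×-dec (¬? (x ≟ y) ×-dec ¬? (Y? x))

    ¬Yy : ¬ Y y
    ¬Yy Yy = proj₂ (Y⊆ Yy) refl

    closedY : ∀ {c d} → Y c → R c d → Y d ⊎ d ≡ y
    closedY {d = d} Yc e with d ≟ y
    ... | yes p = inj₂ p
    ... | no d≢y = inj₁ (closed Yc e d≢y)

    closedX : ∀ {c d} → X c → R d c → X d ⊎ d ≡ y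
    closedX {d = d} (Ac , c≢y , ¬Yc) e with d ≟ y | Y? d
    ... | yes p | _ = inj₂ p
    ... | no d≢y | no ¬Yd = inj₁ (proj₁ (R⊆A e) , d≢y , ¬Yd)
    ... | no d≢y | yes Yd = contradiction (closed Yd e c≢y) ¬Yc

    module HX = Half st Y? Ay (proj₁ ∘ Y⊆) ¬Yy closedY
    module HY = Half (State-flip st) X? Ay proj₁ (λ (_ , y≢y , _) → y≢y refl) closedX

    HY-in : ∀ {x} → HY.A′ x → x ≡ y ⊎ Y x
    HY-in {x} (Ax , ¬Xx) with x ≟ y | Y? x
    ... | yes p | _ = inj₁ p
    ... | _ | yes Yx = inj₂ Yx
    ... | no x≢y | no ¬Yx = contradiction (Ax , x≢y , ¬Yx) ¬Xx

    Y-in : ∀ {x} → Y x → HY.A′ x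
    Y-in Yx = proj₁ (Y⊆ Yx) , λ (_ , _ , ¬Yx) → ¬Yx Yx

    y-inX : HX.A′ y
    y-inX = Ay , ¬Yy

    y-inY : HY.A′ y
    y-inY = Ay , λ (_ , y≢y , _) → y≢y refl

    common : ∀ {x} → HX.A′ x → HY.A′ x → x ≡ y
    common (_ , ¬Yx) q with HY-in q
    ... | inj₁ p = p
    ... | inj₂ Yx = contradiction Yx ¬Yx

    split : ∀ {x} → A x → HX.A′ x ⊎ HY.A′ x
    split {x} Ax with Y? x
    ... | yes Yx = inj₂ (Y-in Yx)
    ... | no ¬Yx = inj₁ (Ax , ¬Yx)

    traceY : ∀ {S} → Str R S → Str (flip HY.R′) (λ x → S x × HY.A′ x)
    traceY s = Str-flip (HY.trace (Str-flip s))

    through : ∀ {S x z} → Str R S → S x → HY.A′ x → S z → HX.A′ z → S y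
    through {S} s Sx A′x Sz A′z with HY-in A′x
    ... | inj₁ refl = Sx
    ... | inj₂ Yx = HX.bridge s Sx Yx Sz A′z

    outcome : Outcome R A
    outcome with ih HX.state (count-< (State.A? HX.state) A? proj₁ (∈-allFin s) (proj₁ (Y⊆ Ys)) (λ (_ , ¬Ys) → ¬Ys Ys))
               | ih (State-flip HY.state) (count-< (State.A? HY.state) A? proj₁ (∈-allFin t) At (λ (_ , ¬Xt) → ¬Xt (At , t≢y , ¬Yt)))
    ... | inj₂ bad | _ = inj₂ (Bad-≼ HX.minor bad)
    ... | _ | inj₂ bad = inj₂ (Bad-≼ (≼-flip HY.minor) bad)
    ... | inj₁ oX | inj₁ oY = inj₁ rooted
      where
      rooted : AllRooted R A
      rooted r Ar with Y? r
      ... | no ¬Yr = glue HX.trace traceY through split proj₁ proj₁ common y-inX y-inY (oX r (Ar , ¬Yr)) (oY y y-inY)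
      ... | yes Yr = glue traceY HX.trace (λ s Sx p Sz q → through s Sz q Sx p) (swap ∘ split) proj₁ proj₁ (λ p q → common q p) y-inY y-inX
                       (oY r (Y-in Yr)) (oX y y-inX)

-- The induction

firstFailure : ∀ {m} {P Q : Pred (Fin m) 0ℓ} → (∀ i → P i ⊎ Q i) → (∀ i → P i) ⊎ ∃ Q
firstFailure {zero}  f = inj₁ λ ()
firstFailure {suc m} f with f zero | firstFailure (f ∘ suc)
... | inj₂ q | _ = inj₂ (zero , q)
... | inj₁ p | inj₂ (i , q) = inj₂ (suc i , q)
... | inj₁ p | inj₁ h = inj₁ λ { zero → p ; (suc i) → h i }

module _ {n : ℕ} where

  private V = Fin n

  -- The three meeting points of an obstruction are distinct, so each of
  -- them has an outgoing edge.

  Obs-inside : ∀ {R} {A₀ : Pred V 0ℓ} → (∀ {x y} → R x y → A₀ x × A₀ y) → (o : Obs {n} R) → let open Obs o in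
               A₀ (proj₁ AB) × A₀ (proj₁ BC) × A₀ (proj₁ CA)
  Obs-inside {R} {A₀} R⊆A o with Obs.AB o | Obs.BC o | Obs.CA o
  ... | x , Ax , Bx | y , By , Cy | z , Cz , Az =
    leave (strA Ax Az) (λ { refl → none Ax Bx Cz }) , leave (strB By Bx) (λ { refl → none Ax Bx Cy }) , leave (strC Cz Cy) λ { refl → none Az By Cz }
    where
    open Obs o
    leave : ∀ {P x y} → Walk (R ⇂ P) x y → x ≢ y → A₀ x
    leave ε x≢x = contradiction refl x≢x
    leave (e ◅ _) _ = proj₁ (R⊆A (step e))

  module Step {R : Rel V 0ℓ} {A : Pred V 0ℓ} (st : State R A) {x₀ : V} (Ax₀ : A x₀)
              (fewer-vertices : ∀ {R′ : Rel V 0ℓ} {A′ : Pred V 0ℓ} (st′ : State R′ A′) → size (State.A? st′) < size (State.A? st) → Outcome R′ A′)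
              (fewer-edges : ∀ {R′ : Rel V 0ℓ} (st′ : State R′ A) → edgeCount (State.R? st′) < edgeCount (State.R? st) → Outcome R′ A) where

    open State st

    Remote : V → V → V → Set
    Remote x y z = A z × z ≢ x × z ≢ y

    remote? : ∀ x y → Decidable₁ (Remote x y)
    remote? x y z = A? z ×-dec (¬? (z ≟ x) ×-dec ¬? (z ≟ y))

    small : ∀ {x y} → (∀ z → ¬ Remote x y z) → AllRooted R A
    small {x} {y} none r Ar with any? (λ s → A? s ×-dec ¬? (s ≟ r))
    ... | no single = record
      { elim = root r ; rooted = refl
      ; complete = λ {z} Az → here (decidable-stable (z ≟ r) λ z≢r → single (z , Az , z≢r))
      ; sound = λ { (here refl) → Ar } }
    ... | yes (s , As , s≢r) = record
      { elim = leaf {l = r ∷ []} r (here refl) (λ { (here p) → s≢r p }) (λ { _ _ (here refl) Pr → Pr }) (root r) ; rooted = refl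
      ; complete = λ {z} Az → pick (member Az) (member As) (member Ar)
      ; sound = λ { (here refl) → As ; (there (here refl)) → Ar } }
      where
      member : ∀ {z} → A z → z ≡ x ⊎ z ≡ y
      member {z} Az with z ≟ x | z ≟ y
      ... | yes p | _ = inj₁ p
      ... | _ | yes p = inj₂ p
      ... | no p | no q = contradiction (Az , p , q) (none z)
      pick : ∀ {z} → z ≡ x ⊎ z ≡ y → s ≡ x ⊎ s ≡ y → r ≡ x ⊎ r ≡ y → z ∈ s ∷ r ∷ []
      pick (inj₁ refl) (inj₁ refl) _ = here refl
      pick (inj₁ refl) _ (inj₁ refl) = there (here refl)
      pick (inj₂ refl) (inj₂ refl) _ = here refl
      pick (inj₂ refl) _ (inj₂ refl) = there (here refl)
      pick _ (inj₁ refl) (inj₁ refl) = contradiction refl s≢r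
      pick _ (inj₂ refl) (inj₂ refl) = contradiction refl s≢r

    Cuts : V → Set
    Cuts y = A y × ∃₂ λ (l : List V) s → ∃ λ t → s ∈ l × t ∉ l × A t × t ≢ y × (∀ {c} → c ∈ l → A c × c ≢ y) ×
             (∀ {c d} → c ∈ l → R c d → d ≢ y → d ∈ l)

    Robust : V → Set
    Robust y = A y → Str R (λ x → A x × x ≢ y)

    module Deleting (y : V) where

      rest? : Decidable₁ (λ x → A x × x ≢ y)
      rest? x = A? x ×-dec ¬? (x ≟ y)

      S? : Decidable (R ⇂ (λ x → A x × x ≢ y))
      S? a b with rest? a | rest? b | R? a b
      ... | yes p | yes q | yes e = yes (within p q e)
      ... | no ¬p | _ | _ = no (¬p ∘ source)
      ... | _ | no ¬q | _ = no (¬q ∘ target)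
      ... | _ | _ | no ¬e = no (¬e ∘ step)

      cut : A y → ∀ {s t} → A s × s ≢ y → A t × t ≢ y → ¬ Walk (R ⇂ (λ x → A x × x ≢ y)) s t → Cuts y
      cut Ay {s} {t} s° t° ¬w with saturate S? s
      ... | l , g , closed = Ay , l , s , t , Grown-root g , (λ t∈ → ¬w (Star.map step (Grown-walk g t∈))) , proj₁ t° , proj₂ t° ,
            inside , λ c∈ e d≢y → closed c∈ (within (inside c∈) (proj₂ (R⊆A e) , d≢y) e)
        where
        inside : ∀ {c} → c ∈ l → A c × c ≢ y
        inside c∈ = walk-end (Star.map step (Grown-walk g c∈)) s°

      robustOrCut : Robust y ⊎ Cuts y
      robustOrCut with A? y
      ... | no ¬Ay = inj₁ λ Ay → contradiction Ay ¬Ay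
      ... | yes Ay with any? (λ s → any? λ t → rest? s ×-dec (rest? t ×-dec ¬? (walk? S? s t)))
      ...   | no none = inj₁ λ _ {a} {b} a° b° →
                decidable-stable (walk? S? a b) λ ¬w → none (a , b , a° , b° , ¬w)
      ...   | yes (s , t , s° , t° , ¬w) = inj₂ (cut Ay s° t° ¬w)

    module _ (third : ∀ x y → ∃ (Remote x y)) (robust : ∀ y → Robust y) where

      module _ {x z : V} (xz : R x z) where

        R₁ : Rel V 0ℓ
        R₁ a b = R a b × ¬ (a ≡ x × b ≡ z)

        R₁? : Decidable R₁
        R₁? a b = R? a b ×-dec ¬? ((a ≟ x) ×-dec (b ≟ z))

        fewer : edgeCount R₁? < edgeCount R?
        fewer = count-< (uncurry R₁?) (uncurry R?) proj₁ (∈-cartesianProduct⁺ (∈-allFin x) (∈-allFin z)) xz λ (_ , h) → h (refl , refl)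

        -- The deleted edge is bypassed through a third vertex t, first
        -- avoiding z and then avoiding x.

        bypass : Walk (R₁ ⇂ A) x z
        bypass with third x z
        ... | t , At , t≢x , t≢z =
          Star.map (λ (within (p , _) (q , q≢z) e) → within p q (e , λ h → q≢z (proj₂ h)))
            (robust z Az (Ax , λ { refl → irr xz }) (At , t≢z))
          ◅◅ Star.map (λ (within (p , p≢x) (q , _) e) → within p q (e , λ h → p≢x (proj₁ h)))
            (robust x Ax (At , t≢x) (Az , λ { refl → irr xz }))
          where
          Ax = proj₁ (R⊆A xz)
          Az = proj₂ (R⊆A xz)

        detour : ∀ {a b} → (R ⇂ A) a b → Walk (R₁ ⇂ A) a b
        detour {a} {b} (within p q e) with (a ≟ x) ×-dec (b ≟ z)
        ... | yes (refl , refl) = bypass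
        ... | no h = within p q (e , h) ◅ ε

        state₁ : State R₁ A
        state₁ = record { R? = R₁? ; A? = A? ; irr = irr ∘ proj₁ ; R⊆A = R⊆A ∘ proj₁
                        ; strong = λ p q → Star.concat (Star.map detour (strong p q)) }

        missing′ : Obs R₁ → Bad R
        missing′ o with fewer-edges state₁ fewer
        ... | inj₂ bad = Bad-≼ (delete proj₁) bad
        ... | inj₁ all = contradiction (complete c) (Elim⇒¬Obs elim o (complete a) (complete b))
          where
          open Rooted (all x₀ Ax₀)
          ins = Obs-inside (λ e → R⊆A (proj₁ e)) o
          a = proj₁ ins
          b = proj₁ (proj₂ ins)
          c = proj₂ (proj₂ ins)

      twoConnected : TwoConnected R A (Bad R)
      twoConnected = record
        { A? = A? ; irr = irr ; R⊆A = R⊆A ; robust = λ {y} → robust y ; third = third ; missing = missing′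
        ; bicycleBad = λ ℓ 3≤ℓ m → R , delete id , inj₁ (ℓ , 3≤ℓ , m)
        ; A₄Bad = λ m → R , delete id , inj₂ m }

    outcome : Outcome R A
    outcome with any? (λ x → any? λ y → all? λ z → ¬? (remote? x y z))
    ... | yes (x , y , none) = inj₁ (small none)
    ... | no big with firstFailure Deleting.robustOrCut
    ...   | inj₂ (y , Ay , l , s , t , s∈ , t∉ , At , t≢y , l⊆ , closed) =
            Cut.outcome st Ay (_∈? l) s∈ t∉ At t≢y l⊆ closed fewer-vertices
    ...   | inj₁ robust = inj₂ (Crossings.twoConnected-Bad (twoConnected third robust) x₀ Ax₀)
      where
      third : ∀ x y → ∃ (Remote x y)
      third x y = decidable-stable (any? (remote? x y)) λ h → big (x , y , λ z r → h (z , r))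

  -- Lexicographic induction on the numbers of vertices and edges. The bound `m` is kept apart from
  -- the vertex count because two states with the same `A` may carry different decision procedures,
  -- whose counts are compared by `count-≤`.
  dichotomy : ∀ {R A} → State R A → Outcome R A
  dichotomy st₀ = onSize st₀ (<-wellFounded _) ℕ.≤-refl
    where
    onEdges : ∀ {m} → (∀ {R A} (st : State R A) → size (State.A? st) < m → Outcome R A) →
              ∀ {R A} (st : State R A) {e} → Acc _<_ e → size (State.A? st) ≤ m → edgeCount (State.R? st) ≤ e → Outcome R A
    onEdges smaller st (acc re) ≤m ≤e with any? (State.A? st)
    ... | no none = inj₁ λ r Ar → contradiction (r , Ar) none
    ... | yes (x₀ , Ax₀) = Step.outcome st Ax₀
      (λ st′ lt → smaller st′ (ℕ.<-≤-trans lt ≤m))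
      (λ st′ lt → onEdges smaller st′ (re (ℕ.<-≤-trans lt ≤e))
                    (ℕ.≤-trans (count-≤ (State.A? st′) (State.A? st) id (allFin n)) ≤m) ℕ.≤-refl)
    onSize : ∀ {R A} (st : State R A) {m} → Acc _<_ m → size (State.A? st) ≤ m → Outcome R A
    onSize st (acc rs) ≤m = onEdges (λ st′ lt → onSize st′ (rs lt) ℕ.≤-refl) st (<-wellFounded _) ≤m ℕ.≤-refl

-- The equivalence of the three conditions

hasOutEdges-bicycle : ∀ ℓ (3≤ℓ : 3 ≤ ℓ) → HasOutEdges (bicycle ℓ 3≤ℓ)
hasOutEdges-bicycle ℓ 3≤ℓ i with ℕ.m≤n⇒m<n∨m≡n (toℕ<n i)
... | inj₁ i+1<ℓ = fromℕ< i+1<ℓ , bicycle-edge⁺ 3≤ℓ {i} {fromℕ< i+1<ℓ} (inj₁ (inj₁ (toℕ-fromℕ< i+1<ℓ)))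
... | inj₂ i+1≡ℓ = fromℕ< 0<ℓ , bicycle-edge⁺ 3≤ℓ {i} {fromℕ< 0<ℓ} (inj₁ (inj₂ (i+1≡ℓ , toℕ-fromℕ< 0<ℓ)))
  where
  0<ℓ : 0 < ℓ
  0<ℓ = ℕ.≤-trans (s≤s z≤n) 3≤ℓ

hasOutEdges-A₄ : HasOutEdges A₄
hasOutEdges-A₄ 0F = 1F , _
hasOutEdges-A₄ 1F = 2F , _
hasOutEdges-A₄ 2F = 3F , _
hasOutEdges-A₄ 3F = 0F , _

NoForbiddenMinor : ∀ {n} → Digraph n → Set
NoForbiddenMinor D = (∀ ℓ (3≤ℓ : 3 ≤ ℓ) → ¬ ButterflyMinor (bicycle ℓ 3≤ℓ) D) × ¬ ButterflyMinor A₄ D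

module _ {n : ℕ} (D : Digraph n) where

  Elim⇒NoForbiddenMinor : EliminationOrder D → NoForbiddenMinor D
  Elim⇒NoForbiddenMinor (l , e , all) =
    (λ ℓ 3≤ℓ m → impossible (ButterflyMinor-Obs {D′ = bicycle ℓ 3≤ℓ} {D = D} m (bicycle-Obs ℓ 3≤ℓ))) , λ m → impossible (ButterflyMinor-Obs {D′ = A₄} {D = D} m A₄-Obs)
    where
    impossible : ¬ Obs (Edge D)
    impossible o = Elim⇒¬Obs e o (all _) (all _) (all _)

  NoForbiddenMinor⇒Elim : StronglyConnected D → NoForbiddenMinor D → EliminationOrder D
  NoForbiddenMinor⇒Elim strong (noBicycle , noA₄) = conclude (dichotomy st)
    where
    st : State (Edge D) (λ _ → ⊤)
    st = record
      { R? = λ u v → T? (Digraph.adj D u v) ; A? = λ _ → yes tt ; irr = Digraph.loopless D ; R⊆A = λ _ → tt , tt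
      ; strong = λ {x} {y} _ _ → Star.map (within tt tt) (proj₁ (strong x y)) }
    conclude : Outcome (Edge D) (λ _ → ⊤) → EliminationOrder D
    conclude (inj₁ all) = let open Rooted (all (fin D) tt) in l , elim , λ x → complete {x} tt
    conclude (inj₂ (R′ , R′≼D , inj₁ (ℓ , 3≤ℓ , m))) =
      contradiction (≼-ButterflyMinor (bicycle ℓ 3≤ℓ) (hasOutEdges-bicycle ℓ 3≤ℓ) D R′≼D m) (noBicycle ℓ 3≤ℓ)
    conclude (inj₂ (R′ , R′≼D , inj₂ m)) = contradiction (≼-ButterflyMinor A₄ hasOutEdges-A₄ D R′≼D m) noA₄

theorem4p2 : ∀ {n : ℕ} (D : Digraph n) → 2 ≤ n → StronglyConnected D →
    (HasDirectedTreewidth D 1 ⇔ IsHypertree (cycleHypergraph D))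
    × (IsHypertree (cycleHypergraph D) ⇔
    ((∀ ℓ (3≤ℓ : 3 ≤ ℓ) → ¬ ButterflyMinor (bicycle ℓ 3≤ℓ) D) × ¬ ButterflyMinor A₄ D))
theorem4p2 D 2≤n strong =
    mk⇔ (λ ((𝒯 , width≡1) , _) → hypertree (width≤1⇒Elim D 𝒯 (ℕ.≤-reflexive width≡1)))
        (λ h → let _ , e , all = IsHypertree⇒Elim D h in Rank⇒dtw1 D 2≤n strong (rank e all))
  , mk⇔ (Elim⇒NoForbiddenMinor D ∘ IsHypertree⇒Elim D)
        (hypertree ∘ NoForbiddenMinor⇒Elim D strong)
  where
  hypertree : EliminationOrder D → IsHypertree (cycleHypergraph D)
  hypertree (_ , e , all) = Rank⇒IsHypertree D (rank e all)
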